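{- Let $P$ be an integer with $3\nmid P$, and let $\delta\ge 1$ be the integer with $3^{\delta}\,\Vert\, P^2+2$. Then the following hold. 1) Suppose $\delta=1$ and $k\in\mathbb{N}$. Then for every residue $b$ modulo $3^k$, $$v_{u}(3^k,b)=\begin{cases}3^{\lfloor k/2\rfloor}+2, & \text{if }b\equiv\pm u_{2\cdot 3^{2\lfloor(k-1)/4\rfloor+1}}\pmod{3^k},\\ 2\cdot 3^l+2, &\text{if }b\equiv\pm u_{2\cdot 3^{l-1}}\pmod{3^{2l+1}}\text{ for some }l\in\{1,\ldots,\lfloor(k-1)/2\rfloor\},\\ 2, &\text{otherwise,}\end{cases}$$ and $$v_{v}(3^k,b)=\begin{cases}3^{\lfloor k/2\rfloor}+2, & \text{if }b\equiv\pm 2\pmod{3^k},\\ 2\cdot 3^l+2, &\text{if }b\equiv\pm v_{4\cdot 3^{l-1}}\pmod{3^{2l+1}}\text{ for some }l\in\{1,\ldots,\lfloor(k-1)/2\rfloor\},\\ 2, &\text{otherwise.}\end{cases}$$ 2) Suppose $\delta\geq 2$ and $k\in\mathbb{N}$, $k\geq 2\delta-1$. Then for every residue $b$ modulo $3^k$, $$v_{u}(3^k,b)=\begin{cases}3^{\lfloor k/2\rfloor}, & \text{if }b\equiv\pm u_{2\cdot 3^{2\lfloor(k-2\delta+1)/4\rfloor+1}}\pmod{3^k},\\ 2\cdot 3^l, &\text{if }b\equiv\pm u_{2\cdot 3^{l-\delta}}\pmod{3^{2l+1}}\text{ for some }l\in\{\delta,\ldots,\lfloor(k-1)/2\rfloor\},\\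 2, &\text{if }b\equiv 0,\pm 1\pmod{3^\delta},\\ 0, &\text{otherwise,}\end{cases}$$ and $$v_{v}(3^k,b)=\begin{cases}3^{\lfloor k/2\rfloor}, & \text{if }b\equiv\pm 2\pmod{3^k},\\ 2\cdot 3^l, &\text{if }b\equiv\pm v_{4\cdot 3^{l-\delta}}\pmod{3^{2l+1}}\text{ for some }l\in\{\delta,\ldots,\lfloor(k-1)/2\rfloor\},\\ 2, &\text{if }b\equiv 0,\pm P\pmod{3^{\delta}},\\ 0, &\text{otherwise.}\end{cases}$$ 3) Suppose $\delta\geq 2$ and $k\in\mathbb{N}$, $\delta\leq k<2\delta-1$. Then for every residue $b$ modulo $3^k$, $$v_{u}(3^k,b)=\begin{cases}3^{k-\delta}, & \text{if }b\equiv\pm P\pmod{3^k},\\ 2, &\text{if }b\equiv 0,\pm 1\pmod{3^\delta},\\ 0, &\text{otherwise,}\end{cases}$$ and $$v_{v}(3^k,b)=\begin{cases}3^{k-\delta}, & \text{if }b\equiv\pm 2\pmod{3^k},\\ 2, &\text{if }b\equiv 0,\pm P\pmod{3^{\delta}},\\ 0, &\text{otherwise.}\end{cases}$$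
   Context: For an integer $P$, the sequences $(u_n)$ and $(v_n)$ are defined by $u_0=0$, $u_1=1$, $u_n=Pu_{n-1}+u_{n-2}$ and $v_0=2$, $v_1=P$, $v_n=Pv_{n-1}+v_{n-2}$ for $n\ge 2$. For a prime $p$, $p^k\,\Vert\, n$ means that $p^k$ is the highest power of $p$ dividing $n$. $\mathbb{N}$ is the set of positive integers. For $m\in\mathbb{N}$, $h_u(m)$ (resp. $h_v(m)$) is the length of the shortest period of $(u_n)$ (resp. $(v_n)$) modulo $m$, i.e. the least positive integer $h$ with $u_{n+h}\equiv u_n \pmod m$ (resp. $v_{n+h}\equiv v_n\pmod m$) for all $n\ge 0$. For an integer $b$, the two-argument counting functions (not to be confused with the terms $v_n$) are $v_u(m,b)=\#\{n : 0\le n<h_u(m),\ u_n\equiv b\pmod m\}$ and $v_v(m,b)=\#\{n : 0\le n<h_v(m),\ v_n\equiv b\pmod m\}$. -}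

module Defs where

open import Data.Fin.Base using (Fin; toℕ; fromℕ<; combine)
open import Data.Fin.Properties using (pigeonhole; combine-injective; fromℕ<-injective)
open import Data.Integer.Base using (ℤ; +_; 0ℤ; 1ℤ; _+_; _*_; _-_; -_)
open import Data.Integer.DivMod using (_%ℕ_; _/ℕ_; n%ℕd<d; a≡a%ℕn+[a/ℕn]*n)
open import Data.Integer.Divisibility.Signed using (_∣_; _∣?_; divides; ∣m∣n⇒∣m+n; ∣m∣n⇒∣m-n; ∣n⇒∣m*n)
open import Data.Integer.Tactic.RingSolver using (solve-∀)
open import Data.List.Base using (length; filter; upTo)
open import Data.Nat.Base as ℕ using (ℕ; zero; suc; _≤_; _<_; NonZero; _^_)
open import Data.Nat.Induction using (<-rec)
open import Data.Nat.Properties using (_≤?_; ≮⇒≥; anyUpTo?; m<n⇒0<n∸m; m+[n∸m]≡n; <⇒≤; n<1+n)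
open import Data.Product.Base using (∃; _×_; _,_; proj₁; proj₂)
open import Data.Sum.Base using (_⊎_)
open import Relation.Binary.PropositionalEquality using (_≡_; refl; sym; trans; cong; cong₂; subst)
open import Relation.Nullary using (¬_; Dec; yes; no)
open import Relation.Nullary.Decidable using (map′; _×-dec_)
open import Relation.Unary using (Decidable)

infix 4 _≡_[mod_] _≡±_[mod_] _≡?_[mod_]

_≡_[mod_] : ℤ → ℤ → ℕ → Set
a ≡ b [mod m ] = + m ∣ a - b

_≡±_[mod_] : ℤ → ℤ → ℕ → Set
a ≡± b [mod m ] = a ≡ b [mod m ] ⊎ a ≡ - b [mod m ]

_≡?_[mod_] : ∀ a b m → Dec (a ≡ b [mod m ])
a ≡? b [mod m ] = + m ∣? a - b

-- p ^ k ∥ n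
ExactPower : ℕ → ℕ → ℤ → Set
ExactPower p k n = + (p ^ k) ∣ n × ¬ (+ (p ^ suc k) ∣ n)

u : ℤ → ℕ → ℤ
u P zero          = 0ℤ
u P (suc zero)    = 1ℤ
u P (suc (suc n)) = P * u P (suc n) + u P n

v : ℤ → ℕ → ℤ
v P zero          = + 2
v P (suc zero)    = P
v P (suc (suc n)) = P * v P (suc n) + v P n

IsPeriod : (ℕ → ℤ) → ℕ → ℕ → Set
IsPeriod s m h = 1 ≤ h × (∀ n → s (n ℕ.+ h) ≡ s n [mod m ])

IsShortestPeriod : (ℕ → ℤ) → ℕ → ℕ → Set
IsShortestPeriod s m h = IsPeriod s m h × (∀ h′ → IsPeriod s m h′ → h ≤ h′)

-- Every sequence with s (n + 2) = P s (n + 1) + s n is purely periodic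
-- modulo every m ≥ 1, so that the shortest period is a total function.

module _ (P : ℤ) (s : ℕ → ℤ)
         (rec : ∀ n → s (suc (suc n)) ≡ P * s (suc n) + s n)
         (m : ℕ) where

  private
    Agree : ℕ → ℕ → Set
    Agree i j = s i ≡ s j [mod m ] × s (suc i) ≡ s (suc j) [mod m ]

    forward : ∀ i j → Agree i j → Agree (suc i) (suc j)
    forward i j (p , q) = q , subst (+ m ∣_) eq (∣m∣n⇒∣m+n (∣n⇒∣m*n P q) p)
      where
      ring : ∀ P a b c d → P * (b - d) + (a - c) ≡ (P * b + a) - (P * d + c)
      ring = solve-∀
      eq : P * (s (suc i) - s (suc j)) + (s i - s j) ≡ s (suc (suc i)) - s (suc (suc j))
      eq = trans (ring P (s i) (s (suc i)) (s j) (s (suc j)))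
                 (sym (cong₂ _-_ (rec i) (rec j)))

    backward : ∀ i j → Agree (suc i) (suc j) → Agree i j
    backward i j (p , q) = subst (+ m ∣_) eq (∣m∣n⇒∣m-n q (∣n⇒∣m*n P p)) , p
      where
      ring : ∀ P a b c d → ((P * b + a) - (P * d + c)) - P * (b - d) ≡ a - c
      ring = solve-∀
      eq : (s (suc (suc i)) - s (suc (suc j))) - P * (s (suc i) - s (suc j)) ≡ s i - s j
      eq = trans (cong (_- P * (s (suc i) - s (suc j))) (cong₂ _-_ (rec i) (rec j)))
                 (ring P (s i) (s (suc i)) (s j) (s (suc j)))

    backward* : ∀ i h → Agree (i ℕ.+ h) i → Agree h 0
    backward* zero    h a = a
    backward* (suc i) h a = backward* i h (backward (i ℕ.+ h) i a)

    forward* : ∀ h → Agree h 0 → ∀ n → Agree (n ℕ.+ h) n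
    forward* h a zero    = a
    forward* h a (suc n) = forward (n ℕ.+ h) n (forward* h a n)

    isPeriod? : Decidable (IsPeriod s m)
    isPeriod? h = map′
      (λ (1≤h , a) → 1≤h , λ n → proj₁ (forward* h a n))
      (λ (1≤h , f) → 1≤h , f 0 , f 1)
      (1 ≤? h ×-dec s h ≡? s 0 [mod m ] ×-dec s (suc h) ≡? s 1 [mod m ])

  module _ .{{_ : NonZero m}} where

    private
      residue : ℤ → Fin m
      residue a = fromℕ< (n%ℕd<d a m)

      residue-≡ : ∀ a b → residue a ≡ residue b → a ≡ b [mod m ]
      residue-≡ a b e = divides (a /ℕ m - b /ℕ m)
        (trans (cong₂ _-_ (a≡a%ℕn+[a/ℕn]*n a m)
                 (trans (a≡a%ℕn+[a/ℕn]*n b m) (cong (λ r → + r + b /ℕ m * + m) (sym r≡))))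
               (ring (+ (a %ℕ m)) (a /ℕ m) (b /ℕ m) (+ m)))
        where
        r≡ : a %ℕ m ≡ b %ℕ m
        r≡ = fromℕ<-injective _ _ (n%ℕd<d a m) (n%ℕd<d b m) e
        ring : ∀ r q q′ m → (r + q * m) - (r + q′ * m) ≡ (q - q′) * m
        ring = solve-∀

      state : ℕ → Fin (m ℕ.* m)
      state i = combine (residue (s i)) (residue (s (suc i)))

      state-≡ : ∀ i j → state i ≡ state j → Agree i j
      state-≡ i j e =
        let p , q = combine-injective (residue (s i)) (residue (s (suc i)))
                                      (residue (s j)) (residue (s (suc j))) e
        in residue-≡ (s i) (s j) p , residue-≡ (s (suc i)) (s (suc j)) q

    period-exists : ∃ (IsPeriod s m)
    period-exists =
      let i , j , i<j , e = pigeonhole (n<1+n (m ℕ.* m)) (λ i → state (toℕ i))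
          h = toℕ j ℕ.∸ toℕ i
          a = state-≡ (toℕ j) (toℕ i) (sym e)
          a′ = subst (λ x → Agree x (toℕ i)) (sym (m+[n∸m]≡n (<⇒≤ i<j))) a
      in h , m<n⇒0<n∸m i<j , λ n → proj₁ (forward* h (backward* (toℕ i) h a′) n)

    shortest-period-exists : ∃ (IsShortestPeriod s m)
    shortest-period-exists = <-rec Goal step (proj₁ period-exists) (proj₂ period-exists)
      where
      Goal : ℕ → Set
      Goal h = IsPeriod s m h → ∃ (IsShortestPeriod s m)
      step : ∀ h → (∀ {h′} → h′ < h → Goal h′) → Goal h
      step h ih ph with anyUpTo? isPeriod? h
      ... | yes (h′ , h′<h , ph′) = ih h′<h ph′
      ... | no none = h , ph , λ h′ ph′ → ≮⇒≥ (λ h′<h → none (h′ , h′<h , ph′))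

h-u : ℤ → (m : ℕ) .{{_ : NonZero m}} → ℕ
h-u P m = proj₁ (shortest-period-exists P (u P) (λ _ → refl) m)

h-v : ℤ → (m : ℕ) .{{_ : NonZero m}} → ℕ
h-v P m = proj₁ (shortest-period-exists P (v P) (λ _ → refl) m)

h-u-spec : ∀ P m .{{_ : NonZero m}} → IsShortestPeriod (u P) m (h-u P m)
h-u-spec P m = proj₂ (shortest-period-exists P (u P) (λ _ → refl) m)

h-v-spec : ∀ P m .{{_ : NonZero m}} → IsShortestPeriod (v P) m (h-v P m)
h-v-spec P m = proj₂ (shortest-period-exists P (v P) (λ _ → refl) m)

count : (ℕ → ℤ) → (h m : ℕ) → ℤ → ℕ
count s h m b = length (filter (λ n → s n ≡? b [mod m ]) (upTo h))

v-u : ℤ → (m : ℕ) .{{_ : NonZero m}} → ℤ → ℕ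
v-u P m b = count (u P) (h-u P m) m b

v-v : ℤ → (m : ℕ) .{{_ : NonZero m}} → ℤ → ℕ
v-v P m b = count (v P) (h-v P m) m b

{-# OPTIONS --safe #-}
-- Write n = r + 4t.  For even m, u(n+2m) − u(n) = u(m) v(n+m) and
-- v(n+2m) − v(n) = (P² + 4) u(m) u(n+m); moreover u(4s) has the 3-adic
-- valuation of 3^δ s, and v(4x+2) that of 3^δ (1+2x).  Hence, for t of fixed
-- parity, the values on three of the four classes r are 3-adically linear:
-- s(r+4t) − s(r+4t′) has the valuation of 3^δ (t − t′), so by Hensel lifting
-- each class of t modulo 2 hits every b in its residue class modulo 3^δ exactly
-- once per period 8·3^(k−δ).  On the remaining class (r = 2 for u, r = 0 for v)
-- the difference has the valuation of 3^(2δ) (X² − X′²), with X = 1 + 2t for u and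
-- X = t for v, so the solutions are those of X² ≡ X₀² modulo 3^(k−2δ): there are
-- 3^⌊k/2⌋ of them if X₀² ≡ 0, and 2·3^(j+δ) if X₀ has valuation j < (k−2δ)/2;
-- for k < 2δ the condition is void and all 3^(k−δ) values of X are solutions.
module Submission where

open import Defs

-- The modulus 4 comes from v(2) = P² + 2, which 3^δ divides: s(n+4) ≡ -s(n) modulo 3^δ, so the
-- parity of t acts as a sign. The identities for s(n+2m) ∓ s(n) need m even. With m = 4d the
-- difference formula compares only values of t of equal parity; opposite parities are bridged by
-- the sum formula with 2m = 4·3^N, which negates the value modulo 3^(δ+N) while t moves by an odd
-- number that is 3-adically small. This produces the signs ± of the theorem. The second factor of
-- the difference formula acts as a derivative. It is prime to 3 on three classes; on the fourth it
-- is, up to a unit, v(4x+2) or u(4x) and contributes a second 3^δ times a linear form, whence the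
-- difference of squares. The summand 2 for δ = 1 comes from the three linear classes. Together they
-- hit every b congruent to 0 or ±g modulo 3^δ exactly twice per period (g = 1 for u, g = P for v).
-- For δ = 1 these are all b; for δ ≥ 2 they are disjoint from the residues of the quadratic class,
-- because 9 ∣ P² + 2.

module _ where

  open import Data.Empty using (⊥-elim)
  open import Data.Integer.Base using (ℤ; +_; 0ℤ; 1ℤ; _+_; _*_; _-_; -_)
  open import Data.Integer.DivMod using (_%ℕ_; _/ℕ_; n%ℕd<d; a≡a%ℕn+[a/ℕn]*n)
  open import Data.Integer.Divisibility.Signed using
      (_∣_; _∣?_; divides; ∣ᵤ⇒∣; ∣⇒∣ᵤ; ∣-trans; ∣m∣n⇒∣m+n; ∣m∣n⇒∣m-n; ∣m⇒∣-m; ∣n⇒∣m*n; ∣m⇒∣m*n)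
  open import Data.Integer.Properties using
      (pos-*; abs-*; ⊖-≥; [+m]-[+n]≡m⊖n; +-identityʳ; *-cancelˡ-≡; *-comm; *-assoc; *-identityˡ; *-identityʳ;
      *-distribˡ-+)
  open import Data.Integer.Tactic.RingSolver using (solve-∀)
  open import Data.List.Base using (length; filter; applyUpTo)
  open import Data.Nat.Base as ℕ using (ℕ; zero; suc; _≤_; _<_; _^_; z≤n; s≤s; NonZero; _/_; _%_)
  open import Data.Nat.Divisibility using (∣⇒≤) renaming (_∣_ to _∣ℕ_)
  open import Data.Nat.DivMod using (m≡m%n+[m/n]*n; m%n<n; m/n*n≤m; m*n/n≡m; /-monoˡ-≤)
  open import Data.Nat.Induction using (<-rec)
  open import Data.Nat.Primality using (prime?; euclidsLemma)
  open import Data.Nat.Properties as ℕₚ using (m^n≢0)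
  open import Data.Product.Base using (∃; _×_; _,_; proj₁; proj₂)
  open import Data.Sum.Base using (_⊎_; inj₁; inj₂; [_,_]′)
  open import Function.Base using (_∘_; id)
  open import Relation.Binary.PropositionalEquality using
      (_≡_; refl; sym; trans; cong; cong₂; subst; subst₂; module ≡-Reasoning)
  open import Relation.Nullary using (¬_; Dec; yes; no)
  open import Relation.Nullary.Decidable using (from-yes; from-no; _⊎-dec_)
  open import Relation.Unary using (Decidable)
  import Data.Integer.Base as ℤ
  import Data.Nat.Tactic.RingSolver as ℕ-Solver

  -- Divisibility by powers of 3 and units modulo 3.

  3^_ : ℕ → ℤ
  3^ n = + (3 ^ n)

  infix 9 3^_

  3^suc : ∀ n → 3^ (suc n) ≡ + 3 * 3^ n
  3^suc n = pos-* 3 (3 ^ n)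

  3^-+ : ∀ m n → 3^ (m ℕ.+ n) ≡ 3^ m * 3^ n
  3^-+ m n = trans (cong +_ (ℕₚ.^-distribˡ-+-* 3 m n)) (pos-* (3 ^ m) (3 ^ n))

  3^-cancelˡ : ∀ i {a b} → 3^ i * a ≡ 3^ i * b → a ≡ b
  3^-cancelˡ i {a} {b} = *-cancelˡ-≡ (3^ i) a b {{m^n≢0 3 i}}

  3^∣-mono : ∀ {i j} → i ≤ j → 3^ i ∣ 3^ j
  3^∣-mono {i} {j} i≤j = divides (3^ (j ℕ.∸ i))
      (trans (cong 3^_ (sym (ℕₚ.m+[n∸m]≡n i≤j))) (trans (3^-+ i (j ℕ.∸ i)) (*-comm (3^ i) _)))

  ∣-*-mono : ∀ {a b c d} → a ∣ b → c ∣ d → a * c ∣ b * d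
  ∣-*-mono {a} {b} {c} {d} (divides p refl) (divides q refl) = divides (p * q) (ring p q a c)
    where
    ring : ∀ p q a c → p * a * (q * c) ≡ p * q * (a * c)
    ring = solve-∀

  3^∣3^* : ∀ i j {a} → 3^ j ∣ a → 3^ (i ℕ.+ j) ∣ 3^ i * a
  3^∣3^* i j {a} d = subst (_∣ 3^ i * a) (sym (3^-+ i j)) (∣-*-mono (divides 1ℤ (sym (*-identityˡ (3^ i)))) d)

  3^∣3^*⁻ : ∀ i j {a} → 3^ (i ℕ.+ j) ∣ 3^ i * a → 3^ j ∣ a
  3^∣3^*⁻ i j {a} (divides q eq) = divides q
      (3^-cancelˡ i (trans eq (trans (cong (q *_) (3^-+ i j)) (ring q (3^ i) (3^ j)))))
    where
    ring : ∀ q x y → q * (x * y) ≡ x * (q * y)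
    ring = solve-∀

  Unit : ℤ → Set
  Unit e = ¬ (+ 3 ∣ e)

  3∣*⇒ : ∀ a b → + 3 ∣ a * b → + 3 ∣ a ⊎ + 3 ∣ b
  3∣*⇒ a b d = [ inj₁ ∘ ∣ᵤ⇒∣ , inj₂ ∘ ∣ᵤ⇒∣ ]′
    (euclidsLemma ℤ.∣ a ∣ ℤ.∣ b ∣ (from-yes (prime? 3)) (subst (3 ∣ℕ_) (abs-* a b) (∣⇒∣ᵤ d)))

  unit-* : ∀ {a b} → Unit a → Unit b → Unit (a * b)
  unit-* {a} {b} ua ub d = [ ua , ub ]′ (3∣*⇒ a b d)

  3^∣-cancelʳ : ∀ i {a e} → Unit e → 3^ i ∣ a * e → 3^ i ∣ a
  3^∣-cancelʳ zero {a} ue d = divides a (sym (*-identityʳ a))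
  3^∣-cancelʳ (suc i) {a} {e} ue d with 3∣*⇒ a e (∣-trans (3^∣-mono {1} {suc i} (s≤s z≤n)) d)
  ... | inj₂ 3∣e = ⊥-elim (ue 3∣e)
  ... | inj₁ (divides a′ refl) = subst (3^ suc i ∣_) (*-comm (+ 3) a′)
          (3^∣3^* 1 i (3^∣-cancelʳ i ue (3^∣3^*⁻ 1 i (subst (3^ suc i ∣_) (ring a′ e) d))))
    where
    ring : ∀ a e → a * + 3 * e ≡ + 3 * (a * e)
    ring = solve-∀

  3^∣-cancelˡ : ∀ i {a e} → Unit e → 3^ i ∣ e * a → 3^ i ∣ a
  3^∣-cancelˡ i {a} {e} ue d = 3^∣-cancelʳ i ue (subst (3^ i ∣_) (*-comm e a) d)

  -- Equality of 3-adic valuations, in a form that also covers zero.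
  infix 4 _~_

  record _~_ (a b : ℤ) : Set where
    constructor mk~
    field
      eˡ eʳ : ℤ
      unitˡ : Unit eˡ
      unitʳ : Unit eʳ
      eq    : a * eˡ ≡ b * eʳ

  3∤1 : Unit 1ℤ
  3∤1 = from-no (+ 3 ∣? 1ℤ)

  3∤2 : Unit (+ 2)
  3∤2 = from-no (+ 3 ∣? + 2)

  ~-reflexive : ∀ {a b} → a ≡ b → a ~ b
  ~-reflexive refl = mk~ 1ℤ 1ℤ 3∤1 3∤1 refl

  ~-sym : ∀ {a b} → a ~ b → b ~ a
  ~-sym (mk~ e f ue uf eq) = mk~ f e uf ue (sym eq)

  ~-trans : ∀ {a b c} → a ~ b → b ~ c → a ~ c
  ~-trans {a} {b} {c} (mk~ e f ue uf eq) (mk~ e′ f′ ue′ uf′ eq′) =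
    mk~ (e * e′) (f′ * f) (unit-* ue ue′) (unit-* uf′ uf) (begin
      a * (e * e′) ≡⟨ *-assoc a e e′ ⟨
      a * e * e′   ≡⟨ cong (_* e′) eq ⟩
      b * f * e′   ≡⟨ ring b f e′ ⟩
      b * e′ * f   ≡⟨ cong (_* f) eq′ ⟩
      c * f′ * f   ≡⟨ *-assoc c f′ f ⟩
      c * (f′ * f) ∎)
    where
    open ≡-Reasoning
    ring : ∀ b f e → b * f * e ≡ b * e * f
    ring = solve-∀

  ~-* : ∀ {a b c d} → a ~ b → c ~ d → a * c ~ b * d
  ~-* {a} {b} {c} {d} (mk~ e f ue uf eq) (mk~ e′ f′ ue′ uf′ eq′) =
    mk~ (e * e′) (f * f′) (unit-* ue ue′) (unit-* uf uf′)
      (trans (ring a c e e′) (trans (cong₂ _*_ eq eq′) (sym (ring b d f f′))))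
    where
    ring : ∀ a c e f → a * c * (e * f) ≡ a * e * (c * f)
    ring = solve-∀

  ~-neg : ∀ {a b} → a ~ b → - a ~ - b
  ~-neg {a} {b} (mk~ e f ue uf eq) = mk~ e f ue uf (trans (ring a e) (trans (cong -_ eq) (sym (ring b f))))
    where
    ring : ∀ a e → - a * e ≡ - (a * e)
    ring = solve-∀

  ~-unitˡ : ∀ {a e} → Unit e → e * a ~ a
  ~-unitˡ {a} {e} ue = mk~ 1ℤ e 3∤1 ue (trans (*-identityʳ (e * a)) (*-comm e a))

  -- A factor prime to 3 cancels from divisibility by 3^i, so related numbers are divisible by the
  -- same powers of 3.
  ~-∣ : ∀ i {a b} → a ~ b → 3^ i ∣ a → 3^ i ∣ b
  ~-∣ i {a} {b} (mk~ e f ue uf eq) d = 3^∣-cancelʳ i uf (subst (3^ i ∣_) eq (∣m⇒∣m*n e d))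

  mod3-cases : ∀ a → + 3 ∣ a ⊎ + 3 ∣ a - 1ℤ ⊎ + 3 ∣ a + 1ℤ
  mod3-cases a with a %ℕ 3 | a /ℕ 3 | n%ℕd<d a 3 | a≡a%ℕn+[a/ℕn]*n a 3
  ... | 0 | q | _ | eq = inj₁ (divides q (trans eq (ring q)))
    where
    ring : ∀ q → 0ℤ + q * + 3 ≡ q * + 3
    ring = solve-∀
  ... | 1 | q | _ | eq = inj₂ (inj₁ (divides q (trans (cong (_- 1ℤ) eq) (ring q))))
    where
    ring : ∀ q → 1ℤ + q * + 3 - 1ℤ ≡ q * + 3
    ring = solve-∀
  ... | 2 | q | _ | eq = inj₂ (inj₂ (divides (q + 1ℤ) (trans (cong (_+ 1ℤ) eq) (ring q))))
    where
    ring : ∀ q → + 2 + q * + 3 + 1ℤ ≡ (q + 1ℤ) * + 3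
    ring = solve-∀
  ... | suc (suc (suc _)) | q | s≤s (s≤s (s≤s ())) | eq

  module _ {m : ℕ} where

    ≡m-refl : ∀ a → a ≡ a [mod m ]
    ≡m-refl a = divides 0ℤ (ring a)
      where
      ring : ∀ a → a - a ≡ 0ℤ
      ring = solve-∀

    ≡m-sym : ∀ a b → a ≡ b [mod m ] → b ≡ a [mod m ]
    ≡m-sym a b d = subst (+ m ∣_) (ring a b) (∣m⇒∣-m d)
      where
      ring : ∀ a b → - (a - b) ≡ b - a
      ring = solve-∀

    ≡m-trans : ∀ a b c → a ≡ b [mod m ] → b ≡ c [mod m ] → a ≡ c [mod m ]
    ≡m-trans a b c d e = subst (+ m ∣_) (ring a b c) (∣m∣n⇒∣m+n d e)
      where
      ring : ∀ a b c → a - b + (b - c) ≡ a - c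
      ring = solve-∀

    ≡m-neg : ∀ a b → a ≡ b [mod m ] → - a ≡ - b [mod m ]
    ≡m-neg a b d = subst (+ m ∣_) (ring a b) (∣m⇒∣-m d)
      where
      ring : ∀ a b → - (a - b) ≡ - a - - b
      ring = solve-∀

  ≡m-weaken : ∀ a b {i j} → i ≤ j → a ≡ b [mod 3 ^ j ] → a ≡ b [mod 3 ^ i ]
  ≡m-weaken a b i≤j = ∣-trans (3^∣-mono i≤j)

  -- Counting the solutions of a decidable condition below a bound.

  ind : ∀ {A : Set} → Dec A → ℕ
  ind (yes _) = 1
  ind (no _)  = 0

  ind-cong : ∀ {A B : Set} (a? : Dec A) (b? : Dec B) → (A → B) → (B → A) → ind a? ≡ ind b?
  ind-cong (yes a) (yes b) f g = refl
  ind-cong (yes a) (no ¬b) f g = ⊥-elim (¬b (f a))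
  ind-cong (no ¬a) (yes b) f g = ⊥-elim (¬a (g b))
  ind-cong (no ¬a) (no ¬b) f g = refl

  -- The recursion shifts the predicate and keeps the range starting at 0, so that passing to a
  -- later block or to a residue class is a reindexing of the predicate.
  cnt : {P : ℕ → Set} → Decidable P → ℕ → ℕ
  cnt P? zero    = 0
  cnt P? (suc n) = ind (P? 0) ℕ.+ cnt (P? ∘ suc) n

  length-filter-applyUpTo : ∀ {P : ℕ → Set} (P? : Decidable P) f n →
    length (filter P? (applyUpTo f n)) ≡ cnt (P? ∘ f) n
  length-filter-applyUpTo P? f zero = refl
  length-filter-applyUpTo P? f (suc n) with P? (f 0)
  ... | yes _ = cong suc (length-filter-applyUpTo P? (f ∘ suc) n)
  ... | no _  = length-filter-applyUpTo P? (f ∘ suc) n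

  cnt-cong : ∀ {P Q : ℕ → Set} (P? : Decidable P) (Q? : Decidable Q) →
    (∀ i → P i → Q i) → (∀ i → Q i → P i) → ∀ n → cnt P? n ≡ cnt Q? n
  cnt-cong P? Q? f g zero    = refl
  cnt-cong P? Q? f g (suc n) = cong₂ ℕ._+_ (ind-cong (P? 0) (Q? 0) (f 0) (g 0))
    (cnt-cong (P? ∘ suc) (Q? ∘ suc) (f ∘ suc) (g ∘ suc) n)

  cnt-none : ∀ {P : ℕ → Set} (P? : Decidable P) n → (∀ i → i < n → ¬ P i) → cnt P? n ≡ 0
  cnt-none P? zero    ¬p = refl
  cnt-none P? (suc n) ¬p with P? 0
  ... | yes p = ⊥-elim (¬p 0 (s≤s z≤n) p)
  ... | no _  = cnt-none (P? ∘ suc) n (λ i i<n → ¬p (suc i) (s≤s i<n))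

  cnt-one : ∀ {P : ℕ → Set} (P? : Decidable P) n i → i < n → P i → (∀ j → j < n → P j → j ≡ i) → cnt P? n ≡ 1
  cnt-one P? (suc n) zero i<n p uniq with P? 0
  ... | yes _ = cong suc (cnt-none (P? ∘ suc) n (λ j j<n q → ℕₚ.1+n≢0 (uniq (suc j) (s≤s j<n) q)))
  ... | no ¬p = ⊥-elim (¬p p)
  cnt-one P? (suc n) (suc i) (s≤s i<n) p uniq with P? 0
  ... | yes q = ⊥-elim (ℕₚ.0≢1+n (uniq 0 (s≤s z≤n) q))
  ... | no _  = cnt-one (P? ∘ suc) n i i<n p (λ j j<n q → ℕₚ.suc-injective (uniq (suc j) (s≤s j<n) q))

  cnt-+ : ∀ {P : ℕ → Set} (P? : Decidable P) m n → cnt P? (m ℕ.+ n) ≡ cnt P? m ℕ.+ cnt (λ i → P? (m ℕ.+ i)) n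
  cnt-+ P? zero    n = refl
  cnt-+ P? (suc m) n = trans (cong (ind (P? 0) ℕ.+_) (cnt-+ (P? ∘ suc) m n))
      (sym (ℕₚ.+-assoc (ind (P? 0)) _ _))

  cnt-periodic : ∀ {P : ℕ → Set} (P? : Decidable P) m → (∀ i → P i → P (m ℕ.+ i)) →
      (∀ i → P (m ℕ.+ i) → P i) →
    ∀ q → cnt P? (q ℕ.* m) ≡ q ℕ.* cnt P? m
  cnt-periodic P? m f g zero    = refl
  cnt-periodic P? m f g (suc q) = trans (cnt-+ P? m (q ℕ.* m)) (cong (cnt P? m ℕ.+_)
    (trans (cnt-cong (λ i → P? (m ℕ.+ i)) P? g f (q ℕ.* m)) (cnt-periodic P? m f g q)))

  cnt-⊎ : ∀ {P Q : ℕ → Set} (P? : Decidable P) (Q? : Decidable Q) → (∀ i → P i → ¬ Q i) →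
    ∀ n → cnt (λ i → P? i ⊎-dec Q? i) n ≡ cnt P? n ℕ.+ cnt Q? n
  cnt-⊎ P? Q? disj zero = refl
  cnt-⊎ {P} {Q} P? Q? disj (suc n) = trans
    (cong₂ ℕ._+_ (ind-⊎ (P? 0) (Q? 0) (disj 0)) (cnt-⊎ (P? ∘ suc) (Q? ∘ suc) (disj ∘ suc) n))
    (ring (ind (P? 0)) (ind (Q? 0)) (cnt (P? ∘ suc) n) (cnt (Q? ∘ suc) n))
    where
    ind-⊎ : ∀ {A B : Set} (a? : Dec A) (b? : Dec B) → (A → ¬ B) → ind (a? ⊎-dec b?) ≡ ind a? ℕ.+ ind b?
    ind-⊎ (yes a) (yes b) d = ⊥-elim (d a b)
    ind-⊎ (yes a) (no _)  d = refl
    ind-⊎ (no _)  (yes b) d = refl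
    ind-⊎ (no _)  (no _)  d = refl
    ring : ∀ a b c d → (a ℕ.+ b) ℕ.+ (c ℕ.+ d) ≡ (a ℕ.+ c) ℕ.+ (b ℕ.+ d)
    ring = ℕ-Solver.solve-∀

  cnt-split₂ : ∀ {P : ℕ → Set} (P? : Decidable P) q →
    cnt P? (q ℕ.* 2) ≡ cnt (λ s → P? (s ℕ.* 2)) q ℕ.+ cnt (λ s → P? (1 ℕ.+ s ℕ.* 2)) q
  cnt-split₂ P? zero    = refl
  cnt-split₂ P? (suc q) = trans (cong (λ x → ind (P? 0) ℕ.+ (ind (P? 1) ℕ.+ x))
      (cnt-split₂ (λ i → P? (2 ℕ.+ i)) q))
    (ring (ind (P? 0)) (ind (P? 1)) _ _)
    where
    ring : ∀ a b c d → a ℕ.+ (b ℕ.+ (c ℕ.+ d)) ≡ (a ℕ.+ c) ℕ.+ (b ℕ.+ d)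
    ring = ℕ-Solver.solve-∀

  cnt-split₄ : ∀ {P : ℕ → Set} (P? : Decidable P) q →
    cnt P? (q ℕ.* 4) ≡ (cnt (λ t → P? (t ℕ.* 4)) q ℕ.+ cnt (λ t → P? (1 ℕ.+ t ℕ.* 4)) q)
                   ℕ.+ (cnt (λ t → P? (2 ℕ.+ t ℕ.* 4)) q ℕ.+ cnt (λ t → P? (3 ℕ.+ t ℕ.* 4)) q)
  cnt-split₄ P? zero    = refl
  cnt-split₄ P? (suc q) = trans
    (cong (λ x → ind (P? 0) ℕ.+ (ind (P? 1) ℕ.+ (ind (P? 2) ℕ.+ (ind (P? 3) ℕ.+ x))))
        (cnt-split₄ (λ i → P? (4 ℕ.+ i)) q))
    (ring (ind (P? 0)) (ind (P? 1)) (ind (P? 2)) (ind (P? 3)) _ _ _ _)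
    where
    ring : ∀ a b c d e f g h → a ℕ.+ (b ℕ.+ (c ℕ.+ (d ℕ.+ ((e ℕ.+ f) ℕ.+ (g ℕ.+ h))))) ≡
      ((a ℕ.+ e) ℕ.+ (b ℕ.+ f)) ℕ.+ ((c ℕ.+ g) ℕ.+ (d ℕ.+ h))
    ring = ℕ-Solver.solve-∀

  ≡m-unique : ∀ {m i j} → i < m → j < m → + i ≡ + j [mod m ] → i ≡ j
  ≡m-unique {m} {i} {j} i<m j<m d = [ (λ i≤j → sym (wlog i≤j j<m (≡m-sym (+ i) (+ j) d))) ,
      (λ j≤i → wlog j≤i i<m d) ]′ (ℕₚ.≤-total i j)
    where
    wlog : ∀ {i j} → j ≤ i → i < m → + i ≡ + j [mod m ] → i ≡ j
    wlog {i} {j} j≤i i<m d with i ℕ.∸ j in eq | subst (m ∣ℕ_)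
        (cong ℤ.∣_∣ (trans ([+m]-[+n]≡m⊖n i j) (⊖-≥ j≤i))) (∣⇒∣ᵤ d)
    ... | zero  | _ = ℕₚ.≤-antisym (ℕₚ.m∸n≡0⇒m≤n eq) j≤i
    ... | suc x | m∣ = ⊥-elim (ℕₚ.<-irrefl refl
        (ℕₚ.<-≤-trans i<m (ℕₚ.≤-trans (∣⇒≤ m∣) (ℕₚ.≤-trans (ℕₚ.≤-reflexive (sym eq)) (ℕₚ.m∸n≤m i j)))))

  -- The condition has period `m`, and the first block contains the single solution `s₀ % m`.
  cnt-residue : ∀ m .{{_ : NonZero m}} s₀ q → cnt (λ s → + s ≡? + s₀ [mod m ]) (q ℕ.* m) ≡ q
  cnt-residue m s₀ q = trans (cnt-periodic _ m (λ i → ≡m-trans (+ (m ℕ.+ i)) (+ i) (+ s₀) (shift i))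
      (λ i → ≡m-trans (+ i) (+ (m ℕ.+ i)) (+ s₀) (≡m-sym (+ (m ℕ.+ i)) (+ i) (shift i))) q)
    (trans (cong (q ℕ.*_) (cnt-one _ m (s₀ % m) (m%n<n s₀ m) rem
       (λ j j<m d → ≡m-unique j<m (m%n<n s₀ m)
           (≡m-trans (+ j) (+ s₀) (+ (s₀ % m)) d (≡m-sym (+ (s₀ % m)) (+ s₀) rem)))))
     (ℕₚ.*-identityʳ q))
    where
    shift : ∀ i → + (m ℕ.+ i) ≡ + i [mod m ]
    shift i = divides 1ℤ (ring (+ m) (+ i))
      where
      ring : ∀ a b → a + b - b ≡ 1ℤ * a
      ring = solve-∀
    rem : + (s₀ % m) ≡ + s₀ [mod m ]
    rem = ≡m-sym (+ s₀) (+ (s₀ % m)) (divides (+ (s₀ / m))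
        (trans (cong (λ x → + x - + (s₀ % m)) (m≡m%n+[m/n]*n s₀ m))
      (trans (cong (λ x → (+ (s₀ % m) + x) - + (s₀ % m)) (pos-* (s₀ / m) m)) (ring (+ (s₀ % m)) _))))
      where
      ring : ∀ a b → a + b - a ≡ b
      ring = solve-∀

  -- Hensel lifting for 3-adically linear families.

  -- Up to the factor 3^c such an `f` is a 3-adic isometry. This replaces the unit derivative of the
  -- usual Hensel lemma.
  Linear : ℕ → (ℕ → ℤ) → Set
  Linear c f = ∀ s s′ → f s - f s′ ~ 3^ c * (+ s - + s′)

  ~-exact : ∀ i {a e} → a ~ 3^ i * e → Unit e → ∃ λ z → Unit z × a ≡ z * 3^ i
  ~-exact i {a} {e} a~ ue with ~-∣ i (~-sym a~) (∣m⇒∣m*n e (divides 1ℤ (sym (*-identityˡ (3^ i)))))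
  ... | divides z refl = z , (λ 3∣z → ue
      (3^∣3^*⁻ i 1 (~-∣ (i ℕ.+ 1) a~ (subst (3^ (i ℕ.+ 1) ∣_) (*-comm (3^ i) z) (3^∣3^* i 1 3∣z))))) , refl

  unit-± : ∀ a b → Unit a → Unit b → + 3 ∣ a - b ⊎ + 3 ∣ a + b
  unit-± a b ua ub with mod3-cases a | mod3-cases b
  ... | inj₁ d | _ = ⊥-elim (ua d)
  ... | inj₂ _ | inj₁ d = ⊥-elim (ub d)
  ... | inj₂ (inj₁ d) | inj₂ (inj₁ e) = inj₁ (subst (+ 3 ∣_) (ring a b) (∣m∣n⇒∣m-n d e))
    where
    ring : ∀ a b → a - 1ℤ - (b - 1ℤ) ≡ a - b
    ring = solve-∀
  ... | inj₂ (inj₁ d) | inj₂ (inj₂ e) = inj₂ (subst (+ 3 ∣_) (ring a b) (∣m∣n⇒∣m+n d e))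
    where
    ring : ∀ a b → a - 1ℤ + (b + 1ℤ) ≡ a + b
    ring = solve-∀
  ... | inj₂ (inj₂ d) | inj₂ (inj₁ e) = inj₂ (subst (+ 3 ∣_) (ring a b) (∣m∣n⇒∣m+n d e))
    where
    ring : ∀ a b → a + 1ℤ + (b - 1ℤ) ≡ a + b
    ring = solve-∀
  ... | inj₂ (inj₂ d) | inj₂ (inj₂ e) = inj₁ (subst (+ 3 ∣_) (ring a b) (∣m∣n⇒∣m-n d e))
    where
    ring : ∀ a b → a + 1ℤ - (b + 1ℤ) ≡ a - b
    ring = solve-∀

  unit-cases : ∀ w → + 3 ∣ w ⊎ Unit w
  unit-cases w with + 3 ∣? w
  ... | yes d = inj₁ d
  ... | no ¬d = inj₂ ¬d

  -- w, w + z₁, w + z₂ are pairwise distinct modulo 3, so one of them vanishes.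
  one-vanishes : ∀ w z₁ z₂ → Unit z₁ → Unit z₂ → Unit (z₁ - z₂) → + 3 ∣ w + 0ℤ ⊎ + 3 ∣ w + z₁ ⊎ + 3 ∣ w + z₂
  one-vanishes w z₁ z₂ u₁ u₂ u₁₂ with unit-cases w
  ... | inj₁ d = inj₁ (subst (+ 3 ∣_) (sym (+-identityʳ w)) d)
  ... | inj₂ uw with unit-± w z₁ uw u₁ | unit-± z₁ z₂ u₁ u₂
  ...   | inj₂ d | _      = inj₂ (inj₁ d)
  ...   | inj₁ _ | inj₁ d = ⊥-elim (u₁₂ d)
  ...   | inj₁ d | inj₂ e = inj₂ (inj₂ (subst (+ 3 ∣_) (ring w z₁ z₂) (∣m∣n⇒∣m+n d e)))
    where
    ring : ∀ w a b → w - a + (a + b) ≡ w + b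
    ring = solve-∀

  module _ {c : ℕ} {f : ℕ → ℤ} (lin : Linear c f) where

    linear-exact : ∀ M s s′ e → Unit e → + s - + s′ ≡ 3^ M * e →
      ∃ λ z → Unit z × f s - f s′ ≡ z * 3^ (c ℕ.+ M)
    linear-exact M s s′ e ue eq = ~-exact (c ℕ.+ M) (~-trans (lin s s′) (~-reflexive (begin
      3^ c * (+ s - + s′)  ≡⟨ cong (3^ c *_) eq ⟩
      3^ c * (3^ M * e)    ≡⟨ *-assoc (3^ c) (3^ M) e ⟨
      3^ c * 3^ M * e      ≡⟨ cong (_* e) (3^-+ c M) ⟨
      3^ (c ℕ.+ M) * e     ∎))) ue
      where open ≡-Reasoning

    private
      shift₁ : ∀ s x → + (s ℕ.+ x) - + s ≡ + x * 1ℤ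
      shift₁ s x = ring (+ s) (+ x)
        where
        ring : ∀ s x → s + x - s ≡ x * 1ℤ
        ring = solve-∀

      shift₂ : ∀ s x → + (s ℕ.+ x ℕ.+ x) - + s ≡ + x * + 2
      shift₂ s x = ring (+ s) (+ x)
        where
        ring : ∀ s x → s + x + x - s ≡ x * + 2
        ring = solve-∀

      shift₁₂ : ∀ s x → + (s ℕ.+ x) - + (s ℕ.+ x ℕ.+ x) ≡ + x * - 1ℤ
      shift₁₂ s x = ring (+ s) (+ x)
        where
        ring : ∀ s x → s + x - (s + x + x) ≡ x * - 1ℤ
        ring = solve-∀

      difference : ∀ i {a b c z₁ z₂ z₁₂} → a - c ≡ z₁ * 3^ i → b - c ≡ z₂ * 3^ i → a - b ≡ z₁₂ * 3^ i →
          z₁₂ ≡ z₁ - z₂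
      difference i {a} {b} {c} {z₁} {z₂} {z₁₂} eq₁ eq₂ eq₁₂ = 3^-cancelˡ i (begin
        3^ i * z₁₂               ≡⟨ *-comm (3^ i) z₁₂ ⟩
        z₁₂ * 3^ i               ≡⟨ eq₁₂ ⟨
        a - b                    ≡⟨ ring-a a b c ⟩
        (a - c) - (b - c)        ≡⟨ cong₂ _-_ eq₁ eq₂ ⟩
        z₁ * 3^ i - z₂ * 3^ i    ≡⟨ ring-b z₁ z₂ (3^ i) ⟩
        3^ i * (z₁ - z₂)         ∎)
        where
        open ≡-Reasoning
        ring-a : ∀ x y b → x - y ≡ (x - b) - (y - b)
        ring-a = solve-∀
        ring-b : ∀ w z t → w * t - z * t ≡ t * (w - z)
        ring-b = solve-∀

      correct : ∀ i {a b c w z} → a - b ≡ w * 3^ i → c - a ≡ z * 3^ i → + 3 ∣ w + z → c ≡ b [mod 3 ^ suc i ]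
      correct i {a} {b} {c} {w} {z} eq₁ eq₂ (divides q eq) = divides q (begin
        c - b                     ≡⟨ ring-a c a b ⟩
        (a - b) + (c - a)         ≡⟨ cong₂ _+_ eq₁ eq₂ ⟩
        w * 3^ i + z * 3^ i       ≡⟨ ring-b w z (3^ i) ⟩
        (w + z) * 3^ i            ≡⟨ cong (_* 3^ i) eq ⟩
        q * + 3 * 3^ i            ≡⟨ *-assoc q (+ 3) (3^ i) ⟩
        q * (+ 3 * 3^ i)          ≡⟨ cong (q *_) (3^suc i) ⟨
        q * 3^ suc i              ∎)
        where
        open ≡-Reasoning
        ring-a : ∀ x y b → x - b ≡ (y - b) + (x - y)
        ring-a = solve-∀
        ring-b : ∀ w z t → w * t + z * t ≡ (w + z) * t
        ring-b = solve-∀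

    -- The values at s, s + 3^M and s + 2·3^M agree modulo 3^(c+M), and any two of them differ by a
    -- unit times that power. They therefore fill all three residues modulo 3^(c+M+1) above the
    -- given one, and one of them is b.
    hensel-step : ∀ {b} M s → f s ≡ b [mod 3 ^ (c ℕ.+ M) ] → ∃ λ s → f s ≡ b [mod 3 ^ suc (c ℕ.+ M) ]
    hensel-step {b} M s (divides w eq) =
      let x = 3 ^ M
          z₁ , u₁ , eq₁ = linear-exact M (s ℕ.+ x) s 1ℤ 3∤1 (shift₁ s x)
          z₂ , u₂ , eq₂ = linear-exact M (s ℕ.+ x ℕ.+ x) s (+ 2) 3∤2 (shift₂ s x)
          -- The third pair is there to show that z₁ - z₂, which `difference` identifies with z₁₂,
          -- is a unit.
          z₁₂ , u₁₂ , eq₁₂ = linear-exact M (s ℕ.+ x) (s ℕ.+ x ℕ.+ x) (- 1ℤ) (3∤1 ∘ ∣m⇒∣-m) (shift₁₂ s x)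
          u₁₂′ = subst Unit (difference (c ℕ.+ M) {f (s ℕ.+ x)} {f (s ℕ.+ x ℕ.+ x)} {f s} {z₁} {z₂} eq₁ eq₂
              eq₁₂) u₁₂
      in [ (λ d → s , correct (c ℕ.+ M) {f s} {b} {f s} {w} eq (ring (f s) (3^ (c ℕ.+ M))) d)
         , [ (λ d → s ℕ.+ x , correct (c ℕ.+ M) {f s} {b} {f (s ℕ.+ x)} {w} {z₁} eq eq₁ d)
           , (λ d → s ℕ.+ x ℕ.+ x , correct (c ℕ.+ M) {f s} {b} {f (s ℕ.+ x ℕ.+ x)} {w} {z₂} eq eq₂ d) ]′ ]′
           (one-vanishes w z₁ z₂ u₁ u₂ u₁₂′)
      where
      ring : ∀ x y → x - x ≡ 0ℤ * y
      ring = solve-∀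

    hensel : ∀ {b} → f 0 ≡ b [mod 3 ^ c ] → ∀ M → ∃ λ s → f s ≡ b [mod 3 ^ (c ℕ.+ M) ]
    hensel {b} base zero    = 0 , subst (λ x → f 0 ≡ b [mod 3 ^ x ]) (sym (ℕₚ.+-identityʳ c)) base
    hensel {b} base (suc M) with hensel base M
    ... | s , hit = subst (λ x → ∃ λ s → f s ≡ b [mod 3 ^ x ]) (sym (ℕₚ.+-suc c M)) (hensel-step M s hit)

  module _ {c : ℕ} {f : ℕ → ℤ} (lin : Linear c f) (M : ℕ) (b : ℤ) where

    -- Once a solution s₀ has been lifted, linearity turns the condition on s into s ≡ s₀ modulo
    -- 3^M.
    linear-hit : f 0 ≡ b [mod 3 ^ c ] → cnt (λ s → f s ≡? b [mod 3 ^ (c ℕ.+ M) ]) (3 ^ M) ≡ 1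
    linear-hit base with hensel {c} {f} lin {b} base M
    ... | s₀ , hit = begin
      cnt (λ s → f s ≡? b [mod 3 ^ (c ℕ.+ M) ]) (3 ^ M)  ≡⟨ cnt-cong _ (λ s → + s ≡? + s₀ [mod 3 ^ M ])
        (λ s d → 3^∣3^*⁻ c M (~-∣ (c ℕ.+ M) (lin s s₀) (≡m-trans (f s) b (f s₀) d (≡m-sym (f s₀) b hit))))
        (λ s d → ≡m-trans (f s) (f s₀) b (~-∣ (c ℕ.+ M) (~-sym (lin s s₀)) (3^∣3^* c M d)) hit) (3 ^ M) ⟩
      cnt (λ s → + s ≡? + s₀ [mod 3 ^ M ]) (3 ^ M)
          ≡⟨ cong (cnt (λ s → + s ≡? + s₀ [mod 3 ^ M ])) (ℕₚ.*-identityˡ (3 ^ M)) ⟨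
      cnt (λ s → + s ≡? + s₀ [mod 3 ^ M ]) (1 ℕ.* 3 ^ M) ≡⟨ cnt-residue (3 ^ M) {{m^n≢0 3 M}} s₀ 1 ⟩
      1 ∎
      where open ≡-Reasoning

    linear-base : ∀ s s′ → f s ≡ f s′ [mod 3 ^ c ]
    linear-base s s′ = ~-∣ c (~-sym (lin s s′)) (∣m⇒∣m*n (+ s - + s′) (divides 1ℤ (sym (*-identityˡ (3^ c)))))

    linear-miss : ¬ f 0 ≡ b [mod 3 ^ c ] → cnt (λ s → f s ≡? b [mod 3 ^ (c ℕ.+ M) ]) (3 ^ M) ≡ 0
    linear-miss ¬base = cnt-none _ (3 ^ M)
        (λ s _ d → ¬base (≡m-trans (f 0) (f s) b (linear-base 0 s) (≡m-weaken (f s) b (ℕₚ.m≤m+n c M) d)))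

  -- Quadratic families: solutions of X² ≡ X₀² modulo a power of 3.

  sq-odd : ∀ i {x} → 3^ (suc (i ℕ.+ i)) ∣ x * x → 3^ (suc i) ∣ x
  sq-odd zero {x} d = [ id , id ]′ (3∣*⇒ x x d)
  sq-odd (suc i) {x} d with sq-odd 0 {x} (∣-trans (3^∣-mono {1} {suc (suc i ℕ.+ suc i)} (s≤s z≤n)) d)
  ... | divides x′ refl = subst (3^ (2 ℕ.+ i) ∣_) (*-comm (+ 3) x′) (3^∣3^* 1 (suc i) (sq-odd i
          (3^∣3^*⁻ 2 (suc (i ℕ.+ i)) (subst₂ _∣_ (cong (λ n → 3^ (2 ℕ.+ n)) (ℕₚ.+-suc i i)) (ring x′) d))))
    where
    ring : ∀ x → x * + 3 * (x * + 3) ≡ + 9 * (x * x)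
    ring = solve-∀

  sq-even : ∀ i {x} → 3^ (i ℕ.+ i) ∣ x * x → 3^ i ∣ x
  sq-even zero    {x} d = divides x (sym (*-identityʳ x))
  sq-even (suc i) {x} d = sq-odd i (∣-trans (3^∣-mono (s≤s (ℕₚ.+-monoʳ-≤ i (ℕₚ.n≤1+n i)))) d)

  3^∣² : ∀ i {x} → 3^ i ∣ x → 3^ (i ℕ.+ i) ∣ x * x
  3^∣² i {x} d = subst (_∣ x * x) (sym (3^-+ i i)) (∣-*-mono d d)

  affine : ℤ → ℤ → ℕ → ℤ
  affine a c s = a * + s + c

  -- Differences of `f` behave 3-adically like those of 3^(2δ) X² with X = a s + c. The form X is
  -- left general because the two parities of t lead to different ones.
  Quadratic : ℕ → ℤ → ℤ → (ℕ → ℤ) → Set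
  Quadratic δ a c f = ∀ s s′ → f s - f s′ ~ 3^ (δ ℕ.+ δ) *
      (affine a c s * affine a c s - affine a c s′ * affine a c s′)

  module _ (a c : ℤ) (ua : Unit a) where

    private
      X : ℕ → ℤ
      X = affine a c

      X-diff : ∀ s s′ → X s - X s′ ≡ a * (+ s - + s′)
      X-diff s s′ = ring a c (+ s) (+ s′)
        where
        ring : ∀ a c s t → (a * s + c) - (a * t + c) ≡ a * (s - t)
        ring = solve-∀

    affine-linear : Linear 0 X
    affine-linear s s′ = ~-trans (~-reflexive (X-diff s s′))
        (~-trans (~-unitˡ ua) (~-reflexive (sym (*-identityˡ (+ s - + s′)))))

    affine-cong : ∀ i s s′ → + s ≡ + s′ [mod 3 ^ i ] → X s ≡ X s′ [mod 3 ^ i ]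
    affine-cong i s s′ d = subst (3^ i ∣_) (sym (X-diff s s′)) (∣n⇒∣m*n a d)

    affine-cong⁻ : ∀ i s s′ → X s ≡ X s′ [mod 3 ^ i ] → + s ≡ + s′ [mod 3 ^ i ]
    affine-cong⁻ i s s′ d = 3^∣-cancelˡ i ua (subst (3^ i ∣_) (X-diff s s′) d)

    -- Hensel lifting at level 0, where the base congruence is void, solves for s without an inverse
    -- of `a`.
    affine-onto : ∀ i x → ∃ λ s → X s ≡ x [mod 3 ^ i ]
    affine-onto i x = hensel {0} {X} affine-linear {x} (divides (X 0 - x) (sym (*-identityʳ (X 0 - x)))) i

    module _ {δ : ℕ} {f : ℕ → ℤ} (quad : Quadratic δ a c f) (j s₀ : ℕ) (y : ℤ) (X₀≡ : X s₀ ≡ 3^ j * y)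
        (uy : Unit y) where

      private
        -- A step by a multiple of 3^(j+1) keeps the valuation of X exactly j.
        s′ : ℕ → ℕ
        s′ w = s₀ ℕ.+ 3 ^ suc j ℕ.* w

        y′ : ℕ → ℤ
        y′ w = y + + 3 * (a * + w)

        unit-y′ : ∀ w → Unit (y′ w)
        unit-y′ w d = uy (subst (+ 3 ∣_) (ring y (+ 3 * (a * + w)))
            (∣m∣n⇒∣m-n d (∣m⇒∣m*n (a * + w) (divides 1ℤ refl))))
          where
          ring : ∀ y z → y + z - z ≡ y
          ring = solve-∀

        X′≡ : ∀ w → X (s′ w) ≡ 3^ j * y′ w
        X′≡ w = begin
          a * (+ s₀ + + (3 ^ suc j ℕ.* w)) + c
              ≡⟨ cong (λ z → a * (+ s₀ + z) + c) (trans (pos-* (3 ^ suc j) w) (cong (_* + w) (3^suc j))) ⟩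
          a * (+ s₀ + + 3 * 3^ j * + w) + c       ≡⟨ ring a c (+ s₀) (3^ j) (+ w) ⟩
          X s₀ + 3^ j * (+ 3 * (a * + w))         ≡⟨ cong (_+ 3^ j * (+ 3 * (a * + w))) X₀≡ ⟩
          3^ j * y + 3^ j * (+ 3 * (a * + w))     ≡⟨ *-distribˡ-+ (3^ j) y (+ 3 * (a * + w)) ⟨
          3^ j * y′ w                             ∎
          where
          open ≡-Reasoning
          ring : ∀ a c s t w → a * (s + + 3 * t * w) + c ≡ a * s + c + t * (+ 3 * (a * w))
          ring = solve-∀

        -- Factor X² - X′² as (X - X′)(X + X′): up to units the first factor is 3^(j+1) (w - w′) and
        -- the second is 3^j, because the cofactors add up to 2y modulo 3. Away from X = 0 the
        -- family is thus linear again.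
        lin′ : Linear ((δ ℕ.+ δ) ℕ.+ suc (j ℕ.+ j)) (f ∘ s′)
        lin′ w w′ = ~-trans (quad (s′ w) (s′ w′)) (~-trans (~-reflexive eq) (~-unitˡ (unit-* ua u₂)))
          where
          u₂ : Unit (y′ w + y′ w′)
          u₂ d = unit-* 3∤2 uy (subst (+ 3 ∣_) (ring y a (+ w) (+ w′))
              (∣m∣n⇒∣m-n d (∣m⇒∣m*n (a * (+ w + + w′)) (divides 1ℤ refl))))
            where
            ring : ∀ y a w w′ → y + + 3 * (a * w) + (y + + 3 * (a * w′)) - + 3 * (a * (w + w′)) ≡ + 2 * y
            ring = solve-∀
          eq : 3^ (δ ℕ.+ δ) * (X (s′ w) * X (s′ w) - X (s′ w′) * X (s′ w′)) ≡
               a * (y′ w + y′ w′) * (3^ ((δ ℕ.+ δ) ℕ.+ suc (j ℕ.+ j)) * (+ w - + w′))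
          eq = trans (cong₂ (λ x x′ → 3^ (δ ℕ.+ δ) * (x * x - x′ * x′)) (X′≡ w) (X′≡ w′))
            (trans (ring (3^ (δ ℕ.+ δ)) (3^ j) a y (+ w) (+ w′))
            (cong (λ T → a * (y′ w + y′ w′) * (T * (+ w - + w′))) (sym (trans (3^-+ (δ ℕ.+ δ) (suc (j ℕ.+ j)))
              (cong (3^ (δ ℕ.+ δ) *_) (trans (3^suc (j ℕ.+ j)) (cong (+ 3 *_) (3^-+ j j))))))))
            where
            ring : ∀ d t a y w w′ → d * (t * (y + + 3 * (a * w)) * (t * (y + + 3 * (a * w))) - t *
                (y + + 3 * (a * w′)) * (t * (y + + 3 * (a * w′))))
              ≡ a * ((y + + 3 * (a * w)) + (y + + 3 * (a * w′))) * (d * (+ 3 * (t * t)) * (w - w′))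
            ring = solve-∀

      -- 2δ + 2j + 1 is the precision from which a value with X of valuation j lifts to every higher
      -- modulus; for l = δ + j it is the exponent 2l + 1 of the theorem. The valuation of X at the
      -- lift is recorded for `quad-mid`.
      quad-lift : ∀ {b} → f s₀ ≡ b [mod 3 ^ ((δ ℕ.+ δ) ℕ.+ suc (j ℕ.+ j)) ] → ∀ i →
        ∃ λ s → f s ≡ b [mod 3 ^ (((δ ℕ.+ δ) ℕ.+ suc (j ℕ.+ j)) ℕ.+ i) ] × ∃ λ y → X s ≡ 3^ j * y × Unit y
      quad-lift {b} base i =
        let w , hit = hensel {(δ ℕ.+ δ) ℕ.+ suc (j ℕ.+ j)} {f ∘ s′} lin′ {b}
              (subst (λ s → f s ≡ b [mod 3 ^ ((δ ℕ.+ δ) ℕ.+ suc (j ℕ.+ j)) ])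
                        (sym (trans (cong (s₀ ℕ.+_) (ℕₚ.*-zeroʳ (3 ^ suc j))) (ℕₚ.+-identityʳ s₀))) base) i
        in s′ w , hit , y′ w , X′≡ w , unit-y′ w

    module _ {δ : ℕ} {f : ℕ → ℤ} (quad : Quadratic δ a c f) {b : ℤ} (k M : ℕ) (s₀ : ℕ)
        (hit : f s₀ ≡ b [mod 3 ^ k ]) where

      private
        hit⇒ : ∀ s → f s ≡ b [mod 3 ^ k ] → 3^ k ∣ 3^ (δ ℕ.+ δ) * (X s * X s - X s₀ * X s₀)
        hit⇒ s d = ~-∣ k (quad s s₀) (≡m-trans (f s) b (f s₀) d (≡m-sym (f s₀) b hit))

        hit⇐ : ∀ s → 3^ k ∣ 3^ (δ ℕ.+ δ) * (X s * X s - X s₀ * X s₀) → f s ≡ b [mod 3 ^ k ]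
        hit⇐ s d = ≡m-trans (f s) (f s₀) b (~-∣ k (~-sym (quad s s₀)) d) hit

      -- The hits are the s with 3^E ∣ X s. The upper bound on k gives sufficiency, since 3^(2E)
      -- divides both squares. The lower bound gives necessity: k - 2δ ≥ 2E - 1, and 3^(2E-1) ∣ X²
      -- forces 3^E ∣ X. The alternative E ≡ 0 admits k < 2δ, where the condition is void.
      quad-top : ∀ E R → R ℕ.+ E ≡ M → 3^ E ∣ X s₀ → k ≤ (δ ℕ.+ δ) ℕ.+ (E ℕ.+ E) →
        E ≡ 0 ⊎ (δ ℕ.+ δ) ℕ.+ (E ℕ.+ E) ≤ suc k → cnt (λ s → f s ≡? b [mod 3 ^ k ]) (3 ^ M) ≡ 3 ^ R
      quad-top E R refl 3^E∣X₀ k≤ ≤k = begin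
        cnt (λ s → f s ≡? b [mod 3 ^ k ]) (3 ^ (R ℕ.+ E))
            ≡⟨ cnt-cong _ (λ s → + s ≡? + s₀ [mod 3 ^ E ]) to from (3 ^ (R ℕ.+ E)) ⟩
        cnt (λ s → + s ≡? + s₀ [mod 3 ^ E ]) (3 ^ (R ℕ.+ E))
            ≡⟨ cong (cnt (λ s → + s ≡? + s₀ [mod 3 ^ E ])) (ℕₚ.^-distribˡ-+-* 3 R E) ⟩
        cnt (λ s → + s ≡? + s₀ [mod 3 ^ E ]) (3 ^ R ℕ.* 3 ^ E)
            ≡⟨ cnt-residue (3 ^ E) {{m^n≢0 3 E}} s₀ (3 ^ R) ⟩
        3 ^ R                                                      ∎
        where
        open ≡-Reasoning
        ring : ∀ x y → x - y + y ≡ x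
        ring = solve-∀
        X² : ∀ i s → i ≤ E ℕ.+ E → 3^ i ∣ X s * X s - X s₀ * X s₀ → 3^ i ∣ X s * X s
        X² i s i≤ d = subst (3^ i ∣_) (ring (X s * X s) (X s₀ * X s₀))
            (∣m∣n⇒∣m+n d (∣-trans (3^∣-mono i≤) (3^∣² E 3^E∣X₀)))
        root : ∀ E s → E ≡ 0 ⊎ (δ ℕ.+ δ) ℕ.+ (E ℕ.+ E) ≤ suc k →
            (∀ i → i ≤ E ℕ.+ E → 3^ i ∣ X s * X s - X s₀ * X s₀ → 3^ i ∣ X s * X s) →
          f s ≡ b [mod 3 ^ k ] → 3^ E ∣ X s
        root zero s _ _ _ = divides (X s) (sym (*-identityʳ (X s)))
        root (suc E) s (inj₂ ≤k) X² d = sq-odd E (X² (suc (E ℕ.+ E)) (s≤s (ℕₚ.+-monoʳ-≤ E (ℕₚ.n≤1+n E)))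
          (3^∣3^*⁻ (δ ℕ.+ δ) (suc (E ℕ.+ E)) (∣-trans
              (3^∣-mono (ℕₚ.≤-pred (ℕₚ.≤-trans (ℕₚ.≤-reflexive (nat δ E)) ≤k))) (hit⇒ s d))))
          where
          nat : ∀ δ E → suc ((δ ℕ.+ δ) ℕ.+ suc (E ℕ.+ E)) ≡ (δ ℕ.+ δ) ℕ.+ (suc E ℕ.+ suc E)
          nat = ℕ-Solver.solve-∀
        to : ∀ s → f s ≡ b [mod 3 ^ k ] → + s ≡ + s₀ [mod 3 ^ E ]
        to s d = affine-cong⁻ E s s₀ (∣m∣n⇒∣m-n (root E s ≤k (λ i → X² i s) d) 3^E∣X₀)
        from : ∀ s → + s ≡ + s₀ [mod 3 ^ E ] → f s ≡ b [mod 3 ^ k ]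
        from s d = hit⇐ s (∣-trans (3^∣-mono k≤)
            (3^∣3^* (δ ℕ.+ δ) (E ℕ.+ E) (∣m∣n⇒∣m-n (3^∣² E X∣) (3^∣² E 3^E∣X₀))))
          where
          X∣ : 3^ E ∣ X s
          X∣ = subst (3^ E ∣_) (ring (X s) (X s₀)) (∣m∣n⇒∣m+n (affine-cong E s s₀ d) 3^E∣X₀)

      -- Divide X and X₀ by 3^j to get z and y: of z - y and z + y at most one is divisible by 3, as
      -- they differ by 2y. That one carries all of 3^(i+1), so X ≡ ±X₀ modulo 3^(j+i+1). Each of
      -- these two classes meets the window in 3^(δ+j) points.
      quad-mid : ∀ j i y → X s₀ ≡ 3^ j * y → Unit y → k ≡ (δ ℕ.+ δ) ℕ.+ ((j ℕ.+ j) ℕ.+ suc i) →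
          M ≡ (δ ℕ.+ j) ℕ.+ (j ℕ.+ suc i) →
        cnt (λ s → f s ≡? b [mod 3 ^ k ]) (3 ^ M) ≡ 2 ℕ.* 3 ^ (δ ℕ.+ j)
      quad-mid j i y X₀≡ uy refl refl = begin
        cnt (λ s → f s ≡? b [mod 3 ^ k ]) (3 ^ M)
            ≡⟨ cnt-cong _ (λ s → P? s ⊎-dec Q? s) to from (3 ^ M) ⟩
        cnt (λ s → P? s ⊎-dec Q? s) (3 ^ M)                                  ≡⟨ cnt-⊎ P? Q? disjoint (3 ^ M) ⟩
        cnt P? (3 ^ M) ℕ.+ cnt Q? (3 ^ M)
            ≡⟨ cong (λ n → cnt P? n ℕ.+ cnt Q? n) (ℕₚ.^-distribˡ-+-* 3 (δ ℕ.+ j) e) ⟩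
        cnt P? (3 ^ (δ ℕ.+ j) ℕ.* 3 ^ e) ℕ.+ cnt Q? (3 ^ (δ ℕ.+ j) ℕ.* 3 ^ e)
            ≡⟨ cong₂ ℕ._+_ (cnt-residue (3 ^ e) {{m^n≢0 3 e}} s₀ (3 ^ (δ ℕ.+ j)))
            (cnt-residue (3 ^ e) {{m^n≢0 3 e}} s₁ (3 ^ (δ ℕ.+ j))) ⟩
        3 ^ (δ ℕ.+ j) ℕ.+ 3 ^ (δ ℕ.+ j)
            ≡⟨ cong (3 ^ (δ ℕ.+ j) ℕ.+_) (ℕₚ.+-identityʳ (3 ^ (δ ℕ.+ j))) ⟨
        2 ℕ.* 3 ^ (δ ℕ.+ j)                                                  ∎
        where
        open ≡-Reasoning
        e = j ℕ.+ suc i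
        s₁ = proj₁ (affine-onto e (- X s₀))
        X₁≡ : X s₁ ≡ - X s₀ [mod 3 ^ e ]
        X₁≡ = proj₂ (affine-onto e (- X s₀))
        P? : ∀ s → Dec (+ s ≡ + s₀ [mod 3 ^ e ])
        P? s = + s ≡? + s₀ [mod 3 ^ e ]
        Q? : ∀ s → Dec (+ s ≡ + s₁ [mod 3 ^ e ])
        Q? s = + s ≡? + s₁ [mod 3 ^ e ]
        3^j∣X₀ : 3^ j ∣ X s₀
        3^j∣X₀ = divides y (trans X₀≡ (*-comm (3^ j) y))
        j≤e : j ≤ e
        j≤e = ℕₚ.m≤m+n j (suc i)

        -- A common s would give 3^e ∣ 2 X₀, although X₀ has valuation j < e.
        disjoint : ∀ s → + s ≡ + s₀ [mod 3 ^ e ] → ¬ (+ s ≡ + s₁ [mod 3 ^ e ])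
        disjoint s p q = unit-* 3∤2 uy (3^∣3^*⁻ j 1 (∣-trans (3^∣-mono (ℕₚ.+-monoʳ-≤ j (s≤s (z≤n {i}))))
          (subst (3^ e ∣_) (trans (ring (X s) (X s₀) (X s₁)) (trans (cong (+ 2 *_) X₀≡) (ring′ (3^ j) y)))
            (∣m∣n⇒∣m-n (affine-cong e s s₁ q) (∣m∣n⇒∣m-n (affine-cong e s s₀ p) X₁≡)))))
          where
          ring : ∀ x x₀ x₁ → (x - x₁) - ((x - x₀) - (x₁ - - x₀)) ≡ + 2 * x₀
          ring = solve-∀
          ring′ : ∀ t y → + 2 * (t * y) ≡ t * (+ 2 * y)
          ring′ = solve-∀

        product : ∀ s → X s * X s - X s₀ * X s₀ ≡ (X s - X s₀) * (X s - - X s₀)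
        product s = ring (X s) (X s₀)
          where
          ring : ∀ x y → x * x - y * y ≡ (x - y) * (x - - y)
          ring = solve-∀

        from : ∀ s → (+ s ≡ + s₀ [mod 3 ^ e ]) ⊎ (+ s ≡ + s₁ [mod 3 ^ e ]) → f s ≡ b [mod 3 ^ k ]
        from s pq = hit⇐ s (3^∣3^* (δ ℕ.+ δ) ((j ℕ.+ j) ℕ.+ suc i)
            (subst₂ _∣_ (sym exponent) (sym (product s)) (near pq)))
          where
          exponent : 3^ ((j ℕ.+ j) ℕ.+ suc i) ≡ 3^ e * 3^ j
          exponent = trans (cong 3^_ (nat i j)) (3^-+ e j)
            where
            nat : ∀ i j → (j ℕ.+ j) ℕ.+ suc i ≡ (j ℕ.+ suc i) ℕ.+ j
            nat = ℕ-Solver.solve-∀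
          plus : ∀ x y → (x - y) + + 2 * y ≡ x - - y
          plus = solve-∀
          minus : ∀ x y → (x - - y) - + 2 * y ≡ x - y
          minus = solve-∀
          near : (+ s ≡ + s₀ [mod 3 ^ e ]) ⊎ (+ s ≡ + s₁ [mod 3 ^ e ]) →
              3^ e * 3^ j ∣ (X s - X s₀) * (X s - - X s₀)
          near (inj₁ p) = ∣-*-mono p′ (subst (3^ j ∣_) (plus (X s) (X s₀))
              (∣m∣n⇒∣m+n (∣-trans (3^∣-mono j≤e) p′) (∣n⇒∣m*n (+ 2) 3^j∣X₀)))
            where p′ = affine-cong e s s₀ p
          near (inj₂ q) = subst (_∣ (X s - X s₀) * (X s - - X s₀)) (*-comm (3^ j) (3^ e))
            (∣-*-mono (subst (3^ j ∣_) (minus (X s) (X s₀))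
                (∣m∣n⇒∣m-n (∣-trans (3^∣-mono j≤e) q′) (∣n⇒∣m*n (+ 2) 3^j∣X₀))) q′)
            where q′ = ≡m-trans (X s) (X s₁) (- X s₀) (affine-cong e s s₁ q) X₁≡

        to : ∀ s → f s ≡ b [mod 3 ^ k ] → (+ s ≡ + s₀ [mod 3 ^ e ]) ⊎ (+ s ≡ + s₁ [mod 3 ^ e ])
        to s d = [ (λ p → inj₁ (affine-cong⁻ e s s₀ p)) ,
            (λ q → inj₂ (affine-cong⁻ e s s₁ (≡m-trans (X s) (- X s₀) (X s₁) q (≡m-sym (X s₁) (- X s₀) X₁≡))))
            ]′
          -- 3^(2j) divides X² - X₀² and X₀², hence X², so 3^j can be taken out of X.
          (factor (sq-even j (subst (3^ (j ℕ.+ j) ∣_) (ring (X s * X s) (X s₀ * X s₀))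
             (∣m∣n⇒∣m+n (∣-trans (3^∣-mono (ℕₚ.m≤m+n (j ℕ.+ j) (suc i))) d′) (3^∣² j 3^j∣X₀)))))
          where
          ring : ∀ x y → x - y + y ≡ x
          ring = solve-∀
          d′ : 3^ ((j ℕ.+ j) ℕ.+ suc i) ∣ X s * X s - X s₀ * X s₀
          d′ = 3^∣3^*⁻ (δ ℕ.+ δ) _ (hit⇒ s d)
          factor : 3^ j ∣ X s → (X s ≡ X s₀ [mod 3 ^ e ]) ⊎ (X s ≡ - X s₀ [mod 3 ^ e ])
          factor (divides z Xs≡) = choose (unit-cases (z - - y))
            where
            d″ : 3^ suc i ∣ (z - y) * (z - - y)
            d″ = 3^∣3^*⁻ (j ℕ.+ j) (suc i) (subst (3^ ((j ℕ.+ j) ℕ.+ suc i) ∣_)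
              (trans (cong₂ (λ x x₀ → x * x - x₀ * x₀) Xs≡ X₀≡)
                  (trans (r (3^ j) y z) (cong (_* ((z - y) * (z - - y))) (sym (3^-+ j j))))) d′)
              where
              r : ∀ t y z → z * t * (z * t) - t * y * (t * y) ≡ t * t * ((z - y) * (z - - y))
              r = solve-∀
            scale : ∀ w x → x ≡ 3^ j * w → 3^ suc i ∣ w → 3^ e ∣ x
            scale w x x≡ d = subst (3^ e ∣_) (sym x≡) (3^∣3^* j (suc i) d)
            minus : X s - X s₀ ≡ 3^ j * (z - y)
            minus = trans (cong₂ _-_ Xs≡ X₀≡) (r (3^ j) y z)
              where
              r : ∀ t y z → z * t - t * y ≡ t * (z - y)
              r = solve-∀
            plus : X s - - X s₀ ≡ 3^ j * (z - - y)
            plus = trans (cong₂ (λ x x₀ → x - - x₀) Xs≡ X₀≡) (r (3^ j) y z)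
              where
              r : ∀ t y z → z * t - - (t * y) ≡ t * (z - - y)
              r = solve-∀
            other : + 3 ∣ z - - y → Unit (z - y)
            other p q = unit-* 3∤2 uy (subst (+ 3 ∣_) (r y z) (∣m∣n⇒∣m-n p q))
              where
              r : ∀ y z → (z - - y) - (z - y) ≡ + 2 * y
              r = solve-∀
            choose : + 3 ∣ z - - y ⊎ Unit (z - - y) → (X s ≡ X s₀ [mod 3 ^ e ]) ⊎ (X s ≡ - X s₀ [mod 3 ^ e ])
            choose (inj₁ p) = inj₂ (scale (z - - y) _ plus (3^∣-cancelˡ (suc i) (other p) d″))
            choose (inj₂ u) = inj₁ (scale (z - y) _ minus (3^∣-cancelʳ (suc i) u d″))

  -- Identities for solutions of the recurrence.

  Recurrence : ℤ → (ℕ → ℤ) → Set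
  Recurrence P s = ∀ n → s (suc (suc n)) ≡ P * s (suc n) + s n

  -- The sequences are abstract here: unfolding u P n and v P n at numerals is expensive.
  record LucasPair (P : ℤ) : Set where
    field
      U V   : ℕ → ℤ
      rec-u : Recurrence P U
      rec-v : Recurrence P V
      u0    : U 0 ≡ 0ℤ
      u1    : U 1 ≡ 1ℤ
      v0    : V 0 ≡ + 2
      v1    : V 1 ≡ P

  module Lucas {P : ℤ} (lucas : LucasPair P) where

    open LucasPair lucas public

    Rec : (ℕ → ℤ) → Set
    Rec = Recurrence P

    u2 : U 2 ≡ P
    u2 = trans (rec-u 0) (trans (cong₂ (λ x y → P * x + y) u1 u0) (ring P))
      where
      ring : ∀ P → P * 1ℤ + 0ℤ ≡ P
      ring = solve-∀

    v2 : V 2 ≡ P * P + + 2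
    v2 = trans (rec-v 0) (cong₂ (λ x y → P * x + y) v1 v0)

    -- Both sides satisfy the recurrence in m. The coefficient `U (suc m) - P * U m` is u(m-1),
    -- written so that m = 0 is covered.
    rec-+ : ∀ {s} → Rec s → ∀ m n → s (m ℕ.+ n) ≡ U m * s (suc n) + (U (suc m) - P * U m) * s n
    rec-+ {s} rec zero n = trans (ring P (s n) (s (suc n)))
        (cong₂ (λ a b → a * s (suc n) + (b - P * a) * s n) (sym u0) (sym u1))
      where
      ring : ∀ P x y → x ≡ 0ℤ * y + (1ℤ - P * 0ℤ) * x
      ring = solve-∀
    rec-+ {s} rec (suc zero) n = trans (ring P (s n) (s (suc n)))
        (cong₂ (λ a b → a * s (suc n) + (b - P * a) * s n) (sym u1) (sym u2))
      where
      ring : ∀ P x y → y ≡ 1ℤ * y + (P - P * 1ℤ) * x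
      ring = solve-∀
    rec-+ {s} rec (suc (suc m)) n = trans (rec (m ℕ.+ n))
      (trans (cong₂ (λ x y → P * x + y) (rec-+ rec (suc m) n) (rec-+ rec m n))
      (trans (cong (λ c → P * (U (suc m) * s (suc n) + (c - P * U (suc m)) * s n) +
          (U m * s (suc n) + (U (suc m) - P * U m) * s n)) (rec-u m))
      (trans (ring P (U m) (U (suc m)) (s n) (s (suc n)))
             (sym (trans (cong (λ c → U (suc (suc m)) * s (suc n) + (c - P * U (suc (suc m))) * s n)
                 (rec-u (suc m)))
                         (cong (λ c → c * s (suc n) + (P * c + U (suc m) - P * c) * s n) (rec-u m)))))))
      where
      ring : ∀ P a a′ x y → P * (a′ * y + ((P * a′ + a) - P * a′) * x) + (a * y + (a′ - P * a) * x)
        ≡ (P * a′ + a) * y + ((P * (P * a′ + a) + a′) - P * (P * a′ + a)) * x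
      ring = solve-∀

    -- Only for even m: in general the right-hand side is (−1)^m.
    Cassini : ℕ → Set
    Cassini m = U (suc m) * U (suc m) - P * U m * U (suc m) - U m * U m ≡ 1ℤ

    cassini-+2 : ∀ m → Cassini m → Cassini (2 ℕ.+ m)
    cassini-+2 m = trans (trans (cong (λ c → c * c - P * U (suc (suc m)) * c - U (suc (suc m)) * U
        (suc (suc m))) (rec-u (suc m)))
      (trans (cong (λ c → (P * c + U (suc m)) * (P * c + U (suc m)) - P * c * (P * c + U (suc m)) - c * c)
          (rec-u m))
        (ring P (U m) (U (suc m)))))
      where
      ring : ∀ P a b → (P * (P * b + a) + b) * (P * (P * b + a) + b) - P * (P * b + a) * (P * (P * b + a) + b)
          - (P * b + a) * (P * b + a)
        ≡ b * b - P * a * b - a * a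
      ring = solve-∀

    cassini-0 : Cassini 0
    cassini-0 = trans (cong₂ (λ a b → b * b - P * a * b - a * a) u0 u1) (ring P)
      where
      ring : ∀ P → 1ℤ * 1ℤ - P * 0ℤ * 1ℤ - 0ℤ * 0ℤ ≡ 1ℤ
      ring = solve-∀

    cassini-4 : ∀ t m → Cassini m → Cassini (t ℕ.* 4 ℕ.+ m)
    cassini-4 zero    m c = c
    cassini-4 (suc t) m c = cassini-+2 _ (cassini-+2 _ (cassini-4 t m c))

    -- The matrix advancing (s n, s (n+1)) by m steps has determinant 1 by `Cassini`; the left side
    -- is the first row of its inverse.
    rec-back : ∀ {s} → Rec s → ∀ m → Cassini m → ∀ n → U (suc m) * s (m ℕ.+ n) - U m * s (suc (m ℕ.+ n)) ≡ s n
    rec-back {s} rec m cas n = begin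
      U (suc m) * s (m ℕ.+ n) - U m * s (suc (m ℕ.+ n))
        ≡⟨ cong₂ (λ x y → U (suc m) * x - U m * y) (rec-+ rec m n)
             (trans (cong s (sym (ℕₚ.+-suc m n)))
                 (trans (rec-+ rec m (suc n)) (cong (λ x → U m * x + (U (suc m) - P * U m) * s (suc n))
                 (rec n)))) ⟩
      U (suc m) * (U m * s (suc n) + (U (suc m) - P * U m) * s n) - U m *
          (U m * (P * s (suc n) + s n) + (U (suc m) - P * U m) * s (suc n))
        ≡⟨ ring P (U m) (U (suc m)) (s n) (s (suc n)) ⟩
      (U (suc m) * U (suc m) - P * U m * U (suc m) - U m * U m) * s n
        ≡⟨ cong (_* s n) cas ⟩
      1ℤ * s n
        ≡⟨ *-identityˡ (s n) ⟩
      s n ∎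
      where
      open ≡-Reasoning
      ring : ∀ P a b x y → b * (a * y + (b - P * a) * x) - a * (a * (P * y + x) + (b - P * a) * y) ≡
          (b * b - P * a * b - a * a) * x
      ring = solve-∀

    -- For s = u this is v, and for s = v it is (P² + 4) u.
    partner : (ℕ → ℤ) → ℕ → ℤ
    partner s n = + 2 * s (suc n) - P * s n

    rec-partner : ∀ {s} → Rec s → Rec (partner s)
    rec-partner {s} rec n = trans (cong₂ (λ x y → + 2 * x - P * y) (rec (suc n)) (rec n))
      (ring P (s n) (s (suc n)) (s (suc (suc n))))
      where
      ring : ∀ P a b c → + 2 * (P * c + b) - P * (P * b + a) ≡ P * (+ 2 * c - P * b) + (+ 2 * b - P * a)
      ring = solve-∀

    rec-unique : ∀ {s t} → Rec s → Rec t → s 0 ≡ t 0 → s 1 ≡ t 1 → ∀ n → s n ≡ t n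
    rec-unique rs rt e₀ e₁ zero          = e₀
    rec-unique rs rt e₀ e₁ (suc zero)    = e₁
    rec-unique rs rt e₀ e₁ (suc (suc n)) = trans (rs n) (trans
      (cong₂ (λ x y → P * x + y) (rec-unique rs rt e₀ e₁ (suc n)) (rec-unique rs rt e₀ e₁ n)) (sym (rt n)))

    partner-u : ∀ n → partner U n ≡ V n
    partner-u = rec-unique (rec-partner rec-u) rec-v
      (trans (cong₂ (λ x y → + 2 * x - P * y) u1 u0) (trans (ring₀ P) (sym v0)))
      (trans (cong₂ (λ x y → + 2 * x - P * y) u2 u1) (trans (ring₁ P) (sym v1)))
      where
      ring₀ : ∀ P → + 2 * 1ℤ - P * 0ℤ ≡ + 2
      ring₀ = solve-∀
      ring₁ : ∀ P → + 2 * P - P * 1ℤ ≡ P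
      ring₁ = solve-∀

    partner-v : ∀ n → partner V n ≡ (P * P + + 4) * U n
    partner-v = rec-unique (rec-partner rec-v)
        (λ n → trans (cong ((P * P + + 4) *_) (rec-u n)) (ring (P * P + + 4) P (U n) (U (suc n))))
      (trans (cong₂ (λ x y → + 2 * x - P * y) v1 v0) (trans (ring₀ P) (cong ((P * P + + 4) *_) (sym u0))))
      (trans (cong₂ (λ x y → + 2 * x - P * y) v2 v1) (trans (ring₁ P) (cong ((P * P + + 4) *_) (sym u1))))
      where
      ring : ∀ D P a b → D * (P * b + a) ≡ P * (D * b) + D * a
      ring = solve-∀
      ring₀ : ∀ P → + 2 * P - P * + 2 ≡ (P * P + + 4) * 0ℤ
      ring₀ = solve-∀
      ring₁ : ∀ P → + 2 * (P * P + + 2) - P * P ≡ (P * P + + 4) * 1ℤ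
      ring₁ = solve-∀

    -- The two indices lie m steps after and m steps before the centre m + n, so `rec-+` and
    -- `rec-back` express both values through s (m+n) and s (m+n+1). Subtracting gives the partner;
    -- adding gives `rec-plus`.
    rec-minus : ∀ {s} → Rec s → ∀ m → Cassini m → ∀ n → s (m ℕ.+ (m ℕ.+ n)) - s n ≡ U m * partner s (m ℕ.+ n)
    rec-minus {s} rec m cas n = trans (cong₂ _-_ (rec-+ rec m (m ℕ.+ n)) (sym (rec-back rec m cas n)))
      (ring P (U m) (U (suc m)) (s (m ℕ.+ n)) (s (suc (m ℕ.+ n))))
      where
      ring : ∀ P a b x y → (a * y + (b - P * a) * x) - (b * x - a * y) ≡ a * (+ 2 * y - P * x)
      ring = solve-∀

    rec-plus : ∀ {s} → Rec s → ∀ m → Cassini m → ∀ n → s (m ℕ.+ (m ℕ.+ n)) + s n ≡ V m * s (m ℕ.+ n)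
    rec-plus {s} rec m cas n = trans (cong₂ _+_ (rec-+ rec m (m ℕ.+ n)) (sym (rec-back rec m cas n)))
      (trans (ring P (U m) (U (suc m)) (s (m ℕ.+ n)) (s (suc (m ℕ.+ n))))
          (cong (_* s (m ℕ.+ n)) (partner-u m)))
      where
      ring : ∀ P a b x y → (a * y + (b - P * a) * x) + (b * x - a * y) ≡ (+ 2 * b - P * a) * x
      ring = solve-∀

  -- The valuations of U(4s) and V(4x+2).

  data Mod3 : ℕ → Set where
    3* : ∀ t → Mod3 (t ℕ.* 3)
    3*+1 : ∀ t → Mod3 (suc (t ℕ.* 3))
    3*+2 : ∀ t → Mod3 (suc (suc (t ℕ.* 3)))

  mod3 : ∀ n → Mod3 n
  mod3 0 = 3* 0
  mod3 1 = 3*+1 0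
  mod3 2 = 3*+2 0
  mod3 (suc (suc (suc n))) with mod3 n
  ... | 3* t   = 3* (suc t)
  ... | 3*+1 t = 3*+1 (suc t)
  ... | 3*+2 t = 3*+2 (suc t)

  data Mod2 : ℕ → Set where
    2* : ∀ t → Mod2 (t ℕ.* 2)
    2*+1 : ∀ t → Mod2 (suc (t ℕ.* 2))

  mod2 : ∀ n → Mod2 n
  mod2 0 = 2* 0
  mod2 1 = 2*+1 0
  mod2 (suc (suc n)) with mod2 n
  ... | 2* t   = 2* (suc t)
  ... | 2*+1 t = 2*+1 (suc t)

  module Valuation {P : ℤ} (lucas : LucasPair P) (δ : ℕ) (3∤P : Unit P) (1≤δ : 1 ≤ δ)
      (exact : ExactPower 3 δ (P * P + + 2)) where

    open Lucas lucas

    3∣3^δ : + 3 ∣ 3^ δ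
    3∣3^δ = 3^∣-mono {1} 1≤δ

    3^δ∣v2 : 3^ δ ∣ V 2
    3^δ∣v2 = subst (3^ δ ∣_) (sym v2) (proj₁ exact)

    rec-+4 : ∀ {s} → Rec s → ∀ n → s (4 ℕ.+ n) + s n ≡ V 2 * s (2 ℕ.+ n)
    rec-+4 rec n = rec-plus rec 2 (cassini-+2 0 cassini-0) n

    3^δ∣+4 : ∀ {s} → Rec s → ∀ n → 3^ δ ∣ s (4 ℕ.+ n) + s n
    3^δ∣+4 {s} rec n = subst (3^ δ ∣_) (sym (rec-+4 rec n)) (∣m⇒∣m*n (s (2 ℕ.+ n)) 3^δ∣v2)

    3^δ∣+4t : ∀ {s} → Rec s → ∀ n → 3^ δ ∣ s n → ∀ t → 3^ δ ∣ s (t ℕ.* 4 ℕ.+ n)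
    3^δ∣+4t rec n d zero    = d
    3^δ∣+4t {s} rec n d (suc t) = subst (3^ δ ∣_) (ring (s (4 ℕ.+ (t ℕ.* 4 ℕ.+ n))) (s (t ℕ.* 4 ℕ.+ n)))
      (∣m∣n⇒∣m-n (3^δ∣+4 rec (t ℕ.* 4 ℕ.+ n)) (3^δ∣+4t rec n d t))
      where
      ring : ∀ x y → x + y - y ≡ x
      ring = solve-∀

    unit-+4t : ∀ {s} → Rec s → ∀ n → Unit (s n) → ∀ t → Unit (s (t ℕ.* 4 ℕ.+ n))
    unit-+4t rec n un zero = un
    unit-+4t {s} rec n un (suc t) d = unit-+4t rec n un t
        (subst (+ 3 ∣_) (ring (s (4 ℕ.+ (t ℕ.* 4 ℕ.+ n))) (s (t ℕ.* 4 ℕ.+ n)))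
      (∣m∣n⇒∣m-n (∣-trans 3∣3^δ (3^δ∣+4 rec (t ℕ.* 4 ℕ.+ n))) d))
      where
      ring : ∀ x y → x + y - x ≡ y
      ring = solve-∀

    3^δ∣u4 : ∀ t → 3^ δ ∣ U (t ℕ.* 4)
    3^δ∣u4 t = subst (λ n → 3^ δ ∣ U n) (ℕₚ.+-identityʳ (t ℕ.* 4)) (3^δ∣+4t rec-u 0 (divides 0ℤ u0) t)

    unit-u2 : Unit (U 2)
    unit-u2 d = 3∤P (subst (+ 3 ∣_) u2 d)

    private
      3^δ⁺ = 3^ (suc δ)

      -- V 6 = V 2 (V 2² - 3) gains a factor 3 over V 2. By the sum formula U then changes only its
      -- sign modulo 3^(δ+1) under a shift by 12, so whether that power divides U(4s) depends on s
      -- modulo 3 alone.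
      3^δ⁺∣v6 : 3^δ⁺ ∣ V 6
      3^δ⁺∣v6 = subst₂ _∣_ (sym (3^suc δ)) (sym eq) (∣-*-mono 3∣ 3^δ∣v2)
        where
        move : ∀ {x y z} → x + y ≡ z → x ≡ z - y
        move {x} {y} refl = ring x y
          where
          ring : ∀ x y → x ≡ x + y - y
          ring = solve-∀
        eq : V 6 ≡ (V 2 * V 2 - + 3) * V 2
        eq = trans (move (rec-+4 rec-v 2)) (trans
            (cong (λ x → V 2 * x - V 2) (trans (move (rec-+4 rec-v 0)) (cong (λ x → V 2 * V 2 - x) v0)))
            (ring (V 2)))
          where
          ring : ∀ x → x * (x * x - + 2) - x ≡ (x * x - + 3) * x
          ring = solve-∀
        3∣ : + 3 ∣ V 2 * V 2 - + 3
        3∣ = ∣m∣n⇒∣m-n (∣n⇒∣m*n (V 2) (∣-trans 3∣3^δ 3^δ∣v2)) (divides 1ℤ refl)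

      u12 : ∀ n → 3^δ⁺ ∣ U (12 ℕ.+ n) + U n
      u12 n = subst (3^δ⁺ ∣_) (sym (rec-plus rec-u 6 (cassini-+2 4 (cassini-+2 2 (cassini-+2 0 cassini-0)))
          n)) (∣m⇒∣m*n (U (6 ℕ.+ n)) 3^δ⁺∣v6)

      exact-step : ∀ r t → ¬ (3^δ⁺ ∣ U (r ℕ.* 4)) → ¬ (3^δ⁺ ∣ U ((t ℕ.* 3 ℕ.+ r) ℕ.* 4))
      exact-step r zero    ¬d = ¬d
      exact-step r (suc t) ¬d d = exact-step r t ¬d
          (subst (3^δ⁺ ∣_) (ring (U (12 ℕ.+ (t ℕ.* 3 ℕ.+ r) ℕ.* 4)) (U ((t ℕ.* 3 ℕ.+ r) ℕ.* 4)))
          (∣m∣n⇒∣m-n (u12 ((t ℕ.* 3 ℕ.+ r) ℕ.* 4)) d))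
        where
        ring : ∀ x y → x + y - x ≡ y
        ring = solve-∀

      +u0 : ∀ x → x + U 0 ≡ x
      +u0 x = trans (cong (λ y → x + y) u0) (+-identityʳ x)

      -u0 : ∀ x → x - U 0 ≡ x
      -u0 x = trans (cong (λ y → x - y) u0) (+-identityʳ x)

      -- U 4 = V 2 · U 2 with U 2 = P prime to 3, so the exactness of δ passes from P² + 2 to U 4;
      -- from there it passes to U 8 = U 4 · V 4.
      exact-4 : ¬ (3^δ⁺ ∣ U 4)
      exact-4 d = proj₂ exact (3^∣-cancelʳ (suc δ) unit-u2
          (subst (3^δ⁺ ∣_) (trans (sym (+u0 (U 4))) (trans (rec-+4 rec-u 0) (cong (_* U 2) v2))) d))

      unit-v4 : Unit (V 4)
      unit-v4 = unit-+4t rec-v 0 (subst Unit (sym v0) 3∤2) 1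

      exact-8 : ¬ (3^δ⁺ ∣ U 8)
      exact-8 d = exact-4 (3^∣-cancelʳ (suc δ) unit-v4
        (subst (3^δ⁺ ∣_) (trans (sym (-u0 (U 8)))
            (trans (rec-minus rec-u 4 (cassini-4 1 0 cassini-0) 0) (cong (U 4 *_) (partner-u 4)))) d))

      u4-unit : ∀ s → Unit (+ s) → ¬ (3^δ⁺ ∣ U (s ℕ.* 4)) → U (s ℕ.* 4) ~ 3^ δ * + s
      u4-unit s us ¬d with 3^δ∣u4 s
      ... | divides z eq = mk~ (+ s) z us (λ 3∣z → ¬d
          (subst₂ _∣_ (sym (3^suc δ)) (sym eq) (∣-*-mono 3∣z (divides 1ℤ (sym (*-identityˡ (3^ δ)))))))
        (trans (cong (_* + s) eq) (ring z (3^ δ) (+ s)))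
        where
        ring : ∀ z t s → z * t * s ≡ t * s * z
        ring = solve-∀

      -- With m = 4t, U(3m) = U m (D (U m)² + 3). As 3 ∣ U m, the second factor is 3 times the unit
      -- `e`, so tripling adds exactly one factor 3.
      u4-triple : ∀ t → U (t ℕ.* 4) ~ 3^ δ * + t → U (t ℕ.* 3 ℕ.* 4) ~ 3^ δ * + (t ℕ.* 3)
      u4-triple t ih with ∣-trans 3∣3^δ (3^δ∣u4 t)
      ... | divides w eq = ~-trans (~-reflexive triple)
          (~-trans (~-unitˡ ue) (~-trans (~-* (~-reflexive {+ 3} refl) ih) (~-reflexive last)))
        where
        m = t ℕ.* 4
        D = P * P + + 4
        e = + 3 * (D * w * w) + 1ℤ
        ue : Unit e
        ue d = 3∤1 (subst (+ 3 ∣_) (ring (D * w * w)) (∣m∣n⇒∣m-n d (∣m⇒∣m*n (D * w * w) (divides 1ℤ refl))))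
          where
          ring : ∀ x → + 3 * x + 1ℤ - + 3 * x ≡ 1ℤ
          ring = solve-∀
        last : + 3 * (3^ δ * + t) ≡ 3^ δ * + (t ℕ.* 3)
        last = trans (ring (3^ δ) (+ t)) (cong (3^ δ *_) (sym (pos-* t 3)))
          where
          ring : ∀ x t → + 3 * (x * t) ≡ x * (t * + 3)
          ring = solve-∀
        cas : Cassini m
        cas = subst Cassini (ℕₚ.+-identityʳ m) (cassini-4 t 0 cassini-0)
        v2m : V (m ℕ.+ m) ≡ + 2 + U m * (D * U m)
        v2m = trans (ring (V (m ℕ.+ m))) (cong (λ x → + 2 + x) (trans
          (trans (cong (λ y → V (m ℕ.+ m) - y) (sym v0))
              (subst (λ n → V (m ℕ.+ n) - V 0 ≡ U m * partner V n) (ℕₚ.+-identityʳ m)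
              (rec-minus rec-v m cas 0)))
          (cong (U m *_) (partner-v m))))
          where
          ring : ∀ x → x ≡ + 2 + (x - + 2)
          ring = solve-∀
        triple : U (t ℕ.* 3 ℕ.* 4) ≡ e * (+ 3 * U (t ℕ.* 4))
        triple = begin
          U (t ℕ.* 3 ℕ.* 4)                            ≡⟨ cong U (nat t) ⟩
          U (m ℕ.+ (m ℕ.+ m))                          ≡⟨ ring₁ (U (m ℕ.+ (m ℕ.+ m))) (U m) ⟩
          (U (m ℕ.+ (m ℕ.+ m)) - U m) + U m
              ≡⟨ cong (_+ U m) (trans (rec-minus rec-u m cas m)
              (cong (U m *_) (trans (partner-u (m ℕ.+ m)) v2m))) ⟩
          U m * (+ 2 + U m * (D * U m)) + U m          ≡⟨ ring₂ D (U m) ⟩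
          (D * U m * U m + + 3) * U m                  ≡⟨ cong (λ x → (D * x * x + + 3) * U m) eq ⟩
          (D * (w * + 3) * (w * + 3) + + 3) * U m      ≡⟨ ring₃ D w (U m) ⟩
          e * (+ 3 * U m)                              ∎
          where
          open ≡-Reasoning
          nat : ∀ t → t ℕ.* 3 ℕ.* 4 ≡ t ℕ.* 4 ℕ.+ (t ℕ.* 4 ℕ.+ t ℕ.* 4)
          nat = ℕ-Solver.solve-∀
          ring₁ : ∀ x y → x ≡ x - y + y
          ring₁ = solve-∀
          ring₂ : ∀ D x → x * (+ 2 + x * (D * x)) + x ≡ (D * x * x + + 3) * x
          ring₂ = solve-∀
          ring₃ : ∀ D w x → (D * (w * + 3) * (w * + 3) + + 3) * x ≡ (+ 3 * (D * w * w) + 1ℤ) * (+ 3 * x)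
          ring₃ = solve-∀

      unit-3*+ : ∀ t r → Unit (+ r) → Unit (+ (r ℕ.+ t ℕ.* 3))
      unit-3*+ t r ur d = ur (subst (+ 3 ∣_) (ring (+ r) (+ (t ℕ.* 3)))
          (∣m∣n⇒∣m-n d (divides (+ t) (pos-* t 3))))
        where
        ring : ∀ x y → x + y - y ≡ x
        ring = solve-∀

    -- Lifting the exponent: `u4-triple` removes the factors 3 from s, and for s prime to 3 the
    -- valuation is exactly δ. The relation `_~_` lets s = 0 take part.
    u4-val : ∀ s → U (s ℕ.* 4) ~ 3^ δ * + s
    u4-val = <-rec (λ s → U (s ℕ.* 4) ~ 3^ δ * + s) step
      where
      step : ∀ s → (∀ {t} → t < s → U (t ℕ.* 4) ~ 3^ δ * + t) → U (s ℕ.* 4) ~ 3^ δ * + s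
      step s ih with mod3 s
      ... | 3* zero    = ~-reflexive (trans u0 (ring (3^ δ)))
        where
        ring : ∀ x → 0ℤ ≡ x * 0ℤ
        ring = solve-∀
      ... | 3* (suc t) = u4-triple (suc t) (ih (s≤s (s≤s (ℕₚ.m≤n⇒m≤1+n (ℕₚ.m≤m*n t 3)))))
      ... | 3*+1 t     = u4-unit (1 ℕ.+ t ℕ.* 3) (unit-3*+ t 1 3∤1)
          (subst (λ n → ¬ (3^δ⁺ ∣ U (n ℕ.* 4))) (ℕₚ.+-comm (t ℕ.* 3) 1) (exact-step 1 t exact-4))
      ... | 3*+2 t     = u4-unit (2 ℕ.+ t ℕ.* 3) (unit-3*+ t 2 3∤2)
          (subst (λ n → ¬ (3^δ⁺ ∣ U (n ℕ.* 4))) (ℕₚ.+-comm (t ℕ.* 3) 2) (exact-step 2 t exact-8))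

    -- With m = 4x + 2 one has U m · V m = U(2m) and 2m = 4(1 + 2x); as U m is a unit, V m has the
    -- valuation of U(2m).
    v2-val : ∀ x → V (x ℕ.* 4 ℕ.+ 2) ~ 3^ δ * + (1 ℕ.+ x ℕ.* 2)
    v2-val x = ~-trans (~-sym (~-unitˡ (unit-+4t rec-u 2 unit-u2 x)))
        (~-trans (~-reflexive eq) (u4-val (1 ℕ.+ x ℕ.* 2)))
      where
      m = x ℕ.* 4 ℕ.+ 2
      nat : ∀ x → (x ℕ.* 4 ℕ.+ 2) ℕ.+ (x ℕ.* 4 ℕ.+ 2) ≡ (1 ℕ.+ x ℕ.* 2) ℕ.* 4
      nat = ℕ-Solver.solve-∀
      eq : U m * V m ≡ U ((1 ℕ.+ x ℕ.* 2) ℕ.* 4)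
      eq = trans (sym (cong (U m *_) (partner-u m))) (trans
        (sym (subst (λ n → U (m ℕ.+ n) - U 0 ≡ U m * partner U n) (ℕₚ.+-identityʳ m)
            (rec-minus rec-u m (cassini-4 x 2 (cassini-+2 0 cassini-0)) 0)))
        (trans (-u0 _) (cong U (nat x))))

  -- The class with quadratic behaviour.

  wlog-≤ : ∀ K (f g : ℕ → ℤ) → (∀ s d → f (s ℕ.+ d) - f s ~ K * (g (s ℕ.+ d) - g s)) →
    ∀ s s′ → f s - f s′ ~ K * (g s - g s′)
  wlog-≤ K f g h s s′ = [ (λ s≤s′ → swap (at s≤s′)) , at ]′ (ℕₚ.≤-total s s′)
    where
    at : ∀ {s s′} → s′ ≤ s → f s - f s′ ~ K * (g s - g s′)
    at {s} {s′} s′≤s = subst (λ t → f t - f s′ ~ K * (g t - g s′)) (ℕₚ.m+[n∸m]≡n s′≤s) (h s′ (s ℕ.∸ s′))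
    swap : f s′ - f s ~ K * (g s′ - g s) → f s - f s′ ~ K * (g s - g s′)
    swap r = subst₂ _~_ (ring₁ (f s) (f s′)) (ring₂ K (g s) (g s′)) (~-neg r)
      where
      ring₁ : ∀ x y → - (y - x) ≡ x - y
      ring₁ = solve-∀
      ring₂ : ∀ K x y → - (K * (y - x)) ≡ K * (x - y)
      ring₂ = solve-∀

  3^-odd : ∀ N → ∃ λ z → 3 ^ N ≡ 1 ℕ.+ z ℕ.* 2
  3^-odd zero    = 0 , refl
  3^-odd (suc N) with 3^-odd N
  ... | z , eq = 1 ℕ.+ z ℕ.* 3 , trans (cong (3 ℕ.*_) eq) (nat z)
    where
    nat : ∀ z → 3 ℕ.* (1 ℕ.+ z ℕ.* 2) ≡ 1 ℕ.+ (1 ℕ.+ z ℕ.* 3) ℕ.* 2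
    nat = ℕ-Solver.solve-∀

  -- Capping the valuation at E puts x = 0 into the first alternative.
  valuation-below : ∀ E x → 3^ E ∣ x ⊎ ∃ λ j → j < E × ∃ λ y → x ≡ 3^ j * y × Unit y
  valuation-below zero    x = inj₁ (divides x (sym (*-identityʳ x)))
  valuation-below (suc E) x with unit-cases x
  ... | inj₂ ux = inj₂ (0 , s≤s z≤n , x , sym (*-identityˡ x) , ux)
  ... | inj₁ (divides x′ refl) with valuation-below E x′
  ...   | inj₁ d = inj₁ (subst (3^ suc E ∣_) (*-comm (+ 3) x′) (3^∣3^* 1 E d))
  ...   | inj₂ (j , j<E , y , refl , uy) = inj₂
      (suc j , s≤s j<E , y , trans (ring (3^ j) y) (cong (_* y) (sym (3^suc j))) , uy)
    where
    ring : ∀ t y → t * y * + 3 ≡ + 3 * t * y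
    ring = solve-∀

  -- This makes 3^j a representative for all X = 3^j y: the squares agree modulo 3^(2j+1).
  unit-square : ∀ y → Unit y → + 3 ∣ y * y - 1ℤ
  unit-square y uy = [ (λ d → subst (+ 3 ∣_) (ring₁ y) (∣m⇒∣m*n (y + 1ℤ) d)) ,
      (λ d → subst (+ 3 ∣_) (ring₂ y) (∣m⇒∣m*n (y - 1ℤ) d)) ]′ (unit-± y 1ℤ uy 3∤1)
    where
    ring₁ : ∀ y → (y - 1ℤ) * (y + 1ℤ) ≡ y * y - 1ℤ
    ring₁ = solve-∀
    ring₂ : ∀ y → (y + 1ℤ) * (y - 1ℤ) ≡ y * y - 1ℤ
    ring₂ = solve-∀

  -- G is 3-adically a quadratic function of X = a t + c on t of fixed parity; adding
  -- the odd number 3^N to t changes the parity, moves X by little and negates G.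
  module Singular (δ : ℕ) (1≤δ : 1 ≤ δ) (G : ℕ → ℤ) (a c : ℤ) (ua : Unit a)
    (quad : ∀ t d → G (t ℕ.+ d ℕ.* 2) - G t ~ 3^ (δ ℕ.+ δ) *
        (affine a c (t ℕ.+ d ℕ.* 2) * affine a c (t ℕ.+ d ℕ.* 2) - affine a c t * affine a c t))
    (flip : ∀ t N → G (t ℕ.+ 3 ^ N) ≡ - G t [mod 3 ^ (δ ℕ.+ N) ])
    (even-odd : ∀ s s′ → Unit (G (s ℕ.* 2) - G (1 ℕ.+ s′ ℕ.* 2))) where

    private
      X : ℕ → ℤ
      X = affine a c

      a₂ : ℤ
      a₂ = a * + 2

      ua₂ : Unit a₂
      ua₂ = unit-* ua 3∤2

      c₂ : ℕ → ℤ
      c₂ o = a * + o + c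

      X-class : ∀ o s → affine a₂ (c₂ o) s ≡ X (o ℕ.+ s ℕ.* 2)
      X-class o s = trans (ring a c (+ o) (+ s)) (cong (λ x → a * (+ o + x) + c) (sym (pos-* s 2)))
        where
        ring : ∀ a c o s → a * + 2 * s + (a * o + c) ≡ a * (o + s * + 2) + c
        ring = solve-∀

    class : ∀ o → Quadratic δ a₂ (c₂ o) (λ s → G (o ℕ.+ s ℕ.* 2))
    class o s s′ = subst₂ (λ x x′ → G (o ℕ.+ s ℕ.* 2) - G (o ℕ.+ s′ ℕ.* 2) ~ 3^ (δ ℕ.+ δ) * (x * x - x′ * x′))
        (sym (X-class o s)) (sym (X-class o s′))
      (wlog-≤ (3^ (δ ℕ.+ δ)) (λ s → G (o ℕ.+ s ℕ.* 2)) (λ s → X (o ℕ.+ s ℕ.* 2) * X (o ℕ.+ s ℕ.* 2))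
        (λ s d → subst (λ n → G n - G (o ℕ.+ s ℕ.* 2) ~ 3^ (δ ℕ.+ δ) *
            (X n * X n - X (o ℕ.+ s ℕ.* 2) * X (o ℕ.+ s ℕ.* 2))) (nat o s d) (quad (o ℕ.+ s ℕ.* 2) d)) s s′)
      where
      nat : ∀ o s d → o ℕ.+ s ℕ.* 2 ℕ.+ d ℕ.* 2 ≡ o ℕ.+ (s ℕ.+ d) ℕ.* 2
      nat = ℕ-Solver.solve-∀

    X-shift : ∀ t N → X (t ℕ.+ 3 ^ N) ≡ X t + a * 3^ N
    X-shift t N = ring a c (+ t) (3^ N)
      where
      ring : ∀ a c t x → a * (t + x) + c ≡ a * t + c + a * x
      ring = solve-∀

    private
      same-class : ∀ i m o s s′ → 3^ i ∣ X (o ℕ.+ s ℕ.* 2) * X (o ℕ.+ s ℕ.* 2) - X (o ℕ.+ s′ ℕ.* 2) * X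
          (o ℕ.+ s′ ℕ.* 2) → m ≤ (δ ℕ.+ δ) ℕ.+ i →
        G (o ℕ.+ s ℕ.* 2) ≡ G (o ℕ.+ s′ ℕ.* 2) [mod 3 ^ m ]
      same-class i m o s s′ div m≤ = ∣-trans (3^∣-mono m≤) (~-∣ ((δ ℕ.+ δ) ℕ.+ i) (~-sym (class o s s′))
        (3^∣3^* (δ ℕ.+ δ) i (subst₂ (λ x x′ → 3^ i ∣ x * x - x′ * x′) (sym (X-class o s)) (sym (X-class o s′))
            div)))

      shift² : ∀ i t t′ N → i ≤ N → 3^ i ∣ X t * X t - X t′ * X t′ →
          3^ i ∣ X t * X t - X (t′ ℕ.+ 3 ^ N) * X (t′ ℕ.+ 3 ^ N)
      shift² i t t′ N i≤N d = subst (3^ i ∣_)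
          (trans (ring (X t) (X t′) a (3^ N)) (cong (λ x → X t * X t - x * x) (sym (X-shift t′ N))))
        (∣m∣n⇒∣m-n d (∣m⇒∣m*n (a * (+ 2 * X t′ + a * 3^ N)) (3^∣-mono i≤N)))
        where
        ring : ∀ x y a n → x * x - y * y - n * (a * (+ 2 * y + a * n)) ≡ x * x - (y + a * n) * (y + a * n)
        ring = solve-∀

      odd-shift : ∀ t N → ∃ λ s → t ℕ.* 2 ℕ.+ 3 ^ N ≡ 1 ℕ.+ s ℕ.* 2
      odd-shift t N with 3^-odd N
      ... | z , eq = t ℕ.+ z , trans (cong (t ℕ.* 2 ℕ.+_) eq) (nat t z)
        where
        nat : ∀ t z → t ℕ.* 2 ℕ.+ (1 ℕ.+ z ℕ.* 2) ≡ 1 ℕ.+ (t ℕ.+ z) ℕ.* 2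
        nat = ℕ-Solver.solve-∀

      even-shift : ∀ t N → ∃ λ s → (1 ℕ.+ t ℕ.* 2) ℕ.+ 3 ^ N ≡ s ℕ.* 2
      even-shift t N with 3^-odd N
      ... | z , eq = 1 ℕ.+ t ℕ.+ z , trans (cong ((1 ℕ.+ t ℕ.* 2) ℕ.+_) eq) (nat t z)
        where
        nat : ∀ t z → (1 ℕ.+ t ℕ.* 2) ℕ.+ (1 ℕ.+ z ℕ.* 2) ≡ (1 ℕ.+ t ℕ.+ z) ℕ.* 2
        nat = ℕ-Solver.solve-∀

    -- Close squares of X give close values within one parity. For opposite parities t′ is first
    -- moved by the odd number 3^N, which changes X² by a multiple of 3^N and negates the value.
    compare : ∀ i m t t′ → 3^ i ∣ X t * X t - X t′ * X t′ → m ≤ (δ ℕ.+ δ) ℕ.+ i → G t ≡± G t′ [mod 3 ^ m ]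
    compare i m t t′ div m≤ with mod2 t | mod2 t′
    ... | 2* s   | 2* s′   = inj₁ (same-class i m 0 s s′ div m≤)
    ... | 2*+1 s | 2*+1 s′ = inj₁ (same-class i m 1 s s′ div m≤)
    ... | 2* s   | 2*+1 s′ =
      -- N ≥ i preserves the congruence of squares modulo 3^i, and N ≥ m makes the negation valid
      -- modulo 3^m.
      let N = i ℕ.+ m
          s″ , eq = even-shift s′ N
          div′ = shift² i (s ℕ.* 2) (1 ℕ.+ s′ ℕ.* 2) N (ℕₚ.m≤m+n i m) div
      in inj₂ (≡m-trans (G (s ℕ.* 2)) (G ((1 ℕ.+ s′ ℕ.* 2) ℕ.+ 3 ^ N)) (- G (1 ℕ.+ s′ ℕ.* 2))
           (subst (λ n → G (s ℕ.* 2) ≡ G n [mod 3 ^ m ]) (sym eq)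
               (same-class i m 0 s s″ (subst (λ n → 3^ i ∣ X (s ℕ.* 2) * X (s ℕ.* 2) - X n * X n) eq div′)
               m≤))
           (≡m-weaken (G ((1 ℕ.+ s′ ℕ.* 2) ℕ.+ 3 ^ N)) (- G (1 ℕ.+ s′ ℕ.* 2))
               (ℕₚ.≤-trans (ℕₚ.m≤n+m m i) (ℕₚ.m≤n+m N δ)) (flip (1 ℕ.+ s′ ℕ.* 2) N)))
    ... | 2*+1 s | 2* s′ =
      let N = i ℕ.+ m
          s″ , eq = odd-shift s′ N
          div′ = shift² i (1 ℕ.+ s ℕ.* 2) (s′ ℕ.* 2) N (ℕₚ.m≤m+n i m) div
      in inj₂ (≡m-trans (G (1 ℕ.+ s ℕ.* 2)) (G (s′ ℕ.* 2 ℕ.+ 3 ^ N)) (- G (s′ ℕ.* 2))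
           (subst (λ n → G (1 ℕ.+ s ℕ.* 2) ≡ G n [mod 3 ^ m ]) (sym eq)
               (same-class i m 1 s s″ (subst (λ n → 3^ i ∣ X (1 ℕ.+ s ℕ.* 2) * X (1 ℕ.+ s ℕ.* 2) - X n * X n)
               eq div′) m≤))
           (≡m-weaken (G (s′ ℕ.* 2 ℕ.+ 3 ^ N)) (- G (s′ ℕ.* 2)) (ℕₚ.≤-trans (ℕₚ.m≤n+m m i) (ℕₚ.m≤n+m N δ))
               (flip (s′ ℕ.* 2) N)))

    module _ (M : ℕ) (b : ℤ) where

      private
        k : ℕ
        k = δ ℕ.+ M

        hit? : ∀ t → Dec (G t ≡ b [mod 3 ^ k ])
        hit? t = G t ≡? b [mod 3 ^ k ]

      sing : ℕ
      sing = cnt hit? (3 ^ M ℕ.* 2)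

      private
        1≤k : 1 ≤ k
        1≤k = ℕₚ.≤-trans 1≤δ (ℕₚ.m≤m+n δ M)

        -- Values of opposite parity differ already modulo 3, so all hits of b lie in one parity
        -- class.
        exclusive : ∀ s s′ → G (s ℕ.* 2) ≡ b [mod 3 ^ 1 ] → ¬ (G (1 ℕ.+ s′ ℕ.* 2) ≡ b [mod 3 ^ 1 ])
        exclusive s s′ d d′ = even-odd s s′ (subst (+ 3 ∣_) (ring (G (s ℕ.* 2)) (G (1 ℕ.+ s′ ℕ.* 2)) b)
            (∣m∣n⇒∣m-n d d′))
          where
          ring : ∀ x y b → (x - b) - (y - b) ≡ x - y
          ring = solve-∀

        hit₃ : ∀ t → G t ≡ b [mod 3 ^ k ] → G t ≡ b [mod 3 ^ 1 ]
        hit₃ t = ≡m-weaken (G t) b 1≤k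

      sing-even : ∀ s → G (s ℕ.* 2) ≡ b [mod 3 ^ k ] → sing ≡ cnt (λ s → hit? (s ℕ.* 2)) (3 ^ M)
      sing-even s d = trans (cnt-split₂ hit? (3 ^ M)) (trans
        (cong (cnt (λ s → hit? (s ℕ.* 2)) (3 ^ M) ℕ.+_)
            (cnt-none _ (3 ^ M) (λ s′ _ d′ → exclusive s s′ (hit₃ (s ℕ.* 2) d) (hit₃ (1 ℕ.+ s′ ℕ.* 2) d′))))
        (ℕₚ.+-identityʳ _))

      sing-odd : ∀ s → G (1 ℕ.+ s ℕ.* 2) ≡ b [mod 3 ^ k ] → sing ≡ cnt (λ s → hit? (1 ℕ.+ s ℕ.* 2)) (3 ^ M)
      sing-odd s d = trans (cnt-split₂ hit? (3 ^ M))
        (cong (ℕ._+ cnt (λ s → hit? (1 ℕ.+ s ℕ.* 2)) (3 ^ M))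
            (cnt-none _ (3 ^ M) (λ s′ _ d′ → exclusive s′ s (hit₃ (s′ ℕ.* 2) d′) (hit₃ (1 ℕ.+ s ℕ.* 2) d))))

      sing-none : (∀ t → ¬ (G t ≡ b [mod 3 ^ k ])) → sing ≡ 0
      sing-none ¬hit = cnt-none hit? (3 ^ M ℕ.* 2) (λ t _ → ¬hit t)

      module _ (E R : ℕ) (R+E≡M : R ℕ.+ E ≡ M) (k≤ : k ≤ (δ ℕ.+ δ) ℕ.+ (E ℕ.+ E))
          (≤k : E ≡ 0 ⊎ (δ ℕ.+ δ) ℕ.+ (E ℕ.+ E) ≤ suc k) where

        private
          top-hit : ∀ t → 3^ E ∣ X t → G t ≡ b [mod 3 ^ k ] → sing ≡ 3 ^ R
          top-hit t div d with mod2 t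
          ... | 2* s   = trans (sing-even s d)
              (quad-top a₂ (c₂ 0) ua₂ {δ} {λ s → G (s ℕ.* 2)} (class 0) {b} k M s d E R R+E≡M
              (subst (3^ E ∣_) (sym (X-class 0 s)) div) k≤ ≤k)
          ... | 2*+1 s = trans (sing-odd s d) (quad-top a₂ (c₂ 1) ua₂ {δ} {λ s → G (1 ℕ.+ s ℕ.* 2)} (class 1)
              {b} k M s d E R R+E≡M (subst (3^ E ∣_) (sym (X-class 1 s)) div) k≤ ≤k)

        sing-top : ∀ t → 3^ E ∣ X t → b ≡± G t [mod 3 ^ k ] → sing ≡ 3 ^ R
        sing-top t div (inj₁ d) = top-hit t div (≡m-sym b (G t) d)
        sing-top t div (inj₂ d) = top-hit (t ℕ.+ 3 ^ N)
            (subst (3^ E ∣_) (sym (X-shift t N)) (∣m∣n⇒∣m+n div (∣n⇒∣m*n a (3^∣-mono (ℕₚ.m≤n+m E M)))))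
          (≡m-trans (G (t ℕ.+ 3 ^ N)) (- G t) b
              (≡m-weaken (G (t ℕ.+ 3 ^ N)) (- G t) (ℕₚ.+-monoʳ-≤ δ (ℕₚ.m≤m+n M E)) (flip t N))
              (≡m-sym b (- G t) d))
          where
          N : ℕ
          -- N ≥ M makes the negation valid modulo 3^k, and N ≥ E keeps 3^E ∣ X.
          N = M ℕ.+ E

        -- A hit t would make b one of the excluded values: if 3^E ∣ X t, then b ≡ ±G top; if X t
        -- has valuation j < E, its square is close to that of X (mid j) = 3^j, and b ≡ ±G (mid j)
        -- modulo 3^(2δ+2j+1).
        sing-otherwise : ∀ top → 3^ E ∣ X top → (mid : ℕ → ℕ) → (∀ j → X (mid j) ≡ 3^ j) →
          ¬ (b ≡± G top [mod 3 ^ k ]) →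
          (∀ j → (δ ℕ.+ δ) ℕ.+ suc (j ℕ.+ j) ≤ k → ¬
              (b ≡± G (mid j) [mod 3 ^ ((δ ℕ.+ δ) ℕ.+ suc (j ℕ.+ j)) ])) →
          sing ≡ 0
        sing-otherwise top 3^E∣ mid X-mid ¬top ¬mid = sing-none ¬hit
          where
          transport : ∀ m t t′ → G t ≡ b [mod 3 ^ m ] → G t ≡± G t′ [mod 3 ^ m ] → b ≡± G t′ [mod 3 ^ m ]
          transport m t t′ d (inj₁ e) = inj₁ (≡m-trans b (G t) (G t′) (≡m-sym (G t) b d) e)
          transport m t t′ d (inj₂ e) = inj₂ (≡m-trans b (G t) (- G t′) (≡m-sym (G t) b d) e)

          bound : ∀ j → j < E → (δ ℕ.+ δ) ℕ.+ suc (j ℕ.+ j) ≤ k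
          bound j j<E = [ (λ E≡0 → ⊥-elim (ℕₚ.n≮0 (subst (j <_) E≡0 j<E))) ,
              (λ le → ℕₚ.≤-pred (ℕₚ.≤-trans (ℕₚ.≤-reflexive (nat (δ ℕ.+ δ) j))
            (ℕₚ.≤-trans (ℕₚ.+-monoʳ-≤ (δ ℕ.+ δ) (ℕₚ.+-mono-≤ j<E j<E)) le))) ]′ ≤k
            where
            nat : ∀ d j → suc (d ℕ.+ suc (j ℕ.+ j)) ≡ d ℕ.+ (suc j ℕ.+ suc j)
            nat = ℕ-Solver.solve-∀

          ¬hit : ∀ t → ¬ (G t ≡ b [mod 3 ^ k ])
          ¬hit t d with valuation-below E (X t)
          ... | inj₁ div = ¬top (transport k t top d
              (compare (E ℕ.+ E) k t top (∣m∣n⇒∣m-n (3^∣² E div) (3^∣² E 3^E∣)) k≤))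
          ... | inj₂ (j , j<E , y , Xt≡ , uy) = ¬mid j (bound j j<E)
            (transport ((δ ℕ.+ δ) ℕ.+ suc (j ℕ.+ j)) t (mid j) (≡m-weaken (G t) b (bound j j<E) d)
                (compare (suc (j ℕ.+ j)) _ t (mid j) div ℕₚ.≤-refl))
            where
            ring : ∀ t y → t * t * (y * y - 1ℤ) ≡ t * y * (t * y) - t * t
            ring = solve-∀
            div : 3^ suc (j ℕ.+ j) ∣ X t * X t - X (mid j) * X (mid j)
            div = subst₂ _∣_ (cong 3^_ (ℕₚ.+-comm (j ℕ.+ j) 1)) (trans (cong (_* (y * y - 1ℤ)) (3^-+ j j))
              (trans (ring (3^ j) y) (cong₂ (λ x x′ → x * x - x′ * x′) (sym Xt≡) (sym (X-mid j)))))
                  (3^∣3^* (j ℕ.+ j) 1 (unit-square y uy))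

      module _ (j i : ℕ) (k≡ : k ≡ ((δ ℕ.+ δ) ℕ.+ suc (j ℕ.+ j)) ℕ.+ i) where

        private
          m : ℕ
          m = (δ ℕ.+ δ) ℕ.+ suc (j ℕ.+ j)

          k≡′ : k ≡ (δ ℕ.+ δ) ℕ.+ ((j ℕ.+ j) ℕ.+ suc i)
          k≡′ = trans k≡ (nat δ j i)
            where
            nat : ∀ δ j i → ((δ ℕ.+ δ) ℕ.+ suc (j ℕ.+ j)) ℕ.+ i ≡ (δ ℕ.+ δ) ℕ.+ ((j ℕ.+ j) ℕ.+ suc i)
            nat = ℕ-Solver.solve-∀

          M≡ : M ≡ (δ ℕ.+ j) ℕ.+ (j ℕ.+ suc i)
          M≡ = ℕₚ.+-cancelˡ-≡ δ M _ (trans k≡ (nat δ j i))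
            where
            nat : ∀ δ j i → ((δ ℕ.+ δ) ℕ.+ suc (j ℕ.+ j)) ℕ.+ i ≡ δ ℕ.+ ((δ ℕ.+ j) ℕ.+ (j ℕ.+ suc i))
            nat = ℕ-Solver.solve-∀

          mid-hit : ∀ t y → X t ≡ 3^ j * y → Unit y → G t ≡ b [mod 3 ^ m ] → sing ≡ 2 ℕ.* 3 ^ (δ ℕ.+ j)
          mid-hit t y Xt≡ uy d with mod2 t
          ... | 2* s =
            let s₁ , d₁ , y₁ , X₁≡ , uy₁ = quad-lift a₂ (c₂ 0) ua₂ {δ} {λ s → G (s ℕ.* 2)} (class 0) j s y
                  (trans (X-class 0 s) Xt≡) uy {b} d i
                d₁′ = subst (λ n → G (s₁ ℕ.* 2) ≡ b [mod 3 ^ n ]) (sym k≡) d₁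
            in trans (sing-even s₁ d₁′) (quad-mid a₂ (c₂ 0) ua₂ {δ} {λ s → G (s ℕ.* 2)} (class 0) {b} k M s₁
                d₁′ j i y₁ X₁≡ uy₁ k≡′ M≡)
          ... | 2*+1 s =
            let s₁ , d₁ , y₁ , X₁≡ , uy₁ = quad-lift a₂ (c₂ 1) ua₂ {δ} {λ s → G (1 ℕ.+ s ℕ.* 2)} (class 1) j s
                  y (trans (X-class 1 s) Xt≡) uy {b} d i
                d₁′ = subst (λ n → G (1 ℕ.+ s₁ ℕ.* 2) ≡ b [mod 3 ^ n ]) (sym k≡) d₁
            in trans (sing-odd s₁ d₁′) (quad-mid a₂ (c₂ 1) ua₂ {δ} {λ s → G (1 ℕ.+ s ℕ.* 2)} (class 1) {b} k M
                s₁ d₁′ j i y₁ X₁≡ uy₁ k≡′ M≡)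

        sing-mid : ∀ t y → X t ≡ 3^ j * y → Unit y → b ≡± G t [mod 3 ^ m ] → sing ≡ 2 ℕ.* 3 ^ (δ ℕ.+ j)
        sing-mid t y Xt≡ uy (inj₁ d) = mid-hit t y Xt≡ uy (≡m-sym b (G t) d)
        sing-mid t y Xt≡ uy (inj₂ d) = mid-hit (t ℕ.+ 3 ^ N) (y + + 3 * (a * 3^ m)) X′≡ uy′
          (≡m-trans (G (t ℕ.+ 3 ^ N)) (- G t) b
              (≡m-weaken (G (t ℕ.+ 3 ^ N)) (- G t) (ℕₚ.≤-trans (ℕₚ.m≤n+m m (suc j)) (ℕₚ.m≤n+m N δ))
              (flip t N)) (≡m-sym b (- G t) d))
          where
          N : ℕ
          -- The summand j + 1 keeps the valuation of X at j, and m makes the negation valid modulo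
          -- 3^m.
          N = suc j ℕ.+ m
          uy′ : Unit (y + + 3 * (a * 3^ m))
          uy′ d = uy (subst (+ 3 ∣_) (ring y (+ 3 * (a * 3^ m)))
              (∣m∣n⇒∣m-n d (∣m⇒∣m*n (a * 3^ m) (divides 1ℤ refl))))
            where
            ring : ∀ y z → y + z - z ≡ y
            ring = solve-∀
          X′≡ : X (t ℕ.+ 3 ^ N) ≡ 3^ j * (y + + 3 * (a * 3^ m))
          X′≡ = trans (X-shift t N) (trans (cong₂ (λ x n → x + a * n) Xt≡
              (trans (3^-+ (suc j) m) (cong (_* 3^ m) (3^suc j)))) (ring (3^ j) y a (3^ m)))
            where
            ring : ∀ t y a n → t * y + a * (+ 3 * t * n) ≡ t * (y + + 3 * (a * n))
            ring = solve-∀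

  -- The linear classes and the length of the shortest period.

  data Mod4 : ℕ → Set where
    4*_+0 : ∀ t → Mod4 (t ℕ.* 4)
    4*_+1 : ∀ t → Mod4 (1 ℕ.+ t ℕ.* 4)
    4*_+2 : ∀ t → Mod4 (2 ℕ.+ t ℕ.* 4)
    4*_+3 : ∀ t → Mod4 (3 ℕ.+ t ℕ.* 4)

  mod4 : ∀ n → Mod4 n
  mod4 0 = 4* 0 +0
  mod4 1 = 4* 0 +1
  mod4 2 = 4* 0 +2
  mod4 3 = 4* 0 +3
  mod4 (suc (suc (suc (suc n)))) with mod4 n
  ... | 4* t +0 = 4* suc t +0
  ... | 4* t +1 = 4* suc t +1
  ... | 4* t +2 = 4* suc t +2
  ... | 4* t +3 = 4* suc t +3

  module Family {P : ℤ} (lucas : LucasPair P) (δ : ℕ) (3∤P : Unit P) (1≤δ : 1 ≤ δ)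
      (exact : ExactPower 3 δ (P * P + + 2))
    (S : ℕ → ℤ) (rec : Recurrence P S) where

    open Lucas lucas
    open Valuation lucas δ 3∤P 1≤δ exact

    W : ℕ → ℤ
    W = partner S

    cassini-4t : ∀ t → Cassini (t ℕ.* 4)
    cassini-4t t = subst Cassini (ℕₚ.+-identityʳ (t ℕ.* 4)) (cassini-4 t 0 cassini-0)

    step-minus : ∀ r t d → S (r ℕ.+ (t ℕ.+ d ℕ.* 2) ℕ.* 4) - S (r ℕ.+ t ℕ.* 4) ≡ U (d ℕ.* 4) * W
        ((d ℕ.+ t) ℕ.* 4 ℕ.+ r)
    step-minus r t d = trans (cong (λ n → S n - S (r ℕ.+ t ℕ.* 4)) (nat₁ r t d))
      (trans (rec-minus rec (d ℕ.* 4) (cassini-4t d) (r ℕ.+ t ℕ.* 4))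
          (cong (λ n → U (d ℕ.* 4) * W n) (nat₂ r t d)))
      where
      nat₁ : ∀ r t d → r ℕ.+ (t ℕ.+ d ℕ.* 2) ℕ.* 4 ≡ d ℕ.* 4 ℕ.+ (d ℕ.* 4 ℕ.+ (r ℕ.+ t ℕ.* 4))
      nat₁ = ℕ-Solver.solve-∀
      nat₂ : ∀ r t d → d ℕ.* 4 ℕ.+ (r ℕ.+ t ℕ.* 4) ≡ (d ℕ.+ t) ℕ.* 4 ℕ.+ r
      nat₂ = ℕ-Solver.solve-∀

    -- Moving t by 3^N = 1 + 2z moves the index by 2m with m = 4z + 2, and the factor V m of the sum
    -- formula has valuation δ + N.
    step-plus : ∀ r t N → S (r ℕ.+ (t ℕ.+ 3 ^ N) ℕ.* 4) ≡ - S (r ℕ.+ t ℕ.* 4) [mod 3 ^ (δ ℕ.+ N) ]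
    step-plus r t N with 3^-odd N
    ... | z , eq = subst (3^ (δ ℕ.+ N) ∣_) (sym (trans (cong (λ n → S n - - S (r ℕ.+ t ℕ.* 4)) index)
            (trans (ring (S (m ℕ.+ (m ℕ.+ (r ℕ.+ t ℕ.* 4)))) (S (r ℕ.+ t ℕ.* 4)))
                (rec-plus rec m (cassini-4 z 2 (cassini-+2 0 cassini-0)) (r ℕ.+ t ℕ.* 4)))))
          (∣m⇒∣m*n (S (m ℕ.+ (r ℕ.+ t ℕ.* 4))) (~-∣ (δ ℕ.+ N) (~-sym (v2-val z))
            (subst (λ n → 3^ (δ ℕ.+ N) ∣ 3^ δ * + n) eq
                (3^∣3^* δ N (divides 1ℤ (sym (*-identityˡ (3^ N))))))))
      where
      m = z ℕ.* 4 ℕ.+ 2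
      ring : ∀ x y → x - - y ≡ x + y
      ring = solve-∀
      nat : ∀ r t z → r ℕ.+ (t ℕ.+ (1 ℕ.+ z ℕ.* 2)) ℕ.* 4 ≡ (z ℕ.* 4 ℕ.+ 2) ℕ.+
          ((z ℕ.* 4 ℕ.+ 2) ℕ.+ (r ℕ.+ t ℕ.* 4))
      nat = ℕ-Solver.solve-∀
      index : r ℕ.+ (t ℕ.+ 3 ^ N) ℕ.* 4 ≡ m ℕ.+ (m ℕ.+ (r ℕ.+ t ℕ.* 4))
      index = trans (cong (λ x → r ℕ.+ (t ℕ.+ x) ℕ.* 4) eq) (nat r t z)

    flip-4 : ∀ n → S (4 ℕ.+ n) ≡ - S n [mod 3 ^ δ ]
    flip-4 n = subst (3^ δ ∣_) (ring (S (4 ℕ.+ n)) (S n)) (3^δ∣+4 rec n)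
      where
      ring : ∀ x y → x + y ≡ x - - y
      ring = solve-∀

    neg-neg : ∀ x → - - x ≡ x
    neg-neg = solve-∀

    even-class : ∀ r s → S (r ℕ.+ (s ℕ.* 2) ℕ.* 4) ≡ S r [mod 3 ^ δ ]
    even-class r s = subst (λ n → S n ≡ S r [mod 3 ^ δ ]) (ℕₚ.+-comm (s ℕ.* 2 ℕ.* 4) r) (go s)
      where
      go : ∀ s → S (s ℕ.* 2 ℕ.* 4 ℕ.+ r) ≡ S r [mod 3 ^ δ ]
      go zero    = ≡m-refl (S r)
      go (suc s) = ≡m-trans (S (8 ℕ.+ n)) (S n) (S r)
        (subst (λ x → S (8 ℕ.+ n) ≡ x [mod 3 ^ δ ]) (neg-neg (S n))
            (≡m-trans (S (8 ℕ.+ n)) (- S (4 ℕ.+ n)) (- - S n) (flip-4 (4 ℕ.+ n))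
            (≡m-neg (S (4 ℕ.+ n)) (- S n) (flip-4 n))))
        (go s)
        where
        n = s ℕ.* 2 ℕ.* 4 ℕ.+ r

    odd-class : ∀ r s → S (r ℕ.+ (1 ℕ.+ s ℕ.* 2) ℕ.* 4) ≡ - S r [mod 3 ^ δ ]
    odd-class r s = subst (λ n → S n ≡ - S r [mod 3 ^ δ ]) (nat r s)
      (≡m-trans (S (4 ℕ.+ n)) (- S n) (- S r) (flip-4 n) (≡m-neg (S n) (S r) (even-class r s)))
      where
      n = r ℕ.+ (s ℕ.* 2) ℕ.* 4
      nat : ∀ r s → 4 ℕ.+ (r ℕ.+ (s ℕ.* 2) ℕ.* 4) ≡ r ℕ.+ (1 ℕ.+ s ℕ.* 2) ℕ.* 4
      nat = ℕ-Solver.solve-∀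

    class-± : ∀ r t → S (r ℕ.+ t ℕ.* 4) ≡± S r [mod 3 ^ δ ]
    class-± r t with mod2 t
    ... | 2* s   = inj₁ (even-class r s)
    ... | 2*+1 s = inj₂ (odd-class r s)

    module _ (r : ℕ) (uW : Unit (W r)) where

      -- In `step-minus` the factor `W` stays prime to 3 along the class, so the valuation comes
      -- from U(4d) alone.
      class-linear : ∀ o → Linear δ (λ s → S (r ℕ.+ (o ℕ.+ s ℕ.* 2) ℕ.* 4))
      class-linear o = wlog-≤ (3^ δ) (λ s → S (r ℕ.+ (o ℕ.+ s ℕ.* 2) ℕ.* 4)) +_ (λ s d →
        subst₂ (λ n x → S (r ℕ.+ n ℕ.* 4) - S (r ℕ.+ (o ℕ.+ s ℕ.* 2) ℕ.* 4) ~ 3^ δ * x) (nat o s d)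
            (ring (+ s) (+ d)) (val (o ℕ.+ s ℕ.* 2) d))
        where
        nat : ∀ o s d → o ℕ.+ s ℕ.* 2 ℕ.+ d ℕ.* 2 ≡ o ℕ.+ (s ℕ.+ d) ℕ.* 2
        nat = ℕ-Solver.solve-∀
        ring : ∀ s d → d ≡ s + d - s
        ring = solve-∀
        val : ∀ t d → S (r ℕ.+ (t ℕ.+ d ℕ.* 2) ℕ.* 4) - S (r ℕ.+ t ℕ.* 4) ~ 3^ δ * + d
        val t d = ~-trans (~-reflexive (trans (step-minus r t d) (*-comm (U (d ℕ.* 4)) _)))
          (~-trans (~-unitˡ (unit-+4t (rec-partner rec) r uW (d ℕ.+ t))) (u4-val d))

      module _ (M : ℕ) (b : ℤ) where

        private
          k : ℕ
          k = δ ℕ.+ M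

          hit? : ∀ t → Dec (S (r ℕ.+ t ℕ.* 4) ≡ b [mod 3 ^ k ])
          hit? t = S (r ℕ.+ t ℕ.* 4) ≡? b [mod 3 ^ k ]

          even odd : ℕ
          even = cnt (λ s → hit? (s ℕ.* 2)) (3 ^ M)
          odd  = cnt (λ s → hit? (1 ℕ.+ s ℕ.* 2)) (3 ^ M)

          even-hit : b ≡ S r [mod 3 ^ δ ] → even ≡ 1
          even-hit d = linear-hit {δ} {λ s → S (r ℕ.+ (s ℕ.* 2) ℕ.* 4)} (class-linear 0) M b
            (≡m-trans (S (r ℕ.+ 0)) (S r) b (even-class r 0) (≡m-sym b (S r) d))

          even-miss : ¬ (b ≡ S r [mod 3 ^ δ ]) → even ≡ 0
          even-miss ¬d = linear-miss {δ} {λ s → S (r ℕ.+ (s ℕ.* 2) ℕ.* 4)} (class-linear 0) M b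
            (λ d → ¬d (≡m-trans b (S (r ℕ.+ 0)) (S r) (≡m-sym (S (r ℕ.+ 0)) b d) (even-class r 0)))

          odd-hit : b ≡ - S r [mod 3 ^ δ ] → odd ≡ 1
          odd-hit d = linear-hit {δ} {λ s → S (r ℕ.+ (1 ℕ.+ s ℕ.* 2) ℕ.* 4)} (class-linear 1) M b
            (≡m-trans (S (r ℕ.+ 4)) (- S r) b (odd-class r 0) (≡m-sym b (- S r) d))

          odd-miss : ¬ (b ≡ - S r [mod 3 ^ δ ]) → odd ≡ 0
          odd-miss ¬d = linear-miss {δ} {λ s → S (r ℕ.+ (1 ℕ.+ s ℕ.* 2) ℕ.* 4)} (class-linear 1) M b
            (λ d → ¬d (≡m-trans b (S (r ℕ.+ 4)) (- S r) (≡m-sym (S (r ℕ.+ 4)) b d) (odd-class r 0)))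

        class-count : ℕ
        class-count = cnt hit? (3 ^ M ℕ.* 2)

        class-miss : ¬ (b ≡± S r [mod 3 ^ δ ]) → class-count ≡ 0
        class-miss ¬d = trans (cnt-split₂ hit? (3 ^ M))
            (cong₂ ℕ._+_ (even-miss (¬d ∘ inj₁)) (odd-miss (¬d ∘ inj₂)))

        -- The two parities take the residues S r and -S r modulo 3^δ, which are distinct, so
        -- exactly one of them hits b.
        class-unit : Unit (S r) → b ≡± S r [mod 3 ^ δ ] → class-count ≡ 1
        class-unit uS d = trans (cnt-split₂ hit? (3 ^ M)) (one d)
          where
          ring : ∀ b x → (b - - x) - (b - x) ≡ + 2 * x
          ring = solve-∀
          both : b ≡ S r [mod 3 ^ δ ] → ¬ (b ≡ - S r [mod 3 ^ δ ])
          both p q = unit-* 3∤2 uS (∣-trans 3∣3^δ (subst (3^ δ ∣_) (ring b (S r)) (∣m∣n⇒∣m-n q p)))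
          one : b ≡± S r [mod 3 ^ δ ] → even ℕ.+ odd ≡ 1
          one (inj₁ p) = cong₂ ℕ._+_ (even-hit p) (odd-miss (both p))
          one (inj₂ q) = cong₂ ℕ._+_ (even-miss (λ p → both p q)) (odd-hit q)

        -- Here S r ≡ -S r, so both parities hit b once.
        class-zero : 3^ δ ∣ S r → 3^ δ ∣ b → class-count ≡ 2
        class-zero dS db = trans (cnt-split₂ hit? (3 ^ M))
            (cong₂ ℕ._+_ (even-hit (∣m∣n⇒∣m-n db dS)) (odd-hit (∣m∣n⇒∣m-n db (∣m⇒∣-m dS))))

    module _ (z : ℕ) (zero-z : 3^ δ ∣ S z) (unit₁ : Unit (S (1 ℕ.+ z))) (unit₂ : Unit (S (2 ℕ.+ z)))
        (unit₃ : Unit (S (3 ℕ.+ z)))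
      (uS₁ : Unit (S 1)) (uW₁ : Unit (W 1)) (M h : ℕ) (shortest : IsShortestPeriod S (3 ^ (δ ℕ.+ M)) h) where

      private
        k : ℕ
        k = δ ℕ.+ M

        isPeriod : IsPeriod S (3 ^ k) (3 ^ M ℕ.* 2 ℕ.* 4)
        isPeriod = ℕₚ.*-mono-≤ {1} {3 ^ M ℕ.* 2} {1} {4}
            (ℕₚ.*-mono-≤ {1} {3 ^ M} {1} {2} (ℕₚ.m^n>0 3 M) (s≤s z≤n)) (s≤s z≤n) , λ n →
          subst (λ i → S i ≡ S n [mod 3 ^ k ]) (nat (3 ^ M) n)
              (subst (3^ k ∣_) (sym (rec-minus rec (3 ^ M ℕ.* 4) (cassini-4t (3 ^ M)) n))
            (∣m⇒∣m*n (W (3 ^ M ℕ.* 4 ℕ.+ n)) (~-∣ k (~-sym (u4-val (3 ^ M)))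
                (3^∣3^* δ M (divides 1ℤ (sym (*-identityˡ (3^ M))))))))
          where
          nat : ∀ x n → x ℕ.* 4 ℕ.+ (x ℕ.* 4 ℕ.+ n) ≡ n ℕ.+ x ℕ.* 2 ℕ.* 4
          nat = ℕ-Solver.solve-∀

        δ≤k : δ ≤ k
        δ≤k = ℕₚ.m≤m+n δ M

        not-unit : ∀ r t → Unit (S (r ℕ.+ z)) → ¬ (S (z ℕ.+ (r ℕ.+ t ℕ.* 4)) ≡ S z [mod 3 ^ k ])
        not-unit r t uS d = unit-+4t rec (r ℕ.+ z) uS t (∣-trans 3∣3^δ (subst (λ n → 3^ δ ∣ S n) (nat z r t)
          (subst (3^ δ ∣_) (ring (S (z ℕ.+ (r ℕ.+ t ℕ.* 4))) (S z))
              (∣m∣n⇒∣m+n (≡m-weaken (S (z ℕ.+ (r ℕ.+ t ℕ.* 4))) (S z) δ≤k d) zero-z))))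
          where
          nat : ∀ z r t → z ℕ.+ (r ℕ.+ t ℕ.* 4) ≡ t ℕ.* 4 ℕ.+ (r ℕ.+ z)
          nat = ℕ-Solver.solve-∀
          ring : ∀ x y → x - y + y ≡ x
          ring = solve-∀

        -- Three tests bound a period from below. At z only a multiple of 4 returns to a value
        -- divisible by 3; at 1 an odd multiple of 4 would negate a unit; and for h = 8x linearity
        -- on the class of 1 yields 3^M ∣ x.
        minimal : ∀ h → IsPeriod S (3 ^ k) h → 3 ^ M ℕ.* 2 ℕ.* 4 ≤ h
        minimal h (1≤h , per) with mod4 h
        ... | 4* t +1 = ⊥-elim (not-unit 1 t unit₁ (per z))
        ... | 4* t +2 = ⊥-elim (not-unit 2 t unit₂ (per z))
        ... | 4* t +3 = ⊥-elim (not-unit 3 t unit₃ (per z))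
        ... | 4* t +0 with mod2 t
        ...   | 2*+1 x = ⊥-elim (unit-* 3∤2 uS₁
            (∣-trans 3∣3^δ (subst (3^ δ ∣_) (ring (S (5 ℕ.+ x ℕ.* 2 ℕ.* 4)) (S 1))
                  (∣m∣n⇒∣m-n (odd-class 1 x) (≡m-weaken (S (5 ℕ.+ x ℕ.* 2 ℕ.* 4)) (S 1) δ≤k (per 1))))))
          where
          ring : ∀ x y → (x - - y) - (x - y) ≡ + 2 * y
          ring = solve-∀
        ...   | 2* x = ℕₚ.*-monoˡ-≤ 4 (ℕₚ.*-monoˡ-≤ 2
            (bound x 1≤h (3^∣3^*⁻ δ M (~-∣ k (class-linear 1 uW₁ 0 x 0) (per 1)))))
          where
          bound : ∀ x → 1 ≤ x ℕ.* 2 ℕ.* 4 → 3^ M ∣ + x - + 0 → 3 ^ M ≤ x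
          bound (suc x) _ d = ∣⇒≤ (∣⇒∣ᵤ (subst (3^ M ∣_) (+-identityʳ (+ suc x)) d))

      period : h ≡ 3 ^ M ℕ.* 2 ℕ.* 4
      period = ℕₚ.≤-antisym (proj₂ shortest _ isPeriod) (minimal h (proj₁ shortest))

  -- Arithmetic of the exponents in the theorem.

  2*l+1 : ∀ δ j → 2 ℕ.* (δ ℕ.+ j) ℕ.+ 1 ≡ (δ ℕ.+ δ) ℕ.+ suc (j ℕ.+ j)
  2*l+1 = ℕ-Solver.solve-∀

  l≤[k-1]/2⇒ : ∀ l k → 1 ≤ k → l ≤ (k ℕ.∸ 1) / 2 → 2 ℕ.* l ℕ.+ 1 ≤ k
  l≤[k-1]/2⇒ l (suc k) _ l≤ = begin
    2 ℕ.* l ℕ.+ 1         ≡⟨ ℕₚ.+-comm (2 ℕ.* l) 1 ⟩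
    suc (2 ℕ.* l)         ≡⟨ cong suc (ℕₚ.*-comm 2 l) ⟩
    suc (l ℕ.* 2)         ≤⟨ s≤s (ℕₚ.*-monoˡ-≤ 2 l≤) ⟩
    suc (k / 2 ℕ.* 2)     ≤⟨ s≤s (m/n*n≤m k 2) ⟩
    suc k                 ∎
    where open ℕₚ.≤-Reasoning

  ⇒l≤[k-1]/2 : ∀ l k → 2 ℕ.* l ℕ.+ 1 ≤ k → l ≤ (k ℕ.∸ 1) / 2
  ⇒l≤[k-1]/2 l k le = subst (_≤ (k ℕ.∸ 1) / 2) (m*n/n≡m l 2) (/-monoˡ-≤ 2 (begin
    l ℕ.* 2                     ≡⟨ ℕₚ.*-comm l 2 ⟩
    2 ℕ.* l                     ≡⟨ ℕₚ.m+n∸n≡m (2 ℕ.* l) 1 ⟨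
    2 ℕ.* l ℕ.+ 1 ℕ.∸ 1         ≤⟨ ℕₚ.∸-monoˡ-≤ 1 le ⟩
    k ℕ.∸ 1                     ∎))
    where open ℕₚ.≤-Reasoning

  -- E = ⌈(k − 2δ)/2⌉, so that 3^E ∣ X means X² ≡ 0 modulo 3^(k−2δ).
  record Critical (δ k : ℕ) : Set where
    field
      E   : ℕ
      k≡  : δ ℕ.+ (k / 2 ℕ.+ E) ≡ k
      k≤  : k ≤ (δ ℕ.+ δ) ℕ.+ (E ℕ.+ E)
      ≤k  : (δ ℕ.+ δ) ℕ.+ (E ℕ.+ E) ≤ suc k
      E≤  : E ≤ 2 ℕ.* ((k ℕ.+ 1 ℕ.∸ 2 ℕ.* δ) / 4) ℕ.+ 1

  -- With Q = k + 1 - 2δ, E is ⌊Q/2⌋, and the exponent 2⌊Q/4⌋ + 1 of the theorem is E rounded up to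
  -- an odd number, which gives `E≤`. The boundary case k = 2δ - 1 has E = 0.
  critical : ∀ δ k → 1 ≤ δ → 2 ℕ.* δ ℕ.∸ 1 ≤ k → Critical δ k
  critical δ k 1≤δ le = go (k % 2) (m%n<n k 2) (m≡m%n+[m/n]*n k 2)
    where
    R = k / 2
    2δ≤ : 2 ℕ.* δ ≤ 1 ℕ.+ k
    2δ≤ = ℕₚ.≤-trans (ℕₚ.m≤n+m∸n (2 ℕ.* δ) 1) (s≤s le)

    bound : ∀ E → (δ ℕ.+ δ) ℕ.+ (E ℕ.+ E) ≤ suc k → E ≤ 2 ℕ.* ((k ℕ.+ 1 ℕ.∸ 2 ℕ.* δ) / 4) ℕ.+ 1
    bound E ≤k = ℕₚ.≤-pred (ℕₚ.*-cancelʳ-< 2 E _ (begin-strict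
      E ℕ.* 2                        ≡⟨ nat₁ δ E ⟩
      E ℕ.+ E                        ≡⟨ ℕₚ.m+n∸m≡n (δ ℕ.+ δ) (E ℕ.+ E) ⟨
      (δ ℕ.+ δ) ℕ.+ (E ℕ.+ E) ℕ.∸ (δ ℕ.+ δ) ≤⟨ ℕₚ.∸-monoˡ-≤ (δ ℕ.+ δ) ≤k ⟩
      suc k ℕ.∸ (δ ℕ.+ δ)            ≡⟨ cong₂ ℕ._∸_ (ℕₚ.+-comm 1 k) (nat₂ δ) ⟩
      Q                              ≡⟨ m≡m%n+[m/n]*n Q 4 ⟩
      Q % 4 ℕ.+ Q / 4 ℕ.* 4          <⟨ ℕₚ.+-monoˡ-< (Q / 4 ℕ.* 4) (m%n<n Q 4) ⟩
      4 ℕ.+ Q / 4 ℕ.* 4              ≡⟨ nat₃ (Q / 4) ⟩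
      suc (2 ℕ.* (Q / 4) ℕ.+ 1) ℕ.* 2 ∎))
      where
      open ℕₚ.≤-Reasoning
      Q = k ℕ.+ 1 ℕ.∸ 2 ℕ.* δ
      nat₁ : ∀ δ E → E ℕ.* 2 ≡ E ℕ.+ E
      nat₁ = ℕ-Solver.solve-∀
      nat₂ : ∀ δ → δ ℕ.+ δ ≡ 2 ℕ.* δ
      nat₂ = ℕ-Solver.solve-∀
      nat₃ : ∀ q → 4 ℕ.+ q ℕ.* 4 ≡ suc (2 ℕ.* q ℕ.+ 1) ℕ.* 2
      nat₃ = ℕ-Solver.solve-∀

    build : ∀ E → δ ℕ.+ (R ℕ.+ E) ≡ k → k ≤ (δ ℕ.+ δ) ℕ.+ (E ℕ.+ E) → (δ ℕ.+ δ) ℕ.+ (E ℕ.+ E) ≤ suc k →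
        Critical δ k
    build E k≡ k≤ ≤k = record { E = E ; k≡ = k≡ ; k≤ = k≤ ; ≤k = ≤k ; E≤ = bound E ≤k }

    go : ∀ ρ → ρ < 2 → k ≡ ρ ℕ.+ R ℕ.* 2 → Critical δ k
    go 0 _ k≡ = build E (trans (nat₁ δ R E) (trans (cong (ℕ._+ R) δ+E) (trans (nat₂ R) (sym k≡))))
        (ℕₚ.≤-reflexive (sym eq)) (ℕₚ.≤-trans (ℕₚ.≤-reflexive eq) (ℕₚ.n≤1+n k))
      where
      -- For even k the bound 2δ ≤ k + 1 sharpens to 2δ ≤ k.
      δ≤R : δ ≤ R
      δ≤R = ℕₚ.≤-pred (ℕₚ.*-cancelʳ-< 2 δ (suc R) (s≤s (begin
        δ ℕ.* 2          ≡⟨ ℕₚ.*-comm δ 2 ⟩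
        2 ℕ.* δ          ≤⟨ 2δ≤ ⟩
        1 ℕ.+ k          ≡⟨ cong suc k≡ ⟩
        1 ℕ.+ R ℕ.* 2    ∎)))
        where open ℕₚ.≤-Reasoning
      E = R ℕ.∸ δ
      δ+E : δ ℕ.+ E ≡ R
      δ+E = ℕₚ.m+[n∸m]≡n δ≤R
      nat₁ : ∀ δ R E → δ ℕ.+ (R ℕ.+ E) ≡ (δ ℕ.+ E) ℕ.+ R
      nat₁ = ℕ-Solver.solve-∀
      nat₂ : ∀ R → R ℕ.+ R ≡ R ℕ.* 2
      nat₂ = ℕ-Solver.solve-∀
      nat₃ : ∀ δ E → (δ ℕ.+ δ) ℕ.+ (E ℕ.+ E) ≡ (δ ℕ.+ E) ℕ.* 2
      nat₃ = ℕ-Solver.solve-∀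
      eq : (δ ℕ.+ δ) ℕ.+ (E ℕ.+ E) ≡ k
      eq = trans (nat₃ δ E) (trans (cong (ℕ._* 2) δ+E) (sym k≡))
    go 1 _ k≡ = build E (trans (nat₁ δ R E) (trans (cong (ℕ._+ R) δ+E) (trans (nat₂ R) (sym k≡))))
        (ℕₚ.≤-trans (ℕₚ.n≤1+n k) (ℕₚ.≤-reflexive (sym eq))) (ℕₚ.≤-reflexive eq)
      where
      δ≤R : δ ≤ 1 ℕ.+ R
      δ≤R = ℕₚ.*-cancelʳ-≤ δ (1 ℕ.+ R) 2 (begin
        δ ℕ.* 2          ≡⟨ ℕₚ.*-comm δ 2 ⟩
        2 ℕ.* δ          ≤⟨ 2δ≤ ⟩
        1 ℕ.+ k          ≡⟨ cong suc k≡ ⟩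
        2 ℕ.+ R ℕ.* 2    ∎)
        where open ℕₚ.≤-Reasoning
      E = 1 ℕ.+ R ℕ.∸ δ
      δ+E : δ ℕ.+ E ≡ 1 ℕ.+ R
      δ+E = ℕₚ.m+[n∸m]≡n δ≤R
      nat₁ : ∀ δ R E → δ ℕ.+ (R ℕ.+ E) ≡ (δ ℕ.+ E) ℕ.+ R
      nat₁ = ℕ-Solver.solve-∀
      nat₂ : ∀ R → 1 ℕ.+ R ℕ.+ R ≡ 1 ℕ.+ R ℕ.* 2
      nat₂ = ℕ-Solver.solve-∀
      nat₃ : ∀ δ E → (δ ℕ.+ δ) ℕ.+ (E ℕ.+ E) ≡ (δ ℕ.+ E) ℕ.* 2
      nat₃ = ℕ-Solver.solve-∀
      eq : (δ ℕ.+ δ) ℕ.+ (E ℕ.+ E) ≡ suc k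
      eq = trans (nat₃ δ E) (trans (cong (ℕ._* 2) δ+E) (cong suc (sym k≡)))
    go (suc (suc _)) (s≤s (s≤s ())) _

  -- Adding up the four classes.

  ±-trans : ∀ m a b c → a ≡± b [mod m ] → b ≡± c [mod m ] → a ≡± c [mod m ]
  ±-trans m a b c (inj₁ d) (inj₁ e) = inj₁ (≡m-trans a b c d e)
  ±-trans m a b c (inj₁ d) (inj₂ e) = inj₂ (≡m-trans a b (- c) d e)
  ±-trans m a b c (inj₂ d) (inj₁ e) = inj₂ (≡m-trans a (- b) (- c) d (≡m-neg b c e))
  ±-trans m a b c (inj₂ d) (inj₂ e) = inj₁
      (subst (λ x → a ≡ x [mod m ]) (ring c) (≡m-trans a (- b) (- - c) d (≡m-neg b (- c) e)))
    where
    ring : ∀ x → - - x ≡ x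
    ring = solve-∀

  ±-sym : ∀ m a b → a ≡± b [mod m ] → b ≡± a [mod m ]
  ±-sym m a b (inj₁ d) = inj₁ (≡m-sym a b d)
  ±-sym m a b (inj₂ d) = inj₂ (subst (+ m ∣_) (ring a b) d)
    where
    ring : ∀ a b → a - - b ≡ b - - a
    ring = solve-∀

  ±-weaken : ∀ a b {i j} → i ≤ j → a ≡± b [mod 3 ^ j ] → a ≡± b [mod 3 ^ i ]
  ±-weaken a b i≤j (inj₁ d) = inj₁ (≡m-weaken a b i≤j d)
  ±-weaken a b i≤j (inj₂ d) = inj₂ (≡m-weaken a (- b) i≤j d)

  -- S is u or v; z and w are the classes modulo 4 with S ≡ 0 modulo 3^δ and with
  -- quadratic behaviour, (z , w) being (0 , 2) for u and (2 , 0) for v.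
  module Assembly {P : ℤ} (lucas : LucasPair P) (δ : ℕ) (3∤P : Unit P) (1≤δ : 1 ≤ δ)
      (exact : ExactPower 3 δ (P * P + + 2))
    (S : ℕ → ℤ) (rec : Recurrence P S) (z w : ℕ)
    (total : ∀ (C : ℕ → ℕ) → (C 0 ℕ.+ C 1) ℕ.+ (C 2 ℕ.+ C 3) ≡ C w ℕ.+ (C z ℕ.+ (C 1 ℕ.+ C 3)))
    (uWz : Unit (Lucas.partner lucas S z)) (uW₁ : Unit (Lucas.partner lucas S 1))
        (uW₃ : Unit (Lucas.partner lucas S 3))
    (zero-z : 3^ δ ∣ S z) (unit₁ : Unit (S (1 ℕ.+ z))) (unit₂ : Unit (S (2 ℕ.+ z)))
        (unit₃ : Unit (S (3 ℕ.+ z)))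
    (uS₁ : Unit (S 1)) (uS₃ : Unit (S 3)) (uSw : Unit (S w))
    (g : ℤ) (S₁≡ : S 1 ≡± g [mod 3 ^ δ ]) (S₃≡ : S 3 ≡± g [mod 3 ^ δ ])
        (separated : 2 ≤ δ → ¬ (S w ≡± g [mod 3 ^ δ ]))
    (a c : ℤ) (ua : Unit a)
    (quad : ∀ t d → S (w ℕ.+ (t ℕ.+ d ℕ.* 2) ℕ.* 4) - S (w ℕ.+ t ℕ.* 4) ~
      3^ (δ ℕ.+ δ) * (affine a c (t ℕ.+ d ℕ.* 2) * affine a c (t ℕ.+ d ℕ.* 2) - affine a c t * affine a c t))
    (mid : ℕ → ℕ) (X-mid : ∀ j → affine a c (mid j) ≡ 3^ j)
    (mid-value : ℕ → ℤ) (mid-value≡ : ∀ j → S (w ℕ.+ mid j ℕ.* 4) ≡ mid-value j) where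

    open Family lucas δ 3∤P 1≤δ exact S rec
    open Valuation lucas δ 3∤P 1≤δ exact using (3∣3^δ)

    G : ℕ → ℤ
    G t = S (w ℕ.+ t ℕ.* 4)

    private
      even-odd : ∀ s s′ → Unit (G (s ℕ.* 2) - G (1 ℕ.+ s′ ℕ.* 2))
      even-odd s s′ d = unit-* 3∤2 uSw (subst (+ 3 ∣_) (ring (G (s ℕ.* 2)) (G (1 ℕ.+ s′ ℕ.* 2)) (S w))
        (∣m∣n⇒∣m+n (∣m∣n⇒∣m-n d (∣-trans 3∣3^δ (even-class w s))) (∣-trans 3∣3^δ (odd-class w s′))))
        where
        ring : ∀ x y n → x - y - (x - n) + (y - - n) ≡ + 2 * n
        ring = solve-∀

    open Singular δ 1≤δ G a c ua quad (step-plus w) even-odd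

    -- The residues reached by the linear classes: 0 by class `z`, ±g by classes 1 and 3.
    Linear-residue : ℤ → Set
    Linear-residue b = b ≡ 0ℤ [mod 3 ^ δ ] ⊎ b ≡± g [mod 3 ^ δ ]

    private
      -0ℤ : ∀ b → b - 0ℤ ≡ b
      -0ℤ = solve-∀

      ug : Unit g
      ug d = uS₁ ([ (λ e → subst (+ 3 ∣_) (r₁ (S 1) g) (∣m∣n⇒∣m+n (∣-trans 3∣3^δ e) d))
                  , (λ e → subst (+ 3 ∣_) (r₂ (S 1) g) (∣m∣n⇒∣m-n (∣-trans 3∣3^δ e) d)) ]′ S₁≡)
        where
        r₁ : ∀ x g → x - g + g ≡ x
        r₁ = solve-∀
        r₂ : ∀ x g → x - - g - g ≡ x
        r₂ = solve-∀

      ±-unit : ∀ b x → Unit x → b ≡± x [mod 3 ^ δ ] → Unit b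
      ±-unit b x ux (inj₁ e) d = ux (subst (+ 3 ∣_) (ring b x) (∣m∣n⇒∣m-n d (∣-trans 3∣3^δ e)))
        where
        ring : ∀ b x → b - (b - x) ≡ x
        ring = solve-∀
      ±-unit b x ux (inj₂ e) d = ux (subst (+ 3 ∣_) (ring b x) (∣m∣n⇒∣m-n (∣-trans 3∣3^δ e) d))
        where
        ring : ∀ b x → b - - x - b ≡ x
        ring = solve-∀

      ±0 : ∀ b → b ≡± S z [mod 3 ^ δ ] → 3^ δ ∣ b
      ±0 b (inj₁ e) = subst (3^ δ ∣_) (ring b (S z)) (∣m∣n⇒∣m+n e zero-z)
        where
        ring : ∀ b x → b - x + x ≡ b
        ring = solve-∀
      ±0 b (inj₂ e) = subst (3^ δ ∣_) (ring b (S z)) (∣m∣n⇒∣m-n e zero-z)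
        where
        ring : ∀ b x → b - - x - x ≡ b
        ring = solve-∀

    module _ (M : ℕ) (b : ℤ) where

      linear-count : ℕ
      linear-count = class-count z uWz M b ℕ.+ (class-count 1 uW₁ M b ℕ.+ class-count 3 uW₃ M b)

      -- The 2 arises in two ways: b ≡ 0 is hit by both parities of class `z`, and b ≡ ±g once by
      -- class 1 and once by class 3.
      linear-count-hit : Linear-residue b → linear-count ≡ 2
      linear-count-hit (inj₁ b≡0) = cong₂ ℕ._+_ (class-zero z uWz M b zero-z 3^δ∣b) (cong₂ ℕ._+_
          (class-miss 1 uW₁ M b (λ e → ±-unit b (S 1) uS₁ e 3∣b))
              (class-miss 3 uW₃ M b (λ e → ±-unit b (S 3) uS₃ e 3∣b)))
        where
        3^δ∣b : 3^ δ ∣ b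
        3^δ∣b = subst (3^ δ ∣_) (-0ℤ b) b≡0
        3∣b : + 3 ∣ b
        3∣b = ∣-trans 3∣3^δ 3^δ∣b
      linear-count-hit (inj₂ b≡g) = cong₂ ℕ._+_
          (class-miss z uWz M b (λ e → ±-unit b g ug b≡g (∣-trans 3∣3^δ (±0 b e)))) (cong₂ ℕ._+_
          (class-unit 1 uW₁ M b uS₁ (±-trans (3 ^ δ) b g (S 1) b≡g (±-sym (3 ^ δ) (S 1) g S₁≡)))
          (class-unit 3 uW₃ M b uS₃ (±-trans (3 ^ δ) b g (S 3) b≡g (±-sym (3 ^ δ) (S 3) g S₃≡))))

      linear-count-miss : ¬ Linear-residue b → linear-count ≡ 0
      linear-count-miss ¬res = cong₂ ℕ._+_
          (class-miss z uWz M b (λ e → ¬res (inj₁ (subst (3^ δ ∣_) (sym (-0ℤ b)) (±0 b e))))) (cong₂ ℕ._+_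
          (class-miss 1 uW₁ M b (λ e → ¬res (inj₂ (±-trans (3 ^ δ) b (S 1) g e S₁≡))))
          (class-miss 3 uW₃ M b (λ e → ¬res (inj₂ (±-trans (3 ^ δ) b (S 3) g e S₃≡)))))

      count-split : ∀ h → IsShortestPeriod S (3 ^ (δ ℕ.+ M)) h →
          count S h (3 ^ (δ ℕ.+ M)) b ≡ sing M b ℕ.+ linear-count
      count-split h shortest = begin
        count S h m b
            ≡⟨ length-filter-applyUpTo (λ n → S n ≡? b [mod m ]) id h ⟩
        cnt (λ n → S n ≡? b [mod m ]) h
            ≡⟨ cong (cnt (λ n → S n ≡? b [mod m ])) (period z zero-z unit₁ unit₂ unit₃ uS₁ uW₁ M h shortest) ⟩
        cnt (λ n → S n ≡? b [mod m ]) (3 ^ M ℕ.* 2 ℕ.* 4)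
            ≡⟨ cnt-split₄ (λ n → S n ≡? b [mod m ]) (3 ^ M ℕ.* 2) ⟩
        (C 0 ℕ.+ C 1) ℕ.+ (C 2 ℕ.+ C 3)               ≡⟨ total C ⟩
        C w ℕ.+ (C z ℕ.+ (C 1 ℕ.+ C 3))               ∎
        where
        open ≡-Reasoning
        m = 3 ^ (δ ℕ.+ M)
        C : ℕ → ℕ
        C r = cnt (λ t → S (r ℕ.+ t ℕ.* 4) ≡? b [mod m ]) (3 ^ M ℕ.* 2)

    -- As g is a unit, 0, g and -g exhaust the residues modulo 3.
    linear-residue-δ≡1 : δ ≡ 1 → ∀ b → Linear-residue b
    linear-residue-δ≡1 refl b with unit-cases b
    ... | inj₁ d = inj₁ (subst (+ 3 ∣_) (sym (-0ℤ b)) d)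
    ... | inj₂ ub = inj₂ ([ inj₁ , (λ d → inj₂ (subst (+ 3 ∣_) (ring b g) d)) ]′ (unit-± b g ub ug))
      where
      ring : ∀ b g → b + g ≡ b - - g
      ring = solve-∀

    -- G t ≡ ±S w modulo 3^δ, which is prime to 3 and, by `separated`, not ±g. For δ ≥ 2 no b is
    -- therefore hit by both kinds of class.
    singular-residue : 2 ≤ δ → ∀ b t → b ≡± G t [mod 3 ^ δ ] → ¬ Linear-residue b
    singular-residue 2≤δ b t e (inj₁ b≡0) = ±-unit b (S w) uSw (±-trans (3 ^ δ) b (G t) (S w) e (class-± w t))
        (∣-trans 3∣3^δ (subst (3^ δ ∣_) (-0ℤ b) b≡0))
    singular-residue 2≤δ b t e (inj₂ b≡g) = separated 2≤δ
        (±-trans (3 ^ δ) (S w) b g (±-sym (3 ^ δ) b (S w) (±-trans (3 ^ δ) b (G t) (S w) e (class-± w t)))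
        b≡g)

    linear-residue-sing : 2 ≤ δ → ∀ M b → Linear-residue b → sing M b ≡ 0
    linear-residue-sing 2≤δ M b res = sing-none M b
        (λ t d → singular-residue 2≤δ b t (inj₁ (≡m-weaken b (G t) (ℕₚ.m≤m+n δ M) (≡m-sym (G t) b d))) res)

    private
      X : ℕ → ℤ
      X = affine a c

      Count : ℕ → ℕ → ℤ → ℕ
      Count h k b = count S h (3 ^ k) b

    -- `extra` is what the linear classes add for a b near the quadratic class: 2 if δ = 1, and 0 if
    -- δ ≥ 2.
    module _ (extra : ℕ) (linear-at-singular : ∀ M b t → b ≡± G t [mod 3 ^ δ ] → linear-count M b ≡ extra)
        (h : ℕ) (b : ℤ) where

      count-top : ∀ k R E → δ ℕ.+ (R ℕ.+ E) ≡ k → k ≤ (δ ℕ.+ δ) ℕ.+ (E ℕ.+ E) →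
          E ≡ 0 ⊎ (δ ℕ.+ δ) ℕ.+ (E ℕ.+ E) ≤ suc k →
        IsShortestPeriod S (3 ^ k) h → ∀ t → 3^ E ∣ X t → b ≡± G t [mod 3 ^ k ] → Count h k b ≡ 3 ^ R ℕ.+
            extra
      count-top k R E refl k≤ ≤k sh t div e = trans (count-split (R ℕ.+ E) b h sh) (cong₂ ℕ._+_
        (sing-top (R ℕ.+ E) b E R refl k≤ ≤k t div e)
        (linear-at-singular (R ℕ.+ E) b t (±-weaken b (G t) (ℕₚ.m≤m+n δ (R ℕ.+ E)) e)))

      count-mid : ∀ k M → δ ℕ.+ M ≡ k → IsShortestPeriod S (3 ^ k) h → ∀ l → δ ≤ l → 2 ℕ.* l ℕ.+ 1 ≤ k →
        b ≡± mid-value (l ℕ.∸ δ) [mod 3 ^ (2 ℕ.* l ℕ.+ 1) ] → Count h k b ≡ 2 ℕ.* 3 ^ l ℕ.+ extra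
      count-mid k M refl sh l δ≤l le e = trans (count-split M b h sh) (cong₂ ℕ._+_
        (trans (sing-mid M b j (k ℕ.∸ m) (sym (ℕₚ.m+[n∸m]≡n (subst (_≤ k) m≡ le))) (mid j) 1ℤ
            (trans (X-mid j) (sym (*-identityʳ (3^ j)))) 3∤1 e′) (cong (λ x → 2 ℕ.* 3 ^ x) δ+j))
        (linear-at-singular M b (mid j) (±-weaken b (G (mid j))
            (ℕₚ.≤-trans (ℕₚ.m≤m+n δ δ) (ℕₚ.m≤m+n (δ ℕ.+ δ) (suc (j ℕ.+ j)))) e′)))
        where
        j = l ℕ.∸ δ
        m = (δ ℕ.+ δ) ℕ.+ suc (j ℕ.+ j)
        δ+j : δ ℕ.+ j ≡ l
        δ+j = ℕₚ.m+[n∸m]≡n δ≤l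
        m≡ : 2 ℕ.* l ℕ.+ 1 ≡ m
        m≡ = trans (cong (λ x → 2 ℕ.* x ℕ.+ 1) (sym δ+j)) (2*l+1 δ j)
        e′ : b ≡± G (mid j) [mod 3 ^ m ]
        e′ = subst₂ (λ x n → b ≡± x [mod 3 ^ n ]) (sym (mid-value≡ j)) m≡ e

    module _ (h : ℕ) (b : ℤ) where

      count-otherwise : ∀ k R E → δ ℕ.+ (R ℕ.+ E) ≡ k → k ≤ (δ ℕ.+ δ) ℕ.+ (E ℕ.+ E) →
          E ≡ 0 ⊎ (δ ℕ.+ δ) ℕ.+ (E ℕ.+ E) ≤ suc k →
        IsShortestPeriod S (3 ^ k) h → ∀ t → 3^ E ∣ X t → ¬ (b ≡± G t [mod 3 ^ k ]) →
        (∀ l → δ ≤ l → 2 ℕ.* l ℕ.+ 1 ≤ k → ¬ (b ≡± mid-value (l ℕ.∸ δ) [mod 3 ^ (2 ℕ.* l ℕ.+ 1) ])) →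
        Count h k b ≡ linear-count (R ℕ.+ E) b
      count-otherwise k R E refl k≤ ≤k sh t div ¬top ¬mid = trans (count-split (R ℕ.+ E) b h sh)
        (cong (ℕ._+ linear-count (R ℕ.+ E) b) (sing-otherwise (R ℕ.+ E) b E R refl k≤ ≤k t div mid X-mid ¬top
          (λ j le e → ¬mid (δ ℕ.+ j) (ℕₚ.m≤m+n δ j) (subst (_≤ k) (sym (2*l+1 δ j)) le)
            (subst₂ (λ x n → b ≡± x [mod 3 ^ n ])
                (trans (mid-value≡ j) (cong mid-value (sym (ℕₚ.m+n∸m≡n δ j)))) (sym (2*l+1 δ j)) e))))

      count-linear : 2 ≤ δ → ∀ k M → δ ℕ.+ M ≡ k → IsShortestPeriod S (3 ^ k) h → Linear-residue b →
          Count h k b ≡ 2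
      count-linear 2≤δ k M refl sh res = trans (count-split M b h sh)
          (cong₂ ℕ._+_ (linear-residue-sing 2≤δ M b res) (linear-count-hit M b res))

    part₁ : δ ≡ 1 → ∀ k → 1 ≤ k → ∀ h → IsShortestPeriod S (3 ^ k) h →
      ∀ top t → 3^ (2 ℕ.* ((k ℕ.∸ 1) / 4) ℕ.+ 1) ∣ X t → G t ≡ top → ∀ b →
        (b ≡± top [mod 3 ^ k ] → Count h k b ≡ 3 ^ (k / 2) ℕ.+ 2)
      × ((l : ℕ) → 1 ≤ l → l ≤ (k ℕ.∸ 1) / 2 → b ≡± mid-value (l ℕ.∸ 1) [mod 3 ^ (2 ℕ.* l ℕ.+ 1) ] → Count h k
          b ≡ 2 ℕ.* 3 ^ l ℕ.+ 2)
      × (¬ (b ≡± top [mod 3 ^ k ]) →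
         ¬ (∃ λ l → 1 ≤ l × l ≤ (k ℕ.∸ 1) / 2 × b ≡± mid-value (l ℕ.∸ 1) [mod 3 ^ (2 ℕ.* l ℕ.+ 1) ]) → Count h
             k b ≡ 2)
    part₁ refl k@(suc k′) 1≤k h sh _ t div refl b =
        count-top 2 lin h b k (k / 2) E k≡ k≤ (inj₂ ≤k) sh t 3^E∣
      , (λ l 1≤l l≤ → count-mid 2 lin h b k (k / 2 ℕ.+ E) k≡ sh l 1≤l (l≤[k-1]/2⇒ l k 1≤k l≤))
      , λ ¬top ¬mid → trans
          (count-otherwise h b k (k / 2) E k≡ k≤ (inj₂ ≤k) sh t 3^E∣ ¬top
              (λ l 1≤l le e → ¬mid (l , 1≤l , ⇒l≤[k-1]/2 l k le , e)))
          (linear-count-hit (k / 2 ℕ.+ E) b (linear-residue-δ≡1 refl b))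
      where
      open Critical (critical 1 k 1≤δ 1≤k)
      lin : ∀ M b t → b ≡± G t [mod 3 ^ 1 ] → linear-count M b ≡ 2
      lin M b t _ = linear-count-hit M b (linear-residue-δ≡1 refl b)
      3^E∣ : 3^ E ∣ X t
      3^E∣ = ∣-trans (3^∣-mono (subst (λ n → E ≤ 2 ℕ.* (n / 4) ℕ.+ 1) (ℕₚ.m+n∸n≡m k′ 1) E≤)) div

    private
      lin₂ : 2 ≤ δ → ∀ M b t → b ≡± G t [mod 3 ^ δ ] → linear-count M b ≡ 0
      lin₂ 2≤δ M b t e = linear-count-miss M b (singular-residue 2≤δ b t e)

    part₂ : 2 ≤ δ → ∀ k → 1 ≤ k → 2 ℕ.* δ ℕ.∸ 1 ≤ k → ∀ h → IsShortestPeriod S (3 ^ k) h →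
      ∀ top t → 3^ (2 ℕ.* ((k ℕ.+ 1 ℕ.∸ 2 ℕ.* δ) / 4) ℕ.+ 1) ∣ X t → G t ≡ top → ∀ b →
        (b ≡± top [mod 3 ^ k ] → Count h k b ≡ 3 ^ (k / 2))
      × ((l : ℕ) → δ ≤ l → l ≤ (k ℕ.∸ 1) / 2 → b ≡± mid-value (l ℕ.∸ δ) [mod 3 ^ (2 ℕ.* l ℕ.+ 1) ] → Count h k
          b ≡ 2 ℕ.* 3 ^ l)
      × (Linear-residue b → Count h k b ≡ 2)
      × (¬ (b ≡± top [mod 3 ^ k ]) →
         ¬ (∃ λ l → δ ≤ l × l ≤ (k ℕ.∸ 1) / 2 × b ≡± mid-value (l ℕ.∸ δ) [mod 3 ^ (2 ℕ.* l ℕ.+ 1) ]) →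
         ¬ Linear-residue b → Count h k b ≡ 0)
    part₂ 2≤δ k 1≤k le h sh _ t div refl b =
        (λ e → trans (count-top 0 (lin₂ 2≤δ) h b k (k / 2) E k≡ k≤ (inj₂ ≤k) sh t 3^E∣ e) (ℕₚ.+-identityʳ _))
      , (λ l δ≤l l≤ e → trans (count-mid 0 (lin₂ 2≤δ) h b k (k / 2 ℕ.+ E) k≡ sh l δ≤l (l≤[k-1]/2⇒ l k 1≤k l≤)
          e) (ℕₚ.+-identityʳ _))
      , count-linear h b 2≤δ k (k / 2 ℕ.+ E) k≡ sh
      , λ ¬top ¬mid ¬res → trans
          (count-otherwise h b k (k / 2) E k≡ k≤ (inj₂ ≤k) sh t 3^E∣ ¬top
              (λ l δ≤l le e → ¬mid (l , δ≤l , ⇒l≤[k-1]/2 l k le , e)))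
          (linear-count-miss (k / 2 ℕ.+ E) b ¬res)
      where
      open Critical (critical δ k 1≤δ le)
      3^E∣ : 3^ E ∣ X t
      3^E∣ = ∣-trans (3^∣-mono E≤) div

    -- As k < 2δ, each parity of the quadratic class is constant modulo 3^k, so E = 0 and R = k - δ;
    -- no l ≥ δ satisfies 2l + 1 ≤ k, so there is no middle case.
    part₃ : 2 ≤ δ → ∀ k → δ ≤ k → k < 2 ℕ.* δ ℕ.∸ 1 → ∀ h → IsShortestPeriod S (3 ^ k) h → ∀ top → S w ≡ top →
        ∀ b →
        (b ≡± top [mod 3 ^ k ] → Count h k b ≡ 3 ^ (k ℕ.∸ δ))
      × (Linear-residue b → Count h k b ≡ 2)
      × (¬ (b ≡± top [mod 3 ^ k ]) → ¬ Linear-residue b → Count h k b ≡ 0)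
    part₃ 2≤δ k δ≤k k< h sh _ refl b =
        (λ e → trans (count-top 0 (lin₂ 2≤δ) h b k (k ℕ.∸ δ) 0 k≡ k≤ (inj₁ refl) sh 0 (3^0∣ (X 0))
            (subst (λ n → b ≡± S n [mod 3 ^ k ]) (sym (ℕₚ.+-identityʳ w)) e)) (ℕₚ.+-identityʳ _))
      , count-linear h b 2≤δ k (k ℕ.∸ δ ℕ.+ 0) k≡ sh
      , λ ¬top ¬res → trans
          (count-otherwise h b k (k ℕ.∸ δ) 0 k≡ k≤ (inj₁ refl) sh 0 (3^0∣ (X 0))
            (λ e → ¬top (subst (λ n → b ≡± S n [mod 3 ^ k ]) (ℕₚ.+-identityʳ w) e))
            (λ l δ≤l le _ → ℕₚ.<-irrefl refl (ℕₚ.<-≤-trans k<2δ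
                (ℕₚ.≤-trans (ℕₚ.*-monoʳ-≤ 2 δ≤l) (ℕₚ.≤-trans (ℕₚ.m≤m+n (2 ℕ.* l) 1) le)))))
          (linear-count-miss (k ℕ.∸ δ ℕ.+ 0) b ¬res)
      where
      k<2δ : k < 2 ℕ.* δ
      k<2δ = ℕₚ.<-≤-trans k< (ℕₚ.m∸n≤m (2 ℕ.* δ) 1)
      k≡ : δ ℕ.+ (k ℕ.∸ δ ℕ.+ 0) ≡ k
      k≡ = trans (cong (δ ℕ.+_) (ℕₚ.+-identityʳ _)) (ℕₚ.m+[n∸m]≡n δ≤k)
      k≤ : k ≤ (δ ℕ.+ δ) ℕ.+ 0
      k≤ = ℕₚ.≤-trans (ℕₚ.<⇒≤ k<2δ) (ℕₚ.≤-reflexive (nat δ))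
        where
        nat : ∀ δ → 2 ℕ.* δ ≡ (δ ℕ.+ δ) ℕ.+ 0
        nat = ℕ-Solver.solve-∀
      3^0∣ : ∀ x → 3^ 0 ∣ x
      3^0∣ x = divides x (sym (*-identityʳ x))

  -- The data for u and v.

  module Instances {P : ℤ} (lucas : LucasPair P) (δ : ℕ) (3∤P : Unit P) (1≤δ : 1 ≤ δ)
      (exact : ExactPower 3 δ (P * P + + 2)) where

    open Lucas lucas
    open Valuation lucas δ 3∤P 1≤δ exact

    private
      u3 : U 3 ≡ P * P + 1ℤ
      u3 = trans (rec-u 1) (cong₂ (λ x y → P * x + y) u2 u1)

      v3 : V 3 ≡ P * (P * P + + 2) + P
      v3 = trans (rec-v 1) (cong₂ (λ x y → P * x + y) v2 v1)

      3∣P²+2 : + 3 ∣ P * P + + 2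
      3∣P²+2 = ∣-trans 3∣3^δ (proj₁ exact)

      unit-u1 : Unit (U 1)
      unit-u1 = subst Unit (sym u1) 3∤1

      unit-u3 : Unit (U 3)
      unit-u3 d = 3∤1 (subst (+ 3 ∣_) (ring P) (∣m∣n⇒∣m-n 3∣P²+2 (subst (+ 3 ∣_) u3 d)))
        where
        ring : ∀ P → P * P + + 2 - (P * P + 1ℤ) ≡ 1ℤ
        ring = solve-∀

      unit-v0 : Unit (V 0)
      unit-v0 = subst Unit (sym v0) 3∤2

      unit-v1 : Unit (V 1)
      unit-v1 = subst Unit (sym v1) 3∤P

      unit-v3 : Unit (V 3)
      unit-v3 d = 3∤P (subst (+ 3 ∣_) (ring P) (∣m∣n⇒∣m-n (subst (+ 3 ∣_) v3 d) (∣n⇒∣m*n P 3∣P²+2)))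
        where
        ring : ∀ P → P * (P * P + + 2) + P - P * (P * P + + 2) ≡ P
        ring = solve-∀

      D : ℤ
      D = P * P + + 4

      unit-D : Unit D
      unit-D d = 3∤2 (subst (+ 3 ∣_) (ring P) (∣m∣n⇒∣m-n d 3∣P²+2))
        where
        ring : ∀ P → P * P + + 4 - (P * P + + 2) ≡ + 2
        ring = solve-∀

      unit-partner-v : ∀ n → Unit (U n) → Unit (partner V n)
      unit-partner-v n un = subst Unit (sym (partner-v n)) (unit-* unit-D un)

      9∣P²+2 : 2 ≤ δ → + 9 ∣ P * P + + 2
      9∣P²+2 2≤δ = ∣-trans (3^∣-mono 2≤δ) (proj₁ exact)

      -- P ≡ ±1 modulo 9 would give P² + 2 ≡ 3 modulo 9. Modulo 3 alone the congruence does hold,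
      -- whence δ ≥ 2.
      separated-u : 2 ≤ δ → ¬ (U 2 ≡± 1ℤ [mod 3 ^ δ ])
      separated-u 2≤δ e = from-no (+ 9 ∣? + 3) (subst (+ 9 ∣_) (ring P) (∣m∣n⇒∣m-n (9∣P²+2 2≤δ) product))
        where
        ring : ∀ P → P * P + + 2 - (P - 1ℤ) * (P - - 1ℤ) ≡ + 3
        ring = solve-∀
        product : + 9 ∣ (P - 1ℤ) * (P - - 1ℤ)
        product = [ (λ d → ∣m⇒∣m*n (P - - 1ℤ) (subst (λ x → + 9 ∣ x - 1ℤ) u2 (∣-trans (3^∣-mono 2≤δ) d)))
                  , (λ d → ∣n⇒∣m*n (P - 1ℤ) (subst (λ x → + 9 ∣ x - - 1ℤ) u2 (∣-trans (3^∣-mono 2≤δ) d))) ]′ e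

      -- P ≡ ±2 modulo 9 would give P² + 2 ≡ 6 modulo 9.
      separated-v : 2 ≤ δ → ¬ (V 0 ≡± P [mod 3 ^ δ ])
      separated-v 2≤δ e = from-no (+ 9 ∣? + 6) (subst (+ 9 ∣_) (ring P) (∣m∣n⇒∣m+n (9∣P²+2 2≤δ) product))
        where
        ring : ∀ P → P * P + + 2 + (+ 2 - P) * (+ 2 - - P) ≡ + 6
        ring = solve-∀
        product : + 9 ∣ (+ 2 - P) * (+ 2 - - P)
        product = [ (λ d → ∣m⇒∣m*n (+ 2 - - P) (subst (λ x → + 9 ∣ x - P) v0 (∣-trans (3^∣-mono 2≤δ) d)))
                  , (λ d → ∣n⇒∣m*n (+ 2 - P) (subst (λ x → + 9 ∣ x - - P) v0 (∣-trans (3^∣-mono 2≤δ) d))) ]′ e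

      3∤4 : Unit (+ 4)
      3∤4 = unit-* 3∤2 3∤2

      3∤8 : Unit (+ 8)
      3∤8 = unit-* 3∤2 3∤4

      3^2δ : ∀ x y → 3^ δ * x * (3^ δ * y) ≡ 3^ (δ ℕ.+ δ) * (x * y)
      3^2δ x y = trans (ring (3^ δ) x y) (cong (_* (x * y)) (sym (3^-+ δ δ)))
        where
        ring : ∀ t x y → t * x * (t * y) ≡ t * t * (x * y)
        ring = solve-∀

      -- The square is completed by 8 d (1 + 2(d + t)) = (2(t + 2d) + 1)² - (2t + 1)², where 8 is a
      -- unit.
      quad-u : ∀ t d → U (2 ℕ.+ (t ℕ.+ d ℕ.* 2) ℕ.* 4) - U (2 ℕ.+ t ℕ.* 4) ~
        3^ (δ ℕ.+ δ) * (affine (+ 2) 1ℤ (t ℕ.+ d ℕ.* 2) * affine (+ 2) 1ℤ (t ℕ.+ d ℕ.* 2) - affine (+ 2) 1ℤ t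
            * affine (+ 2) 1ℤ t)
      quad-u t d = ~-trans (~-reflexive (trans (Family.step-minus lucas δ 3∤P 1≤δ exact U rec-u 2 t d)
          (cong (U (d ℕ.* 4) *_) (partner-u ((d ℕ.+ t) ℕ.* 4 ℕ.+ 2)))))
        (~-trans (~-* (u4-val d) (v2-val (d ℕ.+ t)))
        (~-trans (~-reflexive (3^2δ (+ d) (+ (1 ℕ.+ (d ℕ.+ t) ℕ.* 2))))
        (~-trans (~-sym (~-unitˡ 3∤8)) (~-reflexive eq))))
        where
        ring : ∀ K t d → + 8 * (K * (d * (1ℤ + (d + t) * + 2))) ≡
          K * ((+ 2 * (t + d * + 2) + 1ℤ) * (+ 2 * (t + d * + 2) + 1ℤ) - (+ 2 * t + 1ℤ) * (+ 2 * t + 1ℤ))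
        ring = solve-∀
        eq : + 8 * (3^ (δ ℕ.+ δ) * (+ d * + (1 ℕ.+ (d ℕ.+ t) ℕ.* 2))) ≡
          3^ (δ ℕ.+ δ) * (affine (+ 2) 1ℤ (t ℕ.+ d ℕ.* 2) * affine (+ 2) 1ℤ (t ℕ.+ d ℕ.* 2) - affine (+ 2) 1ℤ
              t * affine (+ 2) 1ℤ t)
        eq = trans (cong (λ x → + 8 * (3^ (δ ℕ.+ δ) * (+ d * (1ℤ + x)))) (pos-* (d ℕ.+ t) 2))
          (trans (ring (3^ (δ ℕ.+ δ)) (+ t) (+ d))
          (cong (λ x → 3^ (δ ℕ.+ δ) * ((+ 2 * (+ t + x) + 1ℤ) * (+ 2 * (+ t + x) + 1ℤ) - (+ 2 * + t + 1ℤ) *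
              (+ 2 * + t + 1ℤ))) (sym (pos-* d 2))))

      -- Both factors are now values of U at multiples of 4, up to the unit P² + 4, and 4 d (d + t)
      -- = (t + 2d)² - t².
      quad-v : ∀ t d → V ((t ℕ.+ d ℕ.* 2) ℕ.* 4) - V (t ℕ.* 4) ~
        3^ (δ ℕ.+ δ) * (affine 1ℤ 0ℤ (t ℕ.+ d ℕ.* 2) * affine 1ℤ 0ℤ (t ℕ.+ d ℕ.* 2) - affine 1ℤ 0ℤ t * affine
            1ℤ 0ℤ t)
      quad-v t d = ~-trans (~-reflexive (trans (Family.step-minus lucas δ 3∤P 1≤δ exact V rec-v 0 t d)
          (trans (cong (λ n → U (d ℕ.* 4) * partner V n) (ℕₚ.+-identityʳ ((d ℕ.+ t) ℕ.* 4)))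
          (trans (cong (U (d ℕ.* 4) *_) (partner-v ((d ℕ.+ t) ℕ.* 4)))
              (swap (U (d ℕ.* 4)) D (U ((d ℕ.+ t) ℕ.* 4)))))))
        (~-trans (~-unitˡ unit-D)
        (~-trans (~-* (u4-val d) (u4-val (d ℕ.+ t)))
        (~-trans (~-reflexive (3^2δ (+ d) (+ (d ℕ.+ t))))
        (~-trans (~-sym (~-unitˡ 3∤4)) (~-reflexive eq)))))
        where
        swap : ∀ x D y → x * (D * y) ≡ D * (x * y)
        swap = solve-∀
        ring : ∀ K t d → + 4 * (K * (d * (d + t))) ≡
          K * ((1ℤ * (t + d * + 2) + 0ℤ) * (1ℤ * (t + d * + 2) + 0ℤ) - (1ℤ * t + 0ℤ) * (1ℤ * t + 0ℤ))
        ring = solve-∀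
        eq : + 4 * (3^ (δ ℕ.+ δ) * (+ d * + (d ℕ.+ t))) ≡
          3^ (δ ℕ.+ δ) * (affine 1ℤ 0ℤ (t ℕ.+ d ℕ.* 2) * affine 1ℤ 0ℤ (t ℕ.+ d ℕ.* 2) - affine 1ℤ 0ℤ t *
              affine 1ℤ 0ℤ t)
        eq = trans (ring (3^ (δ ℕ.+ δ)) (+ t) (+ d))
          (cong (λ x → 3^ (δ ℕ.+ δ) * ((1ℤ * (+ t + x) + 0ℤ) * (1ℤ * (+ t + x) + 0ℤ) - (1ℤ * + t + 0ℤ) *
              (1ℤ * + t + 0ℤ))) (sym (pos-* d 2)))

      total-u : ∀ (C : ℕ → ℕ) → (C 0 ℕ.+ C 1) ℕ.+ (C 2 ℕ.+ C 3) ≡ C 2 ℕ.+ (C 0 ℕ.+ (C 1 ℕ.+ C 3))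
      total-u C = nat (C 0) (C 1) (C 2) (C 3)
        where
        nat : ∀ a b c d → (a ℕ.+ b) ℕ.+ (c ℕ.+ d) ≡ c ℕ.+ (a ℕ.+ (b ℕ.+ d))
        nat = ℕ-Solver.solve-∀

      total-v : ∀ (C : ℕ → ℕ) → (C 0 ℕ.+ C 1) ℕ.+ (C 2 ℕ.+ C 3) ≡ C 0 ℕ.+ (C 2 ℕ.+ (C 1 ℕ.+ C 3))
      total-v C = nat (C 0) (C 1) (C 2) (C 3)
        where
        nat : ∀ a b c d → (a ℕ.+ b) ℕ.+ (c ℕ.+ d) ≡ a ℕ.+ (c ℕ.+ (b ℕ.+ d))
        nat = ℕ-Solver.solve-∀

    -- (3^j − 1)/2
    half : ℕ → ℕ
    half j = proj₁ (3^-odd j)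

    X-half : ∀ j → affine (+ 2) 1ℤ (half j) ≡ 3^ j
    X-half j = trans (ring (+ half j)) (trans (cong (λ x → 1ℤ + x) (sym (pos-* (half j) 2)))
        (cong +_ (sym (proj₂ (3^-odd j)))))
      where
      ring : ∀ t → + 2 * t + 1ℤ ≡ 1ℤ + t * + 2
      ring = solve-∀

    -- On class 2 the index 2 + 4t equals 2X, so X = 3^j belongs to the index 2·3^j.
    half-index : ∀ j → U (2 ℕ.+ half j ℕ.* 4) ≡ U (2 ℕ.* 3 ^ j)
    half-index j = cong U (trans (nat (half j)) (cong (2 ℕ.*_) (sym (proj₂ (3^-odd j)))))
      where
      nat : ∀ t → 2 ℕ.+ t ℕ.* 4 ≡ 2 ℕ.* (1 ℕ.+ t ℕ.* 2)
      nat = ℕ-Solver.solve-∀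

    private
      u3≡ : U 3 ≡± 1ℤ [mod 3 ^ δ ]
      u3≡ = inj₂ (subst (3^ δ ∣_) (trans (ring P) (cong (λ x → x - - 1ℤ) (sym u3))) (proj₁ exact))
        where
        ring : ∀ P → P * P + + 2 ≡ P * P + 1ℤ - - 1ℤ
        ring = solve-∀

      v3≡ : V 3 ≡± P [mod 3 ^ δ ]
      v3≡ = inj₁ (subst (3^ δ ∣_) (trans (ring P) (cong (_- P) (sym v3))) (∣n⇒∣m*n P (proj₁ exact)))
        where
        ring : ∀ P → P * (P * P + + 2) ≡ P * (P * P + + 2) + P - P
        ring = solve-∀

      X-id : ∀ j → affine 1ℤ 0ℤ (3 ^ j) ≡ 3^ j
      X-id j = ring (3^ j)
        where
        ring : ∀ x → 1ℤ * x + 0ℤ ≡ x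
        ring = solve-∀

    module U-family = Assembly lucas δ 3∤P 1≤δ exact U rec-u 0 2 total-u
      (subst Unit (sym (partner-u 0)) unit-v0) (subst Unit (sym (partner-u 1)) unit-v1)
          (subst Unit (sym (partner-u 3)) unit-v3)
      (divides 0ℤ u0) unit-u1 unit-u2 unit-u3 unit-u1 unit-u3 unit-u2
      1ℤ (inj₁ (subst (λ x → x ≡ 1ℤ [mod 3 ^ δ ]) (sym u1) (≡m-refl 1ℤ))) u3≡ separated-u
      (+ 2) 1ℤ 3∤2 quad-u half X-half (λ j → U (2 ℕ.* 3 ^ j)) half-index

    module V-family = Assembly lucas δ 3∤P 1≤δ exact V rec-v 2 0 total-v
      (unit-partner-v 2 unit-u2) (unit-partner-v 1 unit-u1) (unit-partner-v 3 unit-u3)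
      3^δ∣v2 unit-v3 (unit-+4t rec-v 0 unit-v0 1) (unit-+4t rec-v 1 unit-v1 1) unit-v1 unit-v3 unit-v0
      P (inj₁ (subst (λ x → x ≡ P [mod 3 ^ δ ]) (sym v1) (≡m-refl P))) v3≡ separated-v
      1ℤ 0ℤ 3∤1 quad-v (3 ^_) X-id (λ j → V (4 ℕ.* 3 ^ j)) (λ j → cong V (ℕₚ.*-comm (3 ^ j) 4))

    top-u : ∀ e → 3^ e ∣ affine (+ 2) 1ℤ (half e)
    top-u e = divides 1ℤ (trans (X-half e) (sym (*-identityˡ (3^ e))))

    -- For v the point X = 0 is attained at t = 0, so V 0 = 2 serves for every k. For u, X = 1 + 2t
    -- never vanishes, and the index has to grow with k.
    top-v : ∀ e → 3^ e ∣ affine 1ℤ 0ℤ 0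
    top-v e = divides 0ℤ refl

open import Data.Integer.Base using (ℤ; +_; 0ℤ; 1ℤ)
open import Data.Integer.Divisibility.Signed using (_∣_)
open import Data.Nat.Base using (ℕ; _+_; _*_; _∸_; _^_; _/_; _≤_; _<_)
open import Data.Nat.Properties using (m^n≢0)
open import Data.Product.Base using (∃; _×_; _,_)
open import Data.Sum.Base using (_⊎_)
open import Relation.Binary.PropositionalEquality using (_≡_; refl)
open import Relation.Nullary using (¬_)
import Data.Integer.Base as ℤ

theorem1 : (P : ℤ) (δ : ℕ) → ¬ (+ 3 ∣ P) → 1 ≤ δ → ExactPower 3 δ (P ℤ.* P ℤ.+ + 2) →
  -- 1)
  (δ ≡ 1 → (k : ℕ) → 1 ≤ k → (b : ℤ) →
    ( (b ≡± u P (2 * 3 ^ (2 * ((k ∸ 1) / 4) + 1)) [mod 3 ^ k ] →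
         v-u P (3 ^ k) {{m^n≢0 3 k}} b ≡ 3 ^ (k / 2) + 2)
    × ((l : ℕ) → 1 ≤ l → l ≤ (k ∸ 1) / 2 →
         b ≡± u P (2 * 3 ^ (l ∸ 1)) [mod 3 ^ (2 * l + 1) ] →
         v-u P (3 ^ k) {{m^n≢0 3 k}} b ≡ 2 * 3 ^ l + 2)
    × (¬ (b ≡± u P (2 * 3 ^ (2 * ((k ∸ 1) / 4) + 1)) [mod 3 ^ k ]) →
       ¬ (∃ λ l → 1 ≤ l × l ≤ (k ∸ 1) / 2 ×
            b ≡± u P (2 * 3 ^ (l ∸ 1)) [mod 3 ^ (2 * l + 1) ]) →
         v-u P (3 ^ k) {{m^n≢0 3 k}} b ≡ 2))
    ×
    ( (b ≡± + 2 [mod 3 ^ k ] →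
         v-v P (3 ^ k) {{m^n≢0 3 k}} b ≡ 3 ^ (k / 2) + 2)
    × ((l : ℕ) → 1 ≤ l → l ≤ (k ∸ 1) / 2 →
         b ≡± v P (4 * 3 ^ (l ∸ 1)) [mod 3 ^ (2 * l + 1) ] →
         v-v P (3 ^ k) {{m^n≢0 3 k}} b ≡ 2 * 3 ^ l + 2)
    × (¬ (b ≡± + 2 [mod 3 ^ k ]) →
       ¬ (∃ λ l → 1 ≤ l × l ≤ (k ∸ 1) / 2 ×
            b ≡± v P (4 * 3 ^ (l ∸ 1)) [mod 3 ^ (2 * l + 1) ]) →
         v-v P (3 ^ k) {{m^n≢0 3 k}} b ≡ 2)))
  ×
  -- 2)
  (2 ≤ δ → (k : ℕ) → 1 ≤ k → 2 * δ ∸ 1 ≤ k → (b : ℤ) →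
    ( (b ≡± u P (2 * 3 ^ (2 * ((k + 1 ∸ 2 * δ) / 4) + 1)) [mod 3 ^ k ] →
         v-u P (3 ^ k) {{m^n≢0 3 k}} b ≡ 3 ^ (k / 2))
    × ((l : ℕ) → δ ≤ l → l ≤ (k ∸ 1) / 2 →
         b ≡± u P (2 * 3 ^ (l ∸ δ)) [mod 3 ^ (2 * l + 1) ] →
         v-u P (3 ^ k) {{m^n≢0 3 k}} b ≡ 2 * 3 ^ l)
    × (b ≡ 0ℤ [mod 3 ^ δ ] ⊎ b ≡± 1ℤ [mod 3 ^ δ ] →
         v-u P (3 ^ k) {{m^n≢0 3 k}} b ≡ 2)
    × (¬ (b ≡± u P (2 * 3 ^ (2 * ((k + 1 ∸ 2 * δ) / 4) + 1)) [mod 3 ^ k ]) →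
       ¬ (∃ λ l → δ ≤ l × l ≤ (k ∸ 1) / 2 ×
            b ≡± u P (2 * 3 ^ (l ∸ δ)) [mod 3 ^ (2 * l + 1) ]) →
       ¬ (b ≡ 0ℤ [mod 3 ^ δ ] ⊎ b ≡± 1ℤ [mod 3 ^ δ ]) →
         v-u P (3 ^ k) {{m^n≢0 3 k}} b ≡ 0))
    ×
    ( (b ≡± + 2 [mod 3 ^ k ] →
         v-v P (3 ^ k) {{m^n≢0 3 k}} b ≡ 3 ^ (k / 2))
    × ((l : ℕ) → δ ≤ l → l ≤ (k ∸ 1) / 2 →
         b ≡± v P (4 * 3 ^ (l ∸ δ)) [mod 3 ^ (2 * l + 1) ] →
         v-v P (3 ^ k) {{m^n≢0 3 k}} b ≡ 2 * 3 ^ l)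
    × (b ≡ 0ℤ [mod 3 ^ δ ] ⊎ b ≡± P [mod 3 ^ δ ] →
         v-v P (3 ^ k) {{m^n≢0 3 k}} b ≡ 2)
    × (¬ (b ≡± + 2 [mod 3 ^ k ]) →
       ¬ (∃ λ l → δ ≤ l × l ≤ (k ∸ 1) / 2 ×
            b ≡± v P (4 * 3 ^ (l ∸ δ)) [mod 3 ^ (2 * l + 1) ]) →
       ¬ (b ≡ 0ℤ [mod 3 ^ δ ] ⊎ b ≡± P [mod 3 ^ δ ]) →
         v-v P (3 ^ k) {{m^n≢0 3 k}} b ≡ 0)))
  ×
  -- 3)
  (2 ≤ δ → (k : ℕ) → 1 ≤ k → δ ≤ k → k < 2 * δ ∸ 1 → (b : ℤ) →
    ( (b ≡± P [mod 3 ^ k ] →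
         v-u P (3 ^ k) {{m^n≢0 3 k}} b ≡ 3 ^ (k ∸ δ))
    × (b ≡ 0ℤ [mod 3 ^ δ ] ⊎ b ≡± 1ℤ [mod 3 ^ δ ] →
         v-u P (3 ^ k) {{m^n≢0 3 k}} b ≡ 2)
    × (¬ (b ≡± P [mod 3 ^ k ]) →
       ¬ (b ≡ 0ℤ [mod 3 ^ δ ] ⊎ b ≡± 1ℤ [mod 3 ^ δ ]) →
         v-u P (3 ^ k) {{m^n≢0 3 k}} b ≡ 0))
    ×
    ( (b ≡± + 2 [mod 3 ^ k ] →
         v-v P (3 ^ k) {{m^n≢0 3 k}} b ≡ 3 ^ (k ∸ δ))
    × (b ≡ 0ℤ [mod 3 ^ δ ] ⊎ b ≡± P [mod 3 ^ δ ] →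
         v-v P (3 ^ k) {{m^n≢0 3 k}} b ≡ 2)
    × (¬ (b ≡± + 2 [mod 3 ^ k ]) →
       ¬ (b ≡ 0ℤ [mod 3 ^ δ ] ⊎ b ≡± P [mod 3 ^ δ ]) →
         v-v P (3 ^ k) {{m^n≢0 3 k}} b ≡ 0)))
theorem1 P δ 3∤P 1≤δ exact =
    (λ δ≡1 k 1≤k b →
        U-family.part₁ δ≡1 k 1≤k (h-u P (3 ^ k) {{m^n≢0 3 k}}) (h-u-spec P (3 ^ k) {{m^n≢0 3 k}})
          _ (half (top₁ k)) (top-u (top₁ k)) (half-index (top₁ k)) b
      , V-family.part₁ δ≡1 k 1≤k (h-v P (3 ^ k) {{m^n≢0 3 k}}) (h-v-spec P (3 ^ k) {{m^n≢0 3 k}})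
          (+ 2) 0 (top-v (top₁ k)) refl b)
  , (λ 2≤δ k 1≤k 2δ-1≤k b →
        U-family.part₂ 2≤δ k 1≤k 2δ-1≤k (h-u P (3 ^ k) {{m^n≢0 3 k}}) (h-u-spec P (3 ^ k) {{m^n≢0 3 k}})
          _ (half (top₂ k)) (top-u (top₂ k)) (half-index (top₂ k)) b
      , V-family.part₂ 2≤δ k 1≤k 2δ-1≤k (h-v P (3 ^ k) {{m^n≢0 3 k}}) (h-v-spec P (3 ^ k) {{m^n≢0 3 k}})
          (+ 2) 0 (top-v (top₂ k)) refl b)
  , (λ 2≤δ k 1≤k δ≤k k<2δ-1 b →
        U-family.part₃ 2≤δ k δ≤k k<2δ-1 (h-u P (3 ^ k) {{m^n≢0 3 k}}) (h-u-spec P (3 ^ k) {{m^n≢0 3 k}}) P (Lucas.u2 lucas) b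
      , V-family.part₃ 2≤δ k δ≤k k<2δ-1 (h-v P (3 ^ k) {{m^n≢0 3 k}}) (h-v-spec P (3 ^ k) {{m^n≢0 3 k}}) (+ 2) refl b)
  where
  lucas : LucasPair P
  lucas = record
    { U = u P ; V = v P ; rec-u = λ _ → refl ; rec-v = λ _ → refl
    ; u0 = refl ; u1 = refl ; v0 = refl ; v1 = refl }
  open Instances lucas δ 3∤P 1≤δ exact
  top₁ top₂ : ℕ → ℕ
  top₁ k = 2 * ((k ∸ 1) / 4) + 1
  top₂ k = 2 * ((k + 1 ∸ 2 * δ) / 4) + 1
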